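{- The following problem is in $\mathsf{P}$: given a declining temporal reachability game (a temporal graph $G=(V,E)$ with a partition $V=V_1\uplus V_2$ such that the game is declining, a target set $F\subseteq V$ and an initial vertex $s_0\in V$), with edges given by inequality constraints with binary-encoded constants, decide whether Player 1 wins from $s_0$ starting at time $0$. The same holds with "improving" in place of "declining".
   Context: A temporal graph $G=(V,E)$ consists of a finite set $V$ of vertices and an edge availability relation $E:V^2\to 2^{\mathbb{N}}$; write $u\xrightarrow{i}v$ iff $i\in E(u,v)$. The edge from $u$ to $v$ is decreasing if for all $i\in\mathbb{N}$, $u\xrightarrow{i+1}v$ implies $u\xrightarrow{i}v$; it is increasing if for all $i\in\mathbb{N}$, $u\xrightarrow{i}v$ implies $u\xrightarrow{i+1}v$. Representation: each decreasing edge is given by a constraint of the form $x\le n$ and each increasing edge by a constraint $x\ge n$, with $n\in\mathbb{N}$ in binary, describing the times $x$ at which it is available; a pair may also be declared to be never available (no edge) or always available. Let $V=V_1\uplus V_2$ be a partition into vertices owned by Player 1 and Player 2. The game is declining if all edges out of $V_1$ are decreasing and all edges out of $V_2$ are increasing. It is improving if all edges out of $V_1$ are increasing and all edges out of $V_2$ are decreasing. The reachability game is played on the expansion, the directed graph on $V\times\mathbb{N}$ with edges $(s,i)\to(t,i+1)$ iff $i\in E(s,t)$, where $V_i\times\mathbb{N}$ is owned by Player $i$. The owner of the current vertex moves the token to a successor. Player 1 wins a play iff it visits a vertex of $F\times\mathbb{N}$; convention for dead ends: if the target has not been visited and the player to move has no available successor, that player loses. Player 1 wins from $s_0$ at time $0$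 if she has a strategy such that she wins every consistent play from $(s_0,0)$. -}

module Defs where

open import Data.Bool using (Bool; true)
open import Data.Digit using (Bit; 0b; 1b; Expansion; fromDigits)
open import Data.Fin using (Fin; toℕ)
open import Data.Fin.Subset using (Subset; Side; inside; outside; _∈_)
open import Data.List using (List; []; _∷_; [_]; _++_; map; length; replicate)
open import Data.Maybe using (Maybe; just; nothing)
open import Data.Nat using (ℕ; zero; suc; _+_; _*_; _^_; _≤_)
open import Data.Product using (_×_; _,_; ∃; ∃₂; proj₁; proj₂)
open import Data.Sum using (_⊎_)
open import Data.Unit using (⊤)
open import Data.Empty using (⊥)
open import Data.Vec using (Vec; lookup; zipWith)
import Data.Vec as Vec
open import Data.List.Relation.Unary.Any using (Any)
open import Function using (_↔_; _⇔_)
open import Level using (0ℓ)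
open import Relation.Nullary using (¬_)
open import Relation.Unary using (Pred)
open import Relation.Binary.PropositionalEquality using (_≡_)

------------------------------------------------------------------------
-- Temporal graphs and games

Decreasing : Pred ℕ 0ℓ → Set
Decreasing A = ∀ i → A (suc i) → A i

Increasing : Pred ℕ 0ℓ → Set
Increasing A = ∀ i → A i → A (suc i)

data Player : Set where
  player₁ player₂ : Player

record TemporalGame : Set₁ where
  field
    size   : ℕ
  V : Set
  V = Fin size
  field
    E      : V → V → Pred ℕ 0ℓ
    owner  : V → Player
    target : Subset size
    source : V

  Declining : Set
  Declining = ∀ u v → (owner u ≡ player₁ → Decreasing (E u v))
                    × (owner u ≡ player₂ → Increasing (E u v))

  Improving : Set
  Improving = ∀ u v → (owner u ≡ player₁ → Increasing (E u v))
                    × (owner u ≡ player₂ → Decreasing (E u v))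

  Position : Set
  Position = V × ℕ

  infix 4 _⟶_
  _⟶_ : Position → Position → Set
  (s , i) ⟶ (t , j) = j ≡ suc i × E s t i

  DeadEnd : Position → Set
  DeadEnd p = ¬ ∃ λ q → p ⟶ q

  ownerOf : Position → Player
  ownerOf p = owner (proj₁ p)

  InTarget : Position → Set
  InTarget p = proj₁ p ∈ target

  -- The positions visited before the current one, most recent first.
  History : Set
  History = List Position

  -- Player 1's next position, given the history and the current position.
  -- Only the values at positions of Player 1 that are not dead ends matter.
  Strategy : Set
  Strategy = History → Position → Position

  Legal : Strategy → Set
  Legal σ = ∀ h p → ownerOf p ≡ player₁ → (∃ λ q → p ⟶ q) → p ⟶ σ h p

  data Consistent (σ : Strategy) (p₀ : Position) : History → Position → Set where
    start : Consistent σ p₀ [] p₀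
    step  : ∀ {h p q} → Consistent σ p₀ h p → p ⟶ q →
            (ownerOf p ≡ player₁ → q ≡ σ h p) →
            Consistent σ p₀ (p ∷ h) q

  before : (ℕ → Position) → ℕ → History
  before π zero    = []
  before π (suc n) = π n ∷ before π n

  -- A complete play either stops at a dead end or is infinite.
  record Winning (σ : Strategy) (p₀ : Position) : Set where
    field
      legal    : Legal σ
      finite   : ∀ h p → Consistent σ p₀ h p → DeadEnd p →
                 Any InTarget (p ∷ h) ⊎ ownerOf p ≡ player₂
      infinite : ∀ π → (∀ n → Consistent σ p₀ (before π n) (π n)) →
                 ∃ λ n → InTarget (π n)

  Player₁Wins : Set
  Player₁Wins = ∃ λ σ → Winning σ (source , 0)

------------------------------------------------------------------------
-- Games given by inequality constraints

-- Constants are binary numerals, least significant bit first.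
data Constraint : Set where
  never always : Constraint
  x≤_ x≥_      : Expansion 2 → Constraint

Available : Constraint → Pred ℕ 0ℓ
Available never  x = ⊥
Available always x = ⊤
Available (x≤ b) x = x ≤ fromDigits b
Available (x≥ b) x = fromDigits b ≤ x

record Instance : Set where
  field
    size        : ℕ
    constraints : Vec (Vec Constraint size) size
    owners      : Vec Player size
    target      : Subset size
    source      : Fin size

⟦_⟧ : Instance → TemporalGame
⟦ G ⟧ = record
  { size   = size
  ; E      = λ u v → Available (lookup (lookup constraints u) v)
  ; owner  = lookup owners
  ; target = target
  ; source = source
  }
  where open Instance G

------------------------------------------------------------------------
-- Encoding of instances as bit strings

encodeUnary : ℕ → List Bit
encodeUnary n = replicate n 1b ++ [ 0b ]

-- Self-delimiting: every digit is preceded by 1, and 0 ends the numeral.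
encodeNumeral : Expansion 2 → List Bit
encodeNumeral []       = 0b ∷ []
encodeNumeral (d ∷ ds) = 1b ∷ d ∷ encodeNumeral ds

encodeConstraint : Constraint → List Bit
encodeConstraint never  = 0b ∷ 0b ∷ []
encodeConstraint always = 0b ∷ 1b ∷ []
encodeConstraint (x≤ b) = 1b ∷ 0b ∷ encodeNumeral b
encodeConstraint (x≥ b) = 1b ∷ 1b ∷ encodeNumeral b

encodePlayer : Player → List Bit
encodePlayer player₁ = [ 0b ]
encodePlayer player₂ = [ 1b ]

encodeSide : Side → List Bit
encodeSide outside = [ 0b ]
encodeSide inside  = [ 1b ]

encodeVec : ∀ {A : Set} {n} → (A → List Bit) → Vec A n → List Bit
encodeVec f = Vec.foldr′ (λ a w → f a ++ w) []

-- Vertices are in unary; an instance lists all pairs of vertices anyway, so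
-- this changes its length only polynomially.
encode : Instance → List Bit
encode G = encodeUnary size
        ++ encodeUnary (toℕ source)
        ++ encodeVec encodePlayer owners
        ++ encodeVec encodeSide target
        ++ encodeVec (encodeVec encodeConstraint) constraints
  where open Instance G

Language : Set₁
Language = Pred (List Bit) 0ℓ

DecliningReachability : Language
DecliningReachability w = ∃ λ G → encode G ≡ w ×
  TemporalGame.Declining ⟦ G ⟧ × TemporalGame.Player₁Wins ⟦ G ⟧

ImprovingReachability : Language
ImprovingReachability w = ∃ λ G → encode G ≡ w ×
  TemporalGame.Improving ⟦ G ⟧ × TemporalGame.Player₁Wins ⟦ G ⟧

------------------------------------------------------------------------
-- Deterministic multi-tape Turing machines and the class P

Finite : Set → Set
Finite A = ∃ λ n → A ↔ Fin n

data Symbol (W : Set) : Set where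
  blank : Symbol W
  bit   : Bit → Symbol W
  work  : W → Symbol W

data Move : Set where
  left stay right : Move

data Action (Q Γ : Set) (k : ℕ) : Set where
  halt : (accept : Bool) → Action Q Γ k
  step : Q → Vec (Γ × Move) k → Action Q Γ k

-- A two-way infinite tape, blank outside the recorded part; both lists start
-- next to the head.
record Tape (W : Set) : Set where
  constructor tape
  field
    leftOf  : List (Symbol W)
    head    : Symbol W
    rightOf : List (Symbol W)

module _ {W : Set} where

  emptyTape : Tape W
  emptyTape = tape [] blank []

  inputTape : List Bit → Tape W
  inputTape []      = emptyTape
  inputTape (b ∷ w) = tape [] (bit b) (map bit w)

  act : Symbol W × Move → Tape W → Tape W
  act (a , stay)  (tape ls       _ rs)       = tape ls a rs
  act (a , left)  (tape []       _ rs)       = tape [] blank (a ∷ rs)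
  act (a , left)  (tape (l ∷ ls) _ rs)       = tape ls l (a ∷ rs)
  act (a , right) (tape ls       _ [])       = tape (a ∷ ls) blank []
  act (a , right) (tape ls       _ (r ∷ rs)) = tape (a ∷ ls) r rs

record TuringMachine : Set₁ where
  field
    State       : Set
    Work        : Set
    stateFinite : Finite State
    workFinite  : Finite Work
    extraTapes  : ℕ

  tapes : ℕ
  tapes = suc extraTapes

  field
    initial : State
    δ       : State → Vec (Symbol Work) tapes → Action State (Symbol Work) tapes

  Configuration : Set
  Configuration = State × Vec (Tape Work) tapes

  load : List Bit → Configuration
  load w = initial , inputTape w Vec.∷ Vec.replicate extraTapes emptyTape

  -- The verdict, if the machine halts within the given number of steps.
  run : ℕ → Configuration → Maybe Bool
  run zero    _        = nothing
  run (suc t) (q , ts) with δ q (Vec.map Tape.head ts)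
  ... | halt b     = just b
  ... | step q′ as = run t (q′ , zipWith act as ts)

  DecidesInTime : Language → (ℕ → ℕ) → Set
  DecidesInTime L time = ∀ w →
    ∃ λ b → run (time (length w)) (load w) ≡ just b × (b ≡ true ⇔ L w)

-- Every polynomial is bounded by one of the form c * n ^ d + c.
_∈P : Language → Set₁
L ∈P = ∃ λ M → ∃₂ λ c d →
  TuringMachine.DecidesInTime M L (λ n → c * n ^ d + c)

{-# OPTIONS --safe #-}
module Submission where

-- Let A be the player who owns the decreasing edges. The earlier the time, the
-- more moves A and the fewer moves the opponent has, so a win of A within a
-- bounded number of steps is also one at every earlier time. A play that
-- postpones a win of A by returning to a vertex can therefore be short-circuited,
-- and n rounds suffice for n vertices.
--
-- If A is player 1, backward induction over the times b − 1, …, 0 for any b ≥ n,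
-- starting from the targets, computes the winning region at time 0. If A is
-- player 2, then A wins by reaching, off the targets, a dead end of player 1 or a
-- vertex outside the attractor of the targets in the limit graph, whose edges
-- are the ones eventually available; so the same induction, started from this
-- attractor, is correct. Starting from the attractor is harmless in the first
-- case. Both phases are iterations of one update of a set of vertices, which
-- compares the constants with a time below the length of the input.

open import Defs
open import Data.Bool using (Bool; true; false; if_then_else_; not; _∧_; _∨_)
open import Data.Bool.Properties using (∧-conicalˡ; ¬-not)
open import Data.Digit using (Bit; 1b; Expansion; fromDigits)
open import Data.Empty using (⊥; ⊥-elim)
open import Data.Fin using (Fin; zero; suc; toℕ; fromℕ<; _↑ˡ_; _↑ʳ_; #_)
open import Data.Fin.Properties using (+↔⊎; *↔×; any?; all?; pigeonhole; ¬∀⟶∃¬; toℕ<n; toℕ-fromℕ<)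
  renaming (_≟_ to _≟ᶠ_)
open import Data.Fin.Subset using (Subset; Side; inside; outside; _∈_)
open import Data.Fin.Subset.Properties using (_∈?_)
open import Data.List using (List; []; _∷_; _++_; [_]; length; drop; _ʳ++_; replicate; map)
import Data.List as List
open import Data.List.Properties using (ʳ++-ʳ++; ++-ʳ++; ++-identityʳ; ++-assoc; length-ʳ++; length-++-≤ˡ; length-++-≤ʳ)
open import Data.List.Relation.Unary.Any using (Any; here; there)
open import Data.Maybe using (Maybe; just; nothing; is-just)
import Data.Maybe as Maybe
open import Data.Nat using (ℕ; zero; suc; _+_; _*_; _^_; _∸_; _≤_; _<_; z≤n; s≤s; _⊔_)
open import Data.Nat.Properties
open import Data.Nat.Solver using (module +-*-Solver)
open import Data.Product using (_×_; _,_; ∃; ∃₂; proj₁; proj₂; Σ)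
open import Data.Sum using (_⊎_; inj₁; inj₂)
open import Data.Sum.Function.Propositional using (_⊎-↔_)
open import Data.Product.Function.NonDependent.Propositional using (_×-↔_)
open import Data.Unit using (⊤; tt)
open import Data.Vec using (Vec; []; _∷_; lookup; zipWith; tabulate; updateAt)
import Data.Vec as Vec
open import Data.Vec.Properties using ([]=⇒lookup; lookup⇒[]=; lookup-zipWith; lookup-map; lookup-++ˡ; lookup-++ʳ; lookup∘tabulate; lookup∘updateAt; lookup∘updateAt′; updateAt-id-local; updateAt-cong-local; updateAt-updateAt; lookup-replicate)
open import Function using (_↔_; _⇔_; _∘_; id; case_of_; mk⇔; mk↔ₛ′; Equivalence)
open import Function.Construct.Identity using (↔-id)
open import Function.Properties.Equivalence using () renaming (trans to ⇔-trans)
open import Function.Properties.Inverse using (↔-sym; ↔-trans)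
open import Level using (0ℓ)
open import Relation.Nullary using (¬_; Dec; yes; no; does; contradiction)
open import Relation.Nullary.Decidable using (_×-dec_; _→-dec_; ¬?; decidable-stable; map′)
open import Relation.Unary using (Pred; _⊆_; Decidable)
open import Relation.Binary.PropositionalEquality using (_≡_; _≢_; refl; sym; trans; cong; cong₂; subst; module ≡-Reasoning)

-- Loop programs on multi-tape Turing machines

-- The theorem speaks of Turing machines, so a machine and its running time must be given. It is
-- compiled from a small language whose loops all make N rounds, N being the length of the input.
-- Loops cannot stop early, and this shapes the algorithm: programs idle once their work is done,
-- and the machine makes N + 1 rounds for the attractor and N rounds of backward induction instead
-- of n. These counts are legitimate because the stability lemmas allow every number of rounds from
-- n on. The binary constants are the other obstacle. In an improving game the edges may settle only
-- at a time exponential in N, and player 1 may have to play that long. This horizon never enters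
-- the computation: in the proof, stability prolongs the N computed rounds until the horizon is
-- reached. Finally, the languages contain only well-formed codes of games of the right kind, so the
-- machine also has to parse and to reject. Its checks accumulate in one flag that never recovers;
-- hence a successful run has passed every check on its way, and the form of the input can be read
-- off from it.

Finite-⊤ : Finite ⊤
Finite-⊤ = 1 , mk↔ₛ′ (λ _ → zero) (λ _ → tt) (λ { zero → refl }) (λ _ → refl)

Finite-Bool : Finite Bool
Finite-Bool = 2 , mk↔ₛ′ (λ { false → zero ; true → suc zero }) (λ { zero → false ; (suc zero) → true })
  (λ { zero → refl ; (suc zero) → refl }) (λ { false → refl ; true → refl })

Finite-⊎ : ∀ {A B : Set} → Finite A → Finite B → Finite (A ⊎ B)
Finite-⊎ (m , f) (n , g) = m + n , ↔-trans (f ⊎-↔ g) (↔-sym +↔⊎)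

Finite-× : ∀ {A B : Set} → Finite A → Finite B → Finite (A × B)
Finite-× (m , f) (n , g) = m * n , ↔-trans (f ×-↔ g) (↔-sym *↔×)

Finite-↔ : ∀ {A B : Set} → A ↔ B → Finite B → Finite A
Finite-↔ f (n , g) = n , ↔-trans f g

Finite-Maybe : ∀ {A : Set} → Finite A → Finite (Maybe A)
Finite-Maybe {A} fin = Finite-↔ (mk↔ₛ′ to from to∘from from∘to) (Finite-⊎ fin Finite-⊤)
  where
  to : Maybe A → A ⊎ ⊤
  to (just a) = inj₁ a
  to nothing  = inj₂ tt
  from : A ⊎ ⊤ → Maybe A
  from (inj₁ a) = just a
  from (inj₂ _) = nothing
  to∘from : ∀ s → to (from s) ≡ s
  to∘from (inj₁ _) = refl
  to∘from (inj₂ _) = refl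
  from∘to : ∀ m → from (to m) ≡ m
  from∘to (just _) = refl
  from∘to nothing  = refl

-- Zippers as contents of tapes

iterate : ∀ {A : Set} → ℕ → (A → A) → A → A
iterate zero    f x = x
iterate (suc n) f x = iterate n f (f x)

-- The part of a tape left of the head (nearest cell first) and the part from
-- the head on.
Zipper : Set
Zipper = List Bit × List Bit

data Op : Set where
  keep advance : Op
  write        : Bit → Op

-- Writing also advances; advancing stops at the right end of the contents.
perform : Op → Zipper → Zipper
perform keep      z           = z
perform advance   (l , [])    = l , []
perform advance   (l , x ∷ r) = x ∷ l , r
perform (write b) (l , r)     = b ∷ l , drop 1 r

retreat : Zipper → Zipper
retreat ([] , r)    = [] , r
retreat (x ∷ l , r) = l , x ∷ r

scanned : Zipper → Maybe Bit
scanned (_ , r) = List.head r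

Sym : Set
Sym = Symbol (Fin 0)

symbolBit : Sym → Maybe Bit
symbolBit blank    = nothing
symbolBit (bit b)  = just b
symbolBit (work _) = nothing

infix 4 _∼_
-- A visited cell beyond the contents becomes an explicit blank, so a list of bits has many
-- representations. Blanks may only follow the last bit.
data _∼_ : List Sym → List Bit → Set where
  empty : [] ∼ []
  pad   : ∀ {ss} → ss ∼ [] → blank ∷ ss ∼ []
  cell  : ∀ {ss bs b} → ss ∼ bs → bit b ∷ ss ∼ b ∷ bs

Represents : Zipper → Tape (Fin 0) → Set
Represents (l , r) (tape ls h rs) = ls ∼ l × h ∷ rs ∼ r

-- The one situation that no zipper describes: the head has stepped onto the blank before the first
-- cell. It arises whenever a head moves back past the left end, and the next move to the right ends
-- it.
LeftOf : List Bit → Tape (Fin 0) → Set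
LeftOf r (tape ls h rs) = ls ∼ [] × h ≡ blank × rs ∼ r

∼-map : ∀ w → map bit w ∼ w
∼-map []      = empty
∼-map (b ∷ w) = cell (∼-map w)

represents-input : ∀ w → Represents ([] , w) (inputTape w)
represents-input []      = empty , pad empty
represents-input (b ∷ w) = empty , cell (∼-map w)

represents-empty : Represents ([] , []) emptyTape
represents-empty = empty , pad empty

symbolBit-head : ∀ {z} t → Represents z t → symbolBit (Tape.head t) ≡ scanned z
symbolBit-head (tape ls .blank rs)   (_ , pad _)  = refl
symbolBit-head (tape ls .(bit _) rs) (_ , cell _) = refl

head-blank : ∀ {l} t → Represents (l , []) t → Tape.head t ≡ blank
head-blank (tape ls .blank rs) (_ , pad _) = refl

head-bit : ∀ {l x r} t → Represents (l , x ∷ r) t → Tape.head t ≡ bit x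
head-bit (tape ls .(bit _) rs) (_ , cell _) = refl

act-stay : ∀ {z} t → Represents z t → Represents z (act (Tape.head t , stay) t)
act-stay (tape ls h rs) rep = rep

act-right : ∀ {l r b} t → Represents (l , r) t → Represents (b ∷ l , drop 1 r) (act (bit b , right) t)
act-right (tape ls _ [])       (p , pad q)        = cell p , pad empty
act-right (tape ls _ (_ ∷ _))  (p , pad q)        = cell p , q
act-right (tape ls _ [])       (p , cell empty)   = cell p , pad empty
act-right (tape ls _ (_ ∷ _))  (p , cell q)       = cell p , q

act-left : ∀ {x l r} t → Represents (x ∷ l , r) t → Represents (l , x ∷ r) (act (Tape.head t , left) t)
act-left (tape (_ ∷ ls) h rs) (cell p , q) = p , cell q

act-left-end : ∀ {r} t → Represents ([] , r) t → LeftOf r (act (Tape.head t , left) t)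
act-left-end (tape []       h rs) (p , q)     = empty , refl , q
act-left-end (tape (_ ∷ ls) h rs) (pad p , q) = p , refl , q

act-right-end : ∀ {r} t → LeftOf r t → Represents ([] , r) (act (Tape.head t , right) t)
act-right-end (tape ls .blank [])       (p , refl , empty) = pad p , pad empty
act-right-end (tape ls .blank (_ ∷ _))  (p , refl , q)     = pad p , q

head-leftOf : ∀ {r} t → LeftOf r t → Tape.head t ≡ blank
head-leftOf (tape _ _ _) (_ , eq , _) = eq

hold : Sym → Sym × Move
hold s = s , stay

moveLeft moveRight : Sym → Sym × Move
moveLeft s  = s , left
moveRight s = s , right

opAction : Op → Sym → Sym × Move
opAction keep      s       = s , stay
opAction advance   blank   = blank , stay
opAction advance   s       = s , right
opAction (write b) _       = bit b , right

act-op : ∀ o {z} t → Represents z t → Represents (perform o z) (act (opAction o (Tape.head t)) t)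
act-op keep      t rep = act-stay t rep
act-op advance {l , []}    t@(tape ls .blank rs)   rep@(_ , pad _)  = act-stay t rep
act-op advance {l , x ∷ r} t@(tape ls .(bit _) rs) rep@(_ , cell _) = act-right t rep
act-op (write b) {l , r} t rep = act-right t rep

-- Programs on k + 1 data tapes with registers R. Every loop makes as many
-- rounds as the input has symbols, so that running times are polynomial by
-- construction. It counts them by moving along its own clock tape, which holds
-- a copy of the input; programs in Prog n only move the first n clocks.

module Language (k D : ℕ) (R : Set) where

  Heads : Set
  Heads = Vec (Maybe Bit) (suc k)

  infixr 5 _⨾_
  data Prog : ℕ → Set where
    basic : ∀ {n} → (R → Heads → R × Vec Op (suc k)) → Prog n
    check : ∀ {n} → (R → Heads → Bool) → Prog n
    back  : ∀ {n} → Fin (suc k) → Prog n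
    _⨾_   : ∀ {n} → Prog n → Prog n → Prog n
    when  : ∀ {n} → (R → Heads → Bool) → Prog n → Prog n
    loop  : ∀ {n} (c : Fin D) → toℕ c < n → Prog (toℕ c) → Prog n

  -- The boolean records whether all checks have succeeded so far.
  Control : Set
  Control = Bool × R

  Memory : Set
  Memory = Control × Vec Zipper (suc k)

  ⟪_⟫ : ∀ {n} → Prog n → ℕ → Memory → Memory
  ⟪ basic f ⟫    N ((o , r) , zs) =
    (o , proj₁ (f r (Vec.map scanned zs))) , zipWith perform (proj₂ (f r (Vec.map scanned zs))) zs
  ⟪ check g ⟫    N ((o , r) , zs) = (o ∧ g r (Vec.map scanned zs) , r) , zs
  ⟪ back j ⟫     N (q , zs)       = q , updateAt zs j retreat
  ⟪ p ⨾ p′ ⟫     N m              = ⟪ p′ ⟫ N (⟪ p ⟫ N m)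
  ⟪ when g p ⟫   N (q , zs)       =
    if g (proj₂ q) (Vec.map scanned zs) then ⟪ p ⟫ N (q , zs) else (q , zs)
  ⟪ loop c _ p ⟫ N m              = iterate N (⟪ p ⟫ N) m

  passed : Memory → Bool
  passed = proj₁ ∘ proj₁

  failed-iterate : ∀ {f} → (∀ m → passed m ≡ false → passed (f m) ≡ false) →
                   ∀ j m → passed m ≡ false → passed (iterate j f m) ≡ false
  failed-iterate stays zero    m e = e
  failed-iterate stays (suc j) m e = failed-iterate stays j _ (stays m e)

  -- A check only conjoins to the flag. Read contrapositively, success at the end gives success at
  -- every intermediate point, on which all soundness lemmas rest.
  failed-stays : ∀ {n} (p : Prog n) N m → passed m ≡ false → passed (⟪ p ⟫ N m) ≡ false
  failed-stays (basic f)    N m          e = e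
  failed-stays (check g)    N ((o , r) , zs) refl = refl
  failed-stays (back j)     N m          e = e
  failed-stays (p ⨾ p′)     N m          e = failed-stays p′ N _ (failed-stays p N m e)
  failed-stays (when g p)   N (q , zs)   e with g (proj₂ q) (Vec.map scanned zs)
  ... | true  = failed-stays p N (q , zs) e
  ... | false = e
  failed-stays (loop c _ p) N m          e = failed-iterate (failed-stays p N) N m e

  cost : ∀ {n} → Prog n → ℕ → ℕ
  cost (basic f)    N = 1
  cost (check g)    N = 1
  cost (back j)     N = 2
  cost (p ⨾ p′)     N = cost p N + cost p′ N
  cost (when g p)   N = 1 + cost p N
  -- Each round adds a test of the clock and a move forward. The last N + 2 steps are the test that
  -- finds the end, N moves back and the turn at the left end.
  cost (loop c _ p) N = N * (2 + cost p N) + (N + 2)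

  Point : ∀ {n} → Prog n → Set
  Point (basic f)    = ⊤
  Point (check g)    = ⊤
  Point (back j)     = Bool
  Point (p ⨾ p′)     = Point p ⊎ Point p′
  Point (when g p)   = Maybe (Point p)
  Point (loop c _ p) = Maybe Bool ⊎ Point p

  pattern test      = inj₁ nothing
  pattern forward   = inj₁ (just true)
  pattern rewinding = inj₁ (just false)

  point-finite : ∀ {n} (p : Prog n) → Finite (Point p)
  point-finite (basic f)    = Finite-⊤
  point-finite (check g)    = Finite-⊤
  point-finite (back j)     = Finite-Bool
  point-finite (p ⨾ p′)     = Finite-⊎ (point-finite p) (point-finite p′)
  point-finite (when g p)   = Finite-Maybe (point-finite p)
  point-finite (loop c _ p) = Finite-⊎ (Finite-Maybe Finite-Bool) (point-finite p)

  entry : ∀ {n} (p : Prog n) → Point p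
  entry (basic f)    = tt
  entry (check g)    = tt
  entry (back j)     = false
  entry (p ⨾ p′)     = inj₁ (entry p)
  entry (when g p)   = nothing
  entry (loop c _ p) = test

  Tapes Symbols Actions : Set
  Tapes   = Vec (Tape (Fin 0)) (suc k + D)
  Symbols = Vec Sym (suc k + D)
  Actions = Vec (Sym × Move) (suc k + D)

  dataTape : Fin (suc k) → Fin (suc k + D)
  dataTape j = j ↑ˡ D

  clockTape : Fin D → Fin (suc k + D)
  clockTape c = suc k ↑ʳ c

  actions : (Fin (suc k) → Sym → Sym × Move) → (Fin D → Sym → Sym × Move) → Symbols → Actions
  actions f g hs = tabulate (λ j → f j (lookup hs (dataTape j))) Vec.++ tabulate (λ c → g c (lookup hs (clockTape c)))

  still : ∀ {n} → Fin n → Sym → Sym × Move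
  still _ = hold

  only : ∀ {n} → Fin n → (Sym → Sym × Move) → Fin n → Sym → Sym × Move
  only i f j = if does (j ≟ᶠ i) then f else hold

  heads : Symbols → Heads
  heads hs = tabulate (λ j → symbolBit (lookup hs (dataTape j)))

  relabel : ∀ {A B X : Set} → (A → B) → Maybe B → Maybe A × X → Maybe B × X
  relabel f e (just a  , x) = just (f a) , x
  relabel f e (nothing , x) = e , x

  isBlank : Maybe Bit → Bool
  isBlank = not ∘ is-just

  transition : ∀ {n} (p : Prog n) → Point p → Control → Symbols → Maybe (Point p) × Control × Actions
  transition (basic f) _ (o , r) hs =
    nothing , (o , proj₁ (f r (heads hs))) , actions (λ j → opAction (lookup (proj₂ (f r (heads hs))) j)) still hs
  transition (check g) _ (o , r) hs = nothing , (o ∧ g r (heads hs) , r) , actions still still hs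
  transition (back j) false q hs = just true , q , actions (only j moveLeft) still hs
  transition (back j) true  q hs =
    nothing , q , (if isBlank (symbolBit (lookup hs (dataTape j))) then actions (only j moveRight) still hs else actions still still hs)
  transition (p ⨾ p′) (inj₁ s) q hs = relabel inj₁ (just (inj₂ (entry p′))) (transition p s q hs)
  transition (p ⨾ p′) (inj₂ s) q hs = relabel inj₂ nothing (transition p′ s q hs)
  transition (when g p) nothing q hs =
    (if g (proj₂ q) (heads hs) then just (just (entry p)) else nothing) , q , actions still still hs
  transition (when g p) (just s) q hs = relabel just nothing (transition p s q hs)
  transition (loop c _ p) test q hs =
    if isBlank (symbolBit (lookup hs (clockTape c))) then just rewinding , q , actions still (only c moveLeft) hs
                                                 else just (inj₂ (entry p)) , q , actions still still hs
  transition (loop c _ p) forward q hs = just test , q , actions still (only c moveRight) hs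
  transition (loop c _ p) rewinding q hs =
    if isBlank (symbolBit (lookup hs (clockTape c))) then nothing , q , actions still (only c moveRight) hs
                                                 else just rewinding , q , actions still (only c moveLeft) hs
  transition (loop c _ p) (inj₂ s) q hs = relabel inj₂ (just forward) (transition p s q hs)

  -- Executions of compiled programs

  data Exec {n} (p : Prog n) : Point p → Control → Tapes → ℕ → Control → Tapes → Set where
    exit : ∀ {s q ts q′ as} → transition p s q (Vec.map Tape.head ts) ≡ (nothing , q′ , as) →
           Exec p s q ts 1 q′ (zipWith act as ts)
    next : ∀ {s q ts s′ q′ as t q″ ts″} → transition p s q (Vec.map Tape.head ts) ≡ (just s′ , q′ , as) →
           Exec p s′ q′ (zipWith act as ts) t q″ ts″ → Exec p s q ts (suc t) q″ ts″

  module _ {n n′} {p : Prog n} {p′ : Prog n′} (f : Point p → Point p′) where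

    embed : (∀ s q hs → transition p′ (f s) q hs ≡ relabel f nothing (transition p s q hs)) →
            ∀ {s q ts t q′ ts′} → Exec p s q ts t q′ ts′ → Exec p′ (f s) q ts t q′ ts′
    embed eq {s} {q} {ts} (exit e)   = exit (trans (eq s q _) (cong (relabel f nothing) e))
    embed eq {s} {q} {ts} (next e x) = next (trans (eq s q _) (cong (relabel f nothing) e)) (embed eq x)

    embed-then : ∀ {s₁} → (∀ s q hs → transition p′ (f s) q hs ≡ relabel f (just s₁) (transition p s q hs)) →
                 ∀ {s q ts t q′ ts′ t′ q″ ts″} → Exec p s q ts t q′ ts′ → Exec p′ s₁ q′ ts′ t′ q″ ts″ →
                 Exec p′ (f s) q ts (t + t′) q″ ts″
    embed-then eq (exit e)   y = next (trans (eq _ _ _) (cong (relabel f _) e)) y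
    embed-then eq (next e x) y = next (trans (eq _ _ _) (cong (relabel f _) e)) (embed-then eq x y)

  -- Tapes are described by predicates rather than by zippers, so that `LeftOf` can be imposed on
  -- one tape while the others keep their descriptions.
  Cells : ℕ → Set₁
  Cells n = Fin n → Tape (Fin 0) → Set

  Holds : Cells (suc k) → Cells D → Tapes → Set
  Holds P κ ts = (∀ j → P j (lookup ts (dataTape j))) × (∀ c → κ c (lookup ts (clockTape c)))

  stored : Vec Zipper (suc k) → Cells (suc k)
  stored zs j = Represents (lookup zs j)

  infixl 6 _[_↦_]
  _[_↦_] : ∀ {n} → Cells n → Fin n → (Tape (Fin 0) → Set) → Cells n
  (P [ i ↦ A ]) j t = if does (j ≟ᶠ i) then A t else P j t

  holds-actions : ∀ {P κ} f g ts →
    (∀ j → P j (act (f j (Tape.head (lookup ts (dataTape j)))) (lookup ts (dataTape j)))) →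
    (∀ c → κ c (act (g c (Tape.head (lookup ts (clockTape c)))) (lookup ts (clockTape c)))) →
    Holds P κ (zipWith act (actions f g (Vec.map Tape.head ts)) ts)
  holds-actions {P} {κ} f g ts p q = (λ j → subst (P j) (sym (on-data j)) (p j)) , (λ c → subst (κ c) (sym (on-clock c)) (q c))
    where
    hs : Symbols
    hs = Vec.map Tape.head ts

    F : Fin (suc k) → Sym × Move
    F j = f j (lookup hs (dataTape j))

    G : Fin D → Sym × Move
    G c = g c (lookup hs (clockTape c))

    on-data : ∀ j → lookup (zipWith act (actions f g hs) ts) (dataTape j)
                  ≡ act (f j (Tape.head (lookup ts (dataTape j)))) (lookup ts (dataTape j))
    on-data j = trans (lookup-zipWith act (dataTape j) (actions f g hs) ts) (cong (λ a → act a (lookup ts (dataTape j)))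
      (trans (lookup-++ˡ (tabulate F) (tabulate G) j) (trans (lookup∘tabulate F j) (cong (f j) (lookup-map (dataTape j) Tape.head ts)))))

    on-clock : ∀ c → lookup (zipWith act (actions f g hs) ts) (clockTape c)
                   ≡ act (g c (Tape.head (lookup ts (clockTape c)))) (lookup ts (clockTape c))
    on-clock c = trans (lookup-zipWith act (clockTape c) (actions f g hs) ts) (cong (λ a → act a (lookup ts (clockTape c)))
      (trans (lookup-++ʳ (tabulate F) (tabulate G) c) (trans (lookup∘tabulate G c) (cong (g c) (lookup-map (clockTape c) Tape.head ts)))))

  only-cell : ∀ {n} (P : Cells n) i {A A′ f} → (∀ t → A t → A′ (act (f (Tape.head t)) t)) →
              ∀ j t → (P [ i ↦ A ]) j t → (P [ i ↦ A′ ]) j (act (only i f j (Tape.head t)) t)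
  only-cell P i h j t p with j ≟ᶠ i
  ... | yes _ = h t p
  ... | no  _ = p

  at-cell : ∀ {n} (P : Cells n) i {A t} → (P [ i ↦ A ]) i t → A t
  at-cell P i p with i ≟ᶠ i
  ... | yes _ = p
  ... | no ¬e = contradiction refl ¬e

  put-cell : ∀ {n} (P : Cells n) i {A} → (∀ t → P i t → A t) → ∀ j t → P j t → (P [ i ↦ A ]) j t
  put-cell P i h j t p with j ≟ᶠ i
  ... | yes refl = h t p
  ... | no  _    = p

  take-cell : ∀ {n} (P : Cells n) i {A} → (∀ t → A t → P i t) → ∀ j t → (P [ i ↦ A ]) j t → P j t
  take-cell P i h j t p with j ≟ᶠ i
  ... | yes refl = h t p
  ... | no  _    = p

  still-holds : ∀ {P κ} ts → Holds P κ ts → Holds P κ (zipWith act (actions still still (Vec.map Tape.head ts)) ts)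
  still-holds {P} {κ} ts (p , q) = holds-actions {P} {κ} still still ts p q

  data-holds : ∀ {P κ i A A′ f} → (∀ t → A t → A′ (act (f (Tape.head t)) t)) → ∀ ts → Holds (P [ i ↦ A ]) κ ts →
               Holds (P [ i ↦ A′ ]) κ (zipWith act (actions (only i f) still (Vec.map Tape.head ts)) ts)
  data-holds {P} {κ} {i} {A} {A′} {f} h ts (p , q) =
    holds-actions {P [ i ↦ A′ ]} {κ} (only i f) still ts (λ j → only-cell P i {A} {A′} {f} h j _ (p j)) q

  clock-holds : ∀ {P κ c A A′ f} → (∀ t → A t → A′ (act (f (Tape.head t)) t)) → ∀ ts → Holds P (κ [ c ↦ A ]) ts →
                Holds P (κ [ c ↦ A′ ]) (zipWith act (actions still (only c f) (Vec.map Tape.head ts)) ts)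
  clock-holds {P} {κ} {c} {A} {A′} {f} h ts (p , q) =
    holds-actions {P} {κ [ c ↦ A′ ]} still (only c f) ts p (λ j → only-cell κ c {A} {A′} {f} h j _ (q j))

  symbol-at : ∀ (ts : Tapes) i {s} → Tape.head (lookup ts i) ≡ s → lookup (Vec.map Tape.head ts) i ≡ s
  symbol-at ts i e = trans (lookup-map i Tape.head ts) e

  heads-scanned : ∀ {zs κ} ts → Holds (stored zs) κ ts → heads (Vec.map Tape.head ts) ≡ Vec.map scanned zs
  heads-scanned {zs} ts (p , _) =
    tabulate-scanned zs (λ j → trans (cong symbolBit (lookup-map (dataTape j) Tape.head ts)) (symbolBit-head _ (p j)))
    where
    tabulate-scanned : ∀ {n} (zs : Vec Zipper n) {f : Fin n → Maybe Bit} →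
                       (∀ j → f j ≡ scanned (lookup zs j)) → tabulate f ≡ Vec.map scanned zs
    tabulate-scanned []       e = refl
    tabulate-scanned (z ∷ zs) e = cong₂ _∷_ (e zero) (tabulate-scanned zs (e ∘ suc))

  -- The clocks from `n` on belong to enclosing loops and may stand anywhere. `κ` records where, and
  -- `Correct` demands that every clock be left as it was found.
  Ready : ℕ → List Bit → Cells D → Set₁
  Ready n w κ = ∀ c → toℕ c < n → κ c ≡ Represents ([] , w)

  Runs : ∀ {n} (p : Prog n) → Point p → Control → Tapes → ℕ → Control → Cells (suc k) → Cells D → Set
  Runs p s q ts b q′ P κ = ∃₂ λ t ts′ → Exec p s q ts t q′ ts′ × t ≤ b × Holds P κ ts′

  Correct : ∀ {n} → Prog n → Set₁
  Correct {n} p = ∀ w {κ} → Ready n w κ → ∀ q zs ts → Holds (stored zs) κ ts →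
    Runs p (entry p) q ts (cost p (length w)) (proj₁ (⟪ p ⟫ (length w) (q , zs))) (stored (proj₂ (⟪ p ⟫ (length w) (q , zs)))) κ

  module _ {n} (c : Fin D) (c<n : toℕ c < n) (p : Prog (toℕ c)) (p-correct : Correct p) where

    private
      L : Prog n
      L = loop c c<n p

      seen : ∀ {P κ A s} ts → Holds P (κ [ c ↦ A ]) ts → (∀ t → A t → Tape.head t ≡ s) →
             lookup (Vec.map Tape.head ts) (clockTape c) ≡ s
      seen {κ = κ} {A} ts (_ , q) h = symbol-at ts (clockTape c) (h _ (at-cell κ c {A} (q c)))

    loop-exit : ∀ {P κ r} q ts → Holds P (κ [ c ↦ LeftOf r ]) ts → Runs L rewinding q ts 1 q P (κ [ c ↦ Represents ([] , r) ])
    loop-exit {P} {κ} {r} q ts h = 1 , _ , exit step-eq , ≤-refl ,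
      clock-holds {P} {κ} {c} {LeftOf r} {Represents ([] , r)} {moveRight} act-moveRight ts h
      where
      act-moveRight : ∀ t → LeftOf r t → Represents ([] , r) (act (moveRight (Tape.head t)) t)
      act-moveRight = act-right-end
      step-eq : transition L rewinding q (Vec.map Tape.head ts) ≡ (nothing , q , actions still (only c moveRight) (Vec.map Tape.head ts))
      step-eq rewrite seen {P} {κ} ts h head-leftOf = refl

    loop-rewind : ∀ {P κ} l x r q ts → Holds P (κ [ c ↦ Represents (l , x ∷ r) ]) ts →
      Runs L rewinding q ts (length l + 2) q P (κ [ c ↦ Represents ([] , l ʳ++ x ∷ r) ])
    loop-rewind {P} {κ} l x r q ts h = go l h
      where
      step-eq : ∀ {l} → Holds P (κ [ c ↦ Represents (l , x ∷ r) ]) ts →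
        transition L rewinding q (Vec.map Tape.head ts) ≡ (just rewinding , q , actions still (only c moveLeft) (Vec.map Tape.head ts))
      step-eq {l} h rewrite seen {P} {κ} ts h (head-bit {l}) = refl
      go : ∀ l → Holds P (κ [ c ↦ Represents (l , x ∷ r) ]) ts →
        Runs L rewinding q ts (length l + 2) q P (κ [ c ↦ Represents ([] , l ʳ++ x ∷ r) ])
      go [] h with loop-exit {P} {κ} q _ (clock-holds {P} {κ} {c} {_} {LeftOf (x ∷ r)} {moveLeft} act-left-end ts h)
      ... | t , ts′ , ex , t≤ , h′ = suc t , ts′ , next (step-eq h) ex , s≤s t≤ , h′
      go (y ∷ l) h with loop-rewind {P} {κ} l y (x ∷ r) q _ (clock-holds {P} {κ} {c} {_} {Represents (l , y ∷ x ∷ r)} {moveLeft} act-left ts h)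
      ... | t , ts′ , ex , t≤ , h′ = suc t , ts′ , next (step-eq h) ex , s≤s t≤ , h′

    loop-end : ∀ {P κ} l q ts → Holds P (κ [ c ↦ Represents (l , []) ]) ts →
      Runs L test q ts (length l + 2) q P (κ [ c ↦ Represents ([] , l ʳ++ []) ])
    loop-end {P} {κ} l q ts h = go l h
      where
      step-eq : ∀ {l} → Holds P (κ [ c ↦ Represents (l , []) ]) ts →
        transition L test q (Vec.map Tape.head ts) ≡ (just rewinding , q , actions still (only c moveLeft) (Vec.map Tape.head ts))
      step-eq {l} h rewrite seen {P} {κ} ts h (head-blank {l}) = refl
      go : ∀ l → Holds P (κ [ c ↦ Represents (l , []) ]) ts →
        Runs L test q ts (length l + 2) q P (κ [ c ↦ Represents ([] , l ʳ++ []) ])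
      go [] h with loop-exit {P} {κ} q _ (clock-holds {P} {κ} {c} {_} {LeftOf []} {moveLeft} act-left-end ts h)
      ... | t , ts′ , ex , t≤ , h′ = suc t , ts′ , next (step-eq h) ex , s≤s t≤ , h′
      go (y ∷ l) h with loop-rewind {P} {κ} l y [] q _ (clock-holds {P} {κ} {c} {_} {Represents (l , y ∷ [])} {moveLeft} act-left ts h)
      ... | t , ts′ , ex , t≤ , h′ = suc t , ts′ , next (step-eq h) ex , s≤s t≤ , h′

    module _ (w : List Bit) {κ : Cells D} (ready : Ready n w κ) where

      private
        N C : ℕ
        N = length w
        C = cost p N

        ready′ : ∀ A → Ready (toℕ c) w (κ [ c ↦ A ])
        ready′ A c′ c′<c with c′ ≟ᶠ c
        ... | yes refl = contradiction c′<c (<-irrefl refl)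
        ... | no _     = ready c′ (<-trans c′<c c<n)

      -- The clock itself is the induction variable: `l` holds the rounds made and `r` those to
      -- come. The body moves smaller clocks only, which are ready whatever the state of clock `c`.
      loop-correct : ∀ l r q zs ts → Holds (stored zs) (κ [ c ↦ Represents (l , r) ]) ts →
        Runs L test q ts (length r * (2 + C) + (length l + length r + 2))
             (proj₁ (iterate (length r) (⟪ p ⟫ N) (q , zs))) (stored (proj₂ (iterate (length r) (⟪ p ⟫ N) (q , zs))))
             (κ [ c ↦ Represents ([] , l ʳ++ r) ])
      loop-correct l [] q zs ts h with loop-end {stored zs} {κ} l q ts h
      ... | t , ts′ , ex , t≤ , h′ =
        t , ts′ , ex , ≤-trans t≤ (≤-reflexive (cong (_+ 2) (sym (+-identityʳ (length l))))) , h′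
      loop-correct l (x ∷ r) q zs ts h
        with p-correct w (ready′ (Represents (l , x ∷ r))) q zs _ (still-holds {stored zs} {κ [ c ↦ Represents (l , x ∷ r) ]} ts h)
      ... | t , ts₁ , ex , t≤ , h₁
        with loop-correct (x ∷ l) r _ _ _ (clock-holds {stored (proj₂ (⟪ p ⟫ N (q , zs)))} {κ} {c} {_} {Represents (x ∷ l , r)} {moveRight} advance-clock ts₁ h₁)
        where
        advance-clock : ∀ t → Represents (l , x ∷ r) t → Represents (x ∷ l , r) (act (moveRight (Tape.head t)) t)
        advance-clock t rep with Tape.head t | head-bit t rep
        ... | .(bit x) | refl = act-right t rep
      ... | t′ , ts′ , ex′ , t′≤ , h′ =
        suc (t + suc t′) , ts′ , next step-eq (embed-then {p = p} {p′ = L} inj₂ (λ _ _ _ → refl) ex (next refl ex′)) , bound , h′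
        where
        step-eq : transition L test q (Vec.map Tape.head ts) ≡ (just (inj₂ (entry p)) , q , actions still still (Vec.map Tape.head ts))
        step-eq rewrite seen {stored zs} {κ} ts h (head-bit {l}) = refl
        rest : ℕ
        rest = length r * (2 + C) + (suc (length l) + length r + 2)
        open ≤-Reasoning
        bound : suc (t + suc t′) ≤ suc (length r) * (2 + C) + (length l + suc (length r) + 2)
        bound = begin
          suc (t + suc t′)     ≡⟨ cong suc (+-suc t t′) ⟩
          2 + (t + t′)         ≤⟨ +-monoʳ-≤ 2 (+-mono-≤ t≤ t′≤) ⟩
          2 + (C + rest)       ≡⟨ cong (λ m → 2 + (C + (length r * (2 + C) + (m + 2)))) (sym (+-suc (length l) (length r))) ⟩
          2 + (C + (length r * (2 + C) + (length l + suc (length r) + 2))) ≡⟨ sym (+-assoc (2 + C) (length r * (2 + C)) _) ⟩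
          suc (length r) * (2 + C) + (length l + suc (length r) + 2) ∎

  when-step : ∀ {n} g (p : Prog n) {q zs κ b} ts → Holds (stored zs) κ ts → g (proj₂ q) (Vec.map scanned zs) ≡ b →
    transition (when g p) nothing q (Vec.map Tape.head ts)
      ≡ ((if b then just (just (entry p)) else nothing) , q , actions still still (Vec.map Tape.head ts))
  when-step g p {zs = zs} {κ} ts h refl rewrite heads-scanned {zs} {κ} ts h = refl

  correct : ∀ {n} (p : Prog n) → Correct p
  correct {n} (basic f) w {κ} _ (o , r) zs ts h =
    1 , _ , exit step-eq , ≤-refl , holds-actions {stored (zipWith perform ops zs)} {κ} f′ still ts performed (proj₂ h)
    where
    ops : Vec Op (suc k)
    ops = proj₂ (f r (Vec.map scanned zs))
    f′ : Fin (suc k) → Sym → Sym × Move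
    f′ j = opAction (lookup ops j)
    step-eq : transition {n} (basic f) tt (o , r) (Vec.map Tape.head ts)
            ≡ (nothing , (o , proj₁ (f r (Vec.map scanned zs))) , actions f′ still (Vec.map Tape.head ts))
    step-eq rewrite heads-scanned {zs} {κ} ts h = refl
    performed : ∀ j → stored (zipWith perform ops zs) j (act (f′ j (Tape.head (lookup ts (dataTape j)))) (lookup ts (dataTape j)))
    performed j rewrite lookup-zipWith perform j ops zs = act-op (lookup ops j) _ (proj₁ h j)
  correct {n} (check g) w {κ} _ (o , r) zs ts h = 1 , _ , exit step-eq , ≤-refl , still-holds {stored zs} {κ} ts h
    where
    step-eq : transition {n} (check g) tt (o , r) (Vec.map Tape.head ts)
            ≡ (nothing , (o ∧ g r (Vec.map scanned zs) , r) , actions still still (Vec.map Tape.head ts))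
    step-eq rewrite heads-scanned {zs} {κ} ts h = refl
  -- The machine moves left blindly and looks afterwards: on a blank it has left the contents and
  -- returns, otherwise it stays. Both cases take two steps.
  correct {n} (back j) w {κ} _ q zs ts h = 2 , cases (lookup zs j) refl
    where
    P : Cells (suc k)
    P = stored zs
    updated : ∀ {z} ts → retreat (lookup zs j) ≡ z → Holds (P [ j ↦ Represents z ]) κ ts → Holds (stored (updateAt zs j retreat)) κ ts
    updated {z} ts e (p , c) = (λ i → at i (p i)) , c
      where
      at : ∀ i → (P [ j ↦ Represents z ]) i (lookup ts (dataTape i)) → stored (updateAt zs j retreat) i (lookup ts (dataTape i))
      at i x with i ≟ᶠ j
      ... | yes refl = subst (λ v → Represents v (lookup ts (dataTape i))) (trans (sym e) (sym (lookup∘updateAt i zs))) x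
      ... | no i≢j   = subst (λ v → Represents v (lookup ts (dataTape i))) (sym (lookup∘updateAt′ i j i≢j zs)) x
    put : ∀ {z} → lookup zs j ≡ z → Holds (P [ j ↦ Represents z ]) κ ts
    put refl = (λ i → put-cell P j (λ _ x → x) i _ (proj₁ h i)) , proj₂ h
    cases : ∀ z → lookup zs j ≡ z → ∃ λ ts′ → Exec (back j) false q ts 2 q ts′ × 2 ≤ 2 × Holds (stored (updateAt zs j retreat)) κ ts′
    cases ([] , r) e = _ , next refl (exit step-eq) , ≤-refl , updated (zipWith act (actions (only j moveRight) still (Vec.map Tape.head ts₁)) ts₁) (cong retreat e) (data-holds {P} {κ} {j} {LeftOf r} {Represents ([] , r)} {moveRight} act-right-end ts₁ h₁)
      where
      ts₁ : Tapes
      ts₁ = zipWith act (actions (only j moveLeft) still (Vec.map Tape.head ts)) ts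
      h₁ : Holds (P [ j ↦ LeftOf r ]) κ ts₁
      h₁ = data-holds {P} {κ} {j} {_} {LeftOf r} {moveLeft} act-left-end ts (put e)
      step-eq : transition {n} (back j) true q (Vec.map Tape.head ts₁) ≡ (nothing , q , actions (only j moveRight) still (Vec.map Tape.head ts₁))
      step-eq rewrite symbol-at ts₁ (dataTape j) (head-leftOf _ (at-cell P j {LeftOf r} (proj₁ h₁ j))) = refl
    cases (x ∷ l , r) e = _ , next refl (exit step-eq) , ≤-refl , updated (zipWith act (actions still still (Vec.map Tape.head ts₁)) ts₁) (cong retreat e) (still-holds {P [ j ↦ Represents (l , x ∷ r) ]} {κ} ts₁ h₁)
      where
      ts₁ : Tapes
      ts₁ = zipWith act (actions (only j moveLeft) still (Vec.map Tape.head ts)) ts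
      h₁ : Holds (P [ j ↦ Represents (l , x ∷ r) ]) κ ts₁
      h₁ = data-holds {P} {κ} {j} {_} {Represents (l , x ∷ r)} {moveLeft} act-left ts (put e)
      step-eq : transition {n} (back j) true q (Vec.map Tape.head ts₁) ≡ (nothing , q , actions still still (Vec.map Tape.head ts₁))
      step-eq rewrite symbol-at ts₁ (dataTape j) (head-bit _ (at-cell P j {Represents (l , x ∷ r)} (proj₁ h₁ j))) = refl
  correct (p ⨾ p′) w {κ} ready q zs ts h with correct p w ready q zs ts h
  ... | t , ts₁ , ex , t≤ , h₁ with correct p′ w ready _ _ ts₁ h₁
  ...   | t′ , ts₂ , ex′ , t′≤ , h₂ =
    t + t′ , ts₂ , embed-then inj₁ (λ _ _ _ → refl) ex (embed inj₂ (λ _ _ _ → refl) ex′) , +-mono-≤ t≤ t′≤ , h₂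
  correct (when g p) w {κ} ready q zs ts h with g (proj₂ q) (Vec.map scanned zs) in eq
  ... | false = 1 , _ , exit (when-step g p {zs = zs} {κ} ts h eq) , s≤s z≤n , still-holds {stored zs} {κ} ts h
  ... | true with correct p w ready q zs _ (still-holds {stored zs} {κ} ts h)
  ...   | t , ts₁ , ex , t≤ , h₁ = suc t , ts₁ , next (when-step g p {zs = zs} {κ} ts h eq) (embed just (λ _ _ _ → refl) ex) , s≤s t≤ , h₁
  correct (loop c c<n p) w {κ} ready q zs ts h
    with loop-correct c c<n p (correct p) w ready [] w q zs ts
           (proj₁ h , λ c′ → put-cell κ c (λ t → subst (λ A → A t) (ready c c<n)) c′ _ (proj₂ h c′))
  ... | t , ts₁ , ex , t≤ , h₁ =
    t , ts₁ , ex , t≤ , (proj₁ h₁ , λ c′ → take-cell κ c (λ t → subst (λ A → A t) (sym (ready c c<n))) c′ _ (proj₂ h₁ c′))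

  -- The machine: filling the clocks, then running the program

  module Assembly (main : Prog D) (r₀ : R) (R-finite : Finite R) where

    Phase : Set
    Phase = Bool ⊎ Maybe (Point main)

    pattern copying    = inj₁ false
    pattern returning  = inj₁ true
    pattern running s  = inj₂ (just s)
    pattern stopped    = inj₂ nothing

    everywhere : (Sym → Sym × Move) → Symbols → Actions
    everywhere f = actions (only zero f) (λ _ → f)

    proceed : Maybe (Point main) × Control × Actions → Action (Phase × Control) Sym (suc k + D)
    proceed (s , q , as) = step (inj₂ s , q) as

    program : Phase × Control → Symbols → Action (Phase × Control) Sym (suc k + D)
    program (copying , q) hs =
      if isBlank (symbolBit (lookup hs zero)) then step (returning , q) (everywhere moveLeft hs)
                                              else step (copying , q) (actions (only zero moveRight) (λ _ _ → lookup hs zero , right) hs)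
    program (returning , q) hs =
      if isBlank (symbolBit (lookup hs zero)) then step (running (entry main) , q) (everywhere moveRight hs)
                                              else step (returning , q) (everywhere moveLeft hs)
    program (running s , q) hs = proceed (transition main s q hs)
    program (stopped , q) hs = halt (proj₁ q)

    machine : TuringMachine
    machine = record
      { State       = Phase × Control
      ; Work        = Fin 0
      ; stateFinite = Finite-× (Finite-⊎ Finite-Bool (Finite-Maybe (point-finite main))) (Finite-× Finite-Bool R-finite)
      ; workFinite  = 0 , ↔-id _
      ; extraTapes  = k + D
      ; initial     = copying , true , r₀
      ; δ           = program
      }

    open TuringMachine machine using (run; load; Configuration; DecidesInTime)

    run-step : ∀ t q {q′ as} (ts : Tapes) → program q (Vec.map Tape.head ts) ≡ step q′ as →
               run (suc t) (q , ts) ≡ run t (q′ , zipWith act as ts)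
    run-step t q ts e with program q (Vec.map Tape.head ts)
    run-step t q ts refl | step _ _ = refl

    run-longer : ∀ t s (c : Configuration) {b} → run t c ≡ just b → run (t + s) c ≡ just b
    run-longer (suc t) s (q , ts) e with program q (Vec.map Tape.head ts)
    ... | halt _     = e
    ... | step q′ as = run-longer t s (q′ , zipWith act as ts) e

    run-exec : ∀ {s q ts t q′ ts′} u → Exec main s q ts t q′ ts′ →
               run (t + u) ((running s , q) , ts) ≡ run u ((stopped , q′) , ts′)
    run-exec {s} {q} {ts} u (exit e)   = run-step u (running s , q) ts (cong proceed e)
    run-exec {s} {q} {ts} u (next {t = t} e x) = trans (run-step (t + u) (running s , q) ts (cong proceed e)) (run-exec u x)

    Blank : Cells (suc k)
    Blank _ = Represents ([] , [])

    -- After copying, the input tape and all clocks have the same contents and head position, so a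
    -- single assertion describes their common walk back.
    Synced : (Tape (Fin 0) → Set) → Tapes → Set
    Synced A = Holds (Blank [ zero ↦ A ]) (λ _ → A)

    synced-step : ∀ {A A′ f} → (∀ t → A t → A′ (act (f (Tape.head t)) t)) → ∀ ts → Synced A ts →
                  Synced A′ (zipWith act (everywhere f (Vec.map Tape.head ts)) ts)
    synced-step {A} {A′} {f} h ts (p , q) = holds-actions {Blank [ zero ↦ A′ ]} {λ _ → A′} (only zero f) (λ _ → f) ts
      (λ j → only-cell Blank zero {A} {A′} {f} h j _ (p j)) (λ c → h _ (q c))

    record Prepares (ph : Phase) (q : Control) (ts : Tapes) (t : ℕ) (w : List Bit) : Set where
      constructor prepares
      field
        {prepared} : Tapes
        arrives    : ∀ u → run (t + u) ((ph , q) , ts) ≡ run u ((running (entry main) , q) , prepared)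
        synced     : Synced (Represents ([] , w)) prepared

    first-symbol : ∀ (ts : Tapes) {s} → Tape.head (lookup ts zero) ≡ s → lookup (Vec.map Tape.head ts) zero ≡ s
    first-symbol ts = symbol-at ts zero

    prepare-before : ∀ ph {q ts t w ph′ as} → program (ph , q) (Vec.map Tape.head ts) ≡ step (ph′ , q) as →
      Prepares ph′ q (zipWith act as ts) t w → Prepares ph q ts (suc t) w
    prepare-before ph {q} {ts} {t} e (prepares runs h) = prepares (λ u → trans (run-step (t + u) (ph , q) ts e) (runs u)) h

    return-end : ∀ {r} q ts → Synced (LeftOf r) ts → Prepares returning q ts 1 r
    return-end {r} q ts h = prepares (λ u → run-step u (returning , q) ts step-eq)
      (synced-step {LeftOf r} {Represents ([] , r)} {moveRight} act-right-end ts h)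
      where
      step-eq : program (returning , q) (Vec.map Tape.head ts) ≡ step (running (entry main) , q) (everywhere moveRight (Vec.map Tape.head ts))
      step-eq rewrite first-symbol ts (head-leftOf _ (proj₁ h zero)) = refl

    return : ∀ l x r q ts → Synced (Represents (l , x ∷ r)) ts → Prepares returning q ts (length l + 2) (l ʳ++ x ∷ r)
    return l x r q ts h = go l h
      where
      step-eq : ∀ {l} → Synced (Represents (l , x ∷ r)) ts →
                program (returning , q) (Vec.map Tape.head ts) ≡ step (returning , q) (everywhere moveLeft (Vec.map Tape.head ts))
      step-eq {l} h rewrite first-symbol ts (head-bit {l} _ (proj₁ h zero)) = refl
      go : ∀ l → Synced (Represents (l , x ∷ r)) ts → Prepares returning q ts (length l + 2) (l ʳ++ x ∷ r)
      go []      h = prepare-before returning (step-eq h)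
        (return-end q _ (synced-step {Represents ([] , x ∷ r)} {LeftOf (x ∷ r)} {moveLeft} act-left-end ts h))
      go (y ∷ l) h = prepare-before returning (step-eq h)
        (return l y (x ∷ r) q _ (synced-step {Represents (y ∷ l , x ∷ r)} {Represents (l , y ∷ x ∷ r)} {moveLeft} act-left ts h))

    copy : ∀ l r q ts → Holds (Blank [ zero ↦ Represents (l , r) ]) (λ _ → Represents (l , [])) ts →
           Prepares copying q ts (length r + (length r + length l) + 2) (l ʳ++ r)
    copy l [] q ts h = go l h
      where
      step-eq : ∀ {l} → Synced (Represents (l , [])) ts →
                program (copying , q) (Vec.map Tape.head ts) ≡ step (returning , q) (everywhere moveLeft (Vec.map Tape.head ts))
      step-eq {l} h rewrite first-symbol ts (head-blank {l} _ (proj₁ h zero)) = refl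
      go : ∀ l → Synced (Represents (l , [])) ts → Prepares copying q ts (length l + 2) (l ʳ++ [])
      go []      h = prepare-before copying (step-eq h)
        (return-end q _ (synced-step {Represents ([] , [])} {LeftOf []} {moveLeft} act-left-end ts h))
      go (y ∷ l) h = prepare-before copying (step-eq h)
        (return l y [] q _ (synced-step {Represents (y ∷ l , [])} {Represents (l , y ∷ [])} {moveLeft} act-left ts h))
    copy l (x ∷ r) q ts h = prepare-before copying step-eq
      (subst (λ t → Prepares copying q ts₁ t (l ʳ++ x ∷ r)) (cong (λ m → length r + m + 2) (+-suc (length r) (length l)))
        (copy (x ∷ l) r q ts₁ moved))
      where
      hs : Symbols
      hs = Vec.map Tape.head ts
      ts₁ : Tapes
      ts₁ = zipWith act (actions (only zero moveRight) (λ _ _ → bit x , right) hs) ts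
      seen : lookup hs zero ≡ bit x
      seen = first-symbol ts (head-bit {l} _ (proj₁ h zero))
      step-eq : program (copying , q) hs ≡ step (copying , q) (actions (only zero moveRight) (λ _ _ → bit x , right) hs)
      step-eq rewrite seen = refl
      move-first : ∀ t → Represents (l , x ∷ r) t → Represents (x ∷ l , r) (act (moveRight (Tape.head t)) t)
      move-first t rep with Tape.head t | head-bit {l} t rep
      ... | .(bit x) | refl = act-right t rep
      moved : Holds (Blank [ zero ↦ Represents (x ∷ l , r) ]) (λ _ → Represents (x ∷ l , [])) ts₁
      moved = holds-actions {Blank [ zero ↦ Represents (x ∷ l , r) ]} {λ _ → Represents (x ∷ l , [])} (only zero moveRight) (λ _ _ → bit x , right) ts
        (λ j → only-cell Blank zero {Represents (l , x ∷ r)} {Represents (x ∷ l , r)} {moveRight} move-first j _ (proj₁ h j))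
        (λ c → act-right {l} {[]} _ (proj₂ h c))

    start-memory : List Bit → Memory
    start-memory w = (true , r₀) , ([] , w) ∷ Vec.replicate k ([] , [])

    result : List Bit → Bool
    result w = passed (⟪ main ⟫ (length w) (start-memory w))

    -- Copying takes n steps and the way back n + 2, written as in `copy` for an empty left part;
    -- then come the program and the halting step.
    time : ℕ → ℕ
    time n = n + (n + 0) + 2 + (cost main n + 1)

    loaded : ∀ w → Holds (Blank [ zero ↦ Represents ([] , w) ]) (λ _ → Represents ([] , [])) (proj₂ (load w))
    loaded w = at-data , at-clock
      where
      at-data : ∀ j → (Blank [ zero ↦ Represents ([] , w) ]) j (lookup (proj₂ (load w)) (dataTape j))
      at-data zero    = represents-input w
      at-data (suc j) = subst (Represents _) (sym (lookup-replicate (j ↑ˡ D) emptyTape)) represents-empty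
      at-clock : ∀ c → Represents ([] , []) (lookup (proj₂ (load w)) (clockTape c))
      at-clock c = subst (Represents _) (sym (lookup-replicate (k ↑ʳ c) emptyTape)) represents-empty

    synced-stored : ∀ {w} ts → Synced (Represents ([] , w)) ts → Holds (stored (proj₂ (start-memory w))) (λ _ → Represents ([] , w)) ts
    synced-stored {w} ts (p , q) = at-data , q
      where
      at-data : ∀ j → stored (proj₂ (start-memory w)) j (lookup ts (dataTape j))
      at-data zero    = p zero
      at-data (suc j) = subst (λ z → Represents z (lookup ts (dataTape (suc j)))) (sym (lookup-replicate j ([] , []))) (p (suc j))

    run-within : ∀ {c c′ : Configuration} {s t b} m → (∀ u → run (s + u) c ≡ run u c′) → run (t + 1) c′ ≡ just b → t ≤ m →
                 run (s + (m + 1)) c ≡ just b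
    run-within {c} {c′} {s} {t} {b} m runs e t≤m = trans (runs (m + 1)) (trans (cong (λ u → run u c′) lengthen) (run-longer (t + 1) (m ∸ t) c′ e))
      where
      open ≡-Reasoning
      lengthen : m + 1 ≡ t + 1 + (m ∸ t)
      lengthen = begin
        m + 1             ≡⟨ cong (_+ 1) (sym (m+[n∸m]≡n t≤m)) ⟩
        t + (m ∸ t) + 1   ≡⟨ +-assoc t _ 1 ⟩
        t + ((m ∸ t) + 1) ≡⟨ cong (t +_) (+-comm _ 1) ⟩
        t + (1 + (m ∸ t)) ≡⟨ sym (+-assoc t 1 _) ⟩
        t + 1 + (m ∸ t)   ∎

    run-result : ∀ w → run (time (length w)) (load w) ≡ just (result w)
    run-result w =
      let prepares {ts₁} runs h₁ = copy [] w (true , r₀) (proj₂ (load w)) (loaded w)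
          t , ts₂ , ex , t≤ , _ = correct main w {λ _ → Represents ([] , w)} (λ _ _ → refl) (true , r₀) (proj₂ (start-memory w)) ts₁ (synced-stored ts₁ h₁)
      in run-within {load w} {(running (entry main) , true , r₀) , ts₁} {length w + (length w + 0) + 2} {t} (cost main (length w)) runs (run-exec 1 ex) t≤

    decides : ∀ {L time′} → (∀ n → time n ≤ time′ n) → (∀ w → result w ≡ true ⇔ L w) → DecidesInTime L time′
    decides {time′ = time′} time≤ spec w = result w , within , spec w
      where
      within : run (time′ (length w)) (load w) ≡ just (result w)
      within = trans (cong (λ t → run t (load w)) (sym (m+[n∸m]≡n (time≤ (length w)))))
                     (run-longer (time (length w)) _ (load w) (run-result w))

-- Closure properties of polynomial bounds

Polynomial : (ℕ → ℕ) → Set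
Polynomial f = ∃₂ λ c d → ∀ n → f n ≤ c * n ^ d + c

module _ where
  open ≤-Reasoning
  open +-*-Solver using (solve; _:*_; _:+_; _:=_; con)

  -- The summand 1 is for n = 0, where the power with exponent 0 is 1 and all others are 0.
  n^d≤n^[d+e]+1 : ∀ n d e → n ^ d ≤ n ^ (d + e) + 1
  n^d≤n^[d+e]+1 zero    zero    e = m≤n+m 1 _
  n^d≤n^[d+e]+1 zero    (suc d) e = z≤n
  n^d≤n^[d+e]+1 (suc n) d       e = ≤-trans (^-monoʳ-≤ (suc n) (m≤m+n d e)) (m≤m+n _ 1)

  raise : ∀ c d e n → c * n ^ d + c ≤ (c + c) * n ^ (d + e) + (c + c)
  raise c d e n = begin
    c * n ^ d + c                     ≤⟨ +-monoˡ-≤ c (*-monoʳ-≤ c (n^d≤n^[d+e]+1 n d e)) ⟩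
    c * (n ^ (d + e) + 1) + c         ≡⟨ solve 2 (λ c x → c :* (x :+ con 1) :+ c := c :* x :+ (c :+ c)) refl c (n ^ (d + e)) ⟩
    c * n ^ (d + e) + (c + c)         ≤⟨ +-monoˡ-≤ (c + c) (*-monoˡ-≤ (n ^ (d + e)) (m≤m+n c c)) ⟩
    (c + c) * n ^ (d + e) + (c + c)   ∎

  polynomial-const : ∀ m → Polynomial (λ _ → m)
  polynomial-const m = m , 0 , λ n → m≤n+m m _

  polynomial-id : Polynomial id
  polynomial-id = 1 , 1 , λ n → ≤-trans (≤-reflexive (sym (trans (*-identityˡ (n ^ 1)) (^-identityʳ n)))) (m≤m+n _ 1)

  polynomial-+ : ∀ {f g} → Polynomial f → Polynomial g → Polynomial (λ n → f n + g n)
  polynomial-+ {f} {g} (c , d , f≤) (c′ , d′ , g≤) = (c + c) + (c′ + c′) , d + d′ , λ n → begin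
    f n + g n                                   ≤⟨ +-mono-≤ (≤-trans (f≤ n) (raise c d d′ n)) (≤-trans (g≤ n) (raise c′ d′ d n)) ⟩
    (c + c) * n ^ (d + d′) + (c + c) + ((c′ + c′) * n ^ (d′ + d) + (c′ + c′))
      ≡⟨ cong (λ e → (c + c) * n ^ (d + d′) + (c + c) + ((c′ + c′) * n ^ e + (c′ + c′))) (+-comm d′ d) ⟩
    (c + c) * n ^ (d + d′) + (c + c) + ((c′ + c′) * n ^ (d + d′) + (c′ + c′))
      ≡⟨ solve 3 (λ a b x → a :* x :+ a :+ (b :* x :+ b) := (a :+ b) :* x :+ (a :+ b)) refl (c + c) (c′ + c′) (n ^ (d + d′)) ⟩
    (c + c + (c′ + c′)) * n ^ (d + d′) + (c + c + (c′ + c′)) ∎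

  polynomial-n* : ∀ {f} → Polynomial f → Polynomial (λ n → n * f n)
  polynomial-n* {f} (c , d , f≤) = c + c , suc d , λ n → begin
    n * f n                            ≤⟨ *-monoʳ-≤ n (f≤ n) ⟩
    n * (c * n ^ d + c)                ≡⟨ solve 3 (λ n c x → n :* (c :* x :+ c) := c :* (n :* x) :+ c :* n) refl n c (n ^ d) ⟩
    c * n ^ suc d + c * n              ≤⟨ +-monoʳ-≤ (c * n ^ suc d) (*-monoʳ-≤ c (≤-trans (≤-reflexive (sym (^-identityʳ n))) (n^d≤n^[d+e]+1 n 1 d))) ⟩
    c * n ^ suc d + c * (n ^ suc d + 1) ≡⟨ solve 2 (λ c x → c :* x :+ c :* (x :+ con 1) := (c :+ c) :* x :+ c) refl c (n ^ suc d) ⟩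
    (c + c) * n ^ suc d + c            ≤⟨ +-monoʳ-≤ _ (m≤m+n c c) ⟩
    (c + c) * n ^ suc d + (c + c)      ∎

module _ {k D : ℕ} {R : Set} where
  open Language k D R

  cost-polynomial : ∀ {n} (p : Prog n) → Polynomial (cost p)
  cost-polynomial (basic f)    = polynomial-const 1
  cost-polynomial (check g)    = polynomial-const 1
  cost-polynomial (back j)     = polynomial-const 2
  cost-polynomial (p ⨾ p′)     = polynomial-+ (cost-polynomial p) (cost-polynomial p′)
  cost-polynomial (when g p)   = polynomial-+ (polynomial-const 1) (cost-polynomial p)
  cost-polynomial (loop c _ p) = polynomial-+ (polynomial-n* (polynomial-+ (polynomial-const 2) (cost-polynomial p)))
                                              (polynomial-+ polynomial-id (polynomial-const 2))

  program∈P : ∀ {L : Language} (p : Prog D) r₀ → Finite R →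
              (∀ w → passed (⟪ p ⟫ (length w) ((true , r₀) , ([] , w) ∷ Vec.replicate k ([] , []))) ≡ true ⇔ L w) → L ∈P
  program∈P {L} p r₀ R-finite spec = machine , proj₁ bound , proj₁ (proj₂ bound) , decides {L} (proj₂ (proj₂ bound)) spec
    where
    open Assembly p r₀ R-finite
    bound : Polynomial time
    bound = polynomial-+ (polynomial-+ (polynomial-+ polynomial-id (polynomial-+ polynomial-id (polynomial-const 0))) (polynomial-const 2))
                         (polynomial-+ (cost-polynomial p) (polynomial-const 1))

-- Solving temporal reachability games by bounded backward induction

-- Instantiated by `within` in declining games, by the complements of `solution` in improving ones
-- and, with no dependence on time, by `attractor`. The parameter `descend` says that a vertex
-- entering late owes this to one that entered a round less late, a unit of time later.
module Stability {n : ℕ} (Y : ℕ → ℕ → Pred (Fin n) 0ℓ) (Y? : ∀ k i → Decidable (Y k i))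
  (growing : ∀ {k i} → Y k i ⊆ Y (suc k) i) (shrinking : ∀ {k i} → Y k (suc i) ⊆ Y k i)
  (descend : ∀ {k i v} → Y (2 + k) i v → ¬ Y (1 + k) i v → ∃ λ u → Y (1 + k) (suc i) u × ¬ Y k (suc i) u) where

  private
    growing* : ∀ {k k′ i} → k ≤ k′ → Y k i ⊆ Y k′ i
    growing* {k} {k′} {i} k≤k′ {v} y = subst (λ m → Y m i v) (m∸n+n≡m k≤k′) (go (k′ ∸ k))
      where
      go : ∀ d → Y (d + k) i v
      go zero    = y
      go (suc d) = growing (go d)

    shrinking* : ∀ {k i i′} → i ≤ i′ → Y k i′ ⊆ Y k i
    shrinking* {k} {i} {i′} i≤i′ {v} y = go (i′ ∸ i) (subst (λ m → Y k m v) (sym (m∸n+n≡m i≤i′)) y)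
      where
      go : ∀ d → Y k (d + i) v → Y k i v
      go zero    y = y
      go (suc d) y = go d (shrinking y)

    -- Iterates `descend`: the vertex at place `r` enters exactly with round `suc (k ∸ toℕ r)` at
    -- time `toℕ r + i`. There are `suc k` places, which exceeds the number of vertices as soon as
    -- `n ≤ k`.
    chain : ∀ k i v → Y (suc k) i v → ¬ Y k i v →
            ∃ λ (f : Fin (suc k) → Fin n) → ∀ r → Y (suc (k ∸ toℕ r)) (toℕ r + i) (f r) × ¬ Y (k ∸ toℕ r) (toℕ r + i) (f r)
    chain zero    i v y ¬y = (λ _ → v) , λ { zero → y , ¬y }
    chain (suc k) i v y ¬y with descend y ¬y
    ... | u , y′ , ¬y′ with chain k (suc i) u y′ ¬y′
    ...   | f , p = g , q
      where
      g : Fin (2 + k) → Fin n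
      g zero    = v
      g (suc r) = f r
      q : ∀ r → Y (suc (suc k ∸ toℕ r)) (toℕ r + i) (g r) × ¬ Y (suc k ∸ toℕ r) (toℕ r + i) (g r)
      q zero    = y , ¬y
      q (suc r) = subst (λ m → Y (suc (k ∸ toℕ r)) m (f r) × ¬ Y (k ∸ toℕ r) m (f r)) (+-suc (toℕ r) i) (p r)

  -- A vertex that repeats on the chain lies, by monotonicity, in a set that its
  -- first occurrence avoids.
  stable : ∀ {k i} → n ≤ k → Y (suc k) i ⊆ Y k i
  stable {k} {i} n≤k {v} y = decidable-stable (Y? k i v) impossible
    where
    impossible : ¬ ¬ Y k i v
    impossible ¬y with chain k i v y ¬y
    ... | f , p with pigeonhole (s≤s n≤k) f
    ...   | a , b , a<b , fa≡fb = proj₂ (p a) (growing* (∸-monoʳ-< a<b b≤k)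
                (shrinking* (+-monoˡ-≤ i (<⇒≤ a<b)) (subst (Y _ _) (sym fa≡fb) (proj₁ (p b)))))
      where
      b≤k : toℕ b ≤ k
      b≤k = ≤-pred (toℕ<n b)

-- Controllable predecessors, strategies and traps

module Solving (𝒢 : TemporalGame) (E? : ∀ u v i → Dec (TemporalGame.E 𝒢 u v i)) where
  open TemporalGame 𝒢

  -- The controllable predecessor of player 1, with the targets added. At a dead end `forced` holds
  -- vacuously and `choose` is impossible, which is exactly the convention on dead ends.
  data Pre (A : V → V → Set) (X : Pred V 0ℓ) (u : V) : Set where
    hit    : u ∈ target → Pre A X u
    choose : owner u ≡ player₁ → ∀ v → A u v → X v → Pre A X u
    forced : owner u ≡ player₂ → (∀ v → A u v → X v) → Pre A X u

  player-cases : ∀ {A : Set} p → (p ≡ player₁ → A) → (p ≡ player₂ → A) → A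
  player-cases player₁ f g = f refl
  player-cases player₂ f g = g refl

  player₁≢player₂ : ∀ {p} → p ≡ player₁ → p ≢ player₂
  player₁≢player₂ refl ()

  pre? : ∀ {A X} → (∀ u v → Dec (A u v)) → Decidable X → Decidable (Pre A X)
  pre? {A} {X} A? X? u with u ∈? target
  ... | yes t = yes (hit t)
  ... | no ¬t = player-cases (owner u)
    (λ o₁ → map′ (λ { (v , a , x) → choose o₁ v a x })
                 (λ { (hit t) → contradiction t ¬t ; (choose _ v a x) → v , a , x ; (forced o₂ _) → contradiction o₂ (player₁≢player₂ o₁) })
                 (any? λ v → A? u v ×-dec X? v))
    (λ o₂ → map′ (forced o₂)
                 (λ { (hit t) → contradiction t ¬t ; (choose o₁ _ _ _) → contradiction o₂ (player₁≢player₂ o₁) ; (forced _ f) → f })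
                 (all? λ v → A? u v →-dec X? v))

  -- More edges help their owner, hence the reversed inclusion at player 2. Together the two
  -- inclusions make winning regions monotone in time for declining and improving games.
  pre-mono : ∀ {A A′ X X′} → (∀ {u v} → owner u ≡ player₁ → A u v → A′ u v) →
             (∀ {u v} → owner u ≡ player₂ → A′ u v → A u v) → X ⊆ X′ → Pre A X ⊆ Pre A′ X′
  pre-mono f g h (hit t)          = hit t
  pre-mono f g h (choose o v a x) = choose o v (f o a) (h x)
  pre-mono f g h (forced o k)     = forced o (λ v a → h (k v (g o a)))

  -- Vertices are finite in number and everything is decidable, so a failure of `forced` has a
  -- witness. This provides `descend`.
  pre-difference : ∀ {A X X′ u} → Decidable X′ → (∀ u v → Dec (A u v)) → Pre A X u → ¬ Pre A X′ u → ∃ λ v → X v × ¬ X′ v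
  pre-difference X′? A? (hit t) ¬p = contradiction (hit t) ¬p
  pre-difference X′? A? (choose o v a x) ¬p = v , x , λ x′ → ¬p (choose o v a x′)
  pre-difference {A} {X} {X′} {u} X′? A? (forced o f) ¬p with ¬∀⟶∃¬ _ (λ v → A u v → X′ v) (λ v → A? u v →-dec X′? v) (λ f′ → ¬p (forced o f′))
  ... | v , ¬f with A? u v
  ...   | yes a = v , f v a , λ x′ → ¬f (λ _ → x′)
  ...   | no ¬a = contradiction (λ a → contradiction a ¬a) ¬f

  At : ℕ → V → V → Set
  At i u v = E u v i

  At? : ∀ i u v → Dec (At i u v)
  At? i u v = E? u v i

  -- Backward induction down to time `i`, with `X` imposed at time `i + k`.
  rounds : Pred V 0ℓ → ℕ → ℕ → Pred V 0ℓ
  rounds X zero    i = X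
  rounds X (suc k) i = Pre (At i) (rounds X k (suc i))

  rounds? : ∀ {X} → Decidable X → ∀ k i → Decidable (rounds X k i)
  rounds? X? zero    i = X?
  rounds? X? (suc k) i = pre? (At? i) (rounds? X? k (suc i))

  rounds-base : ∀ {X X′} → X ⊆ X′ → ∀ k i → rounds X k i ⊆ rounds X′ k i
  rounds-base X⊆X′ zero    i = X⊆X′
  rounds-base X⊆X′ (suc k) i = pre-mono (λ _ a → a) (λ _ a → a) (rounds-base X⊆X′ k (suc i))

  Target : Pred V 0ℓ
  Target u = u ∈ target

  within : ℕ → ℕ → Pred V 0ℓ
  within = rounds Target

  within-grows : ∀ k i → within k i ⊆ within (suc k) i
  within-grows zero    i t = hit t
  within-grows (suc k) i   = pre-mono (λ _ a → a) (λ _ a → a) (within-grows k (suc i))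

  module Win {K} (from-source : within K 0 source) where

    -- The time determines the number of rounds left, so no history is consulted. The second search
    -- serves `Legal`, which demands an available edge even from lost positions; the last value
    -- concerns dead ends only.
    move : Position → Position
    move (u , i) with any? (λ v → E? u v i ×-dec rounds? (_∈? target) (K ∸ suc i) (suc i) v)
    ... | yes (v , _) = v , suc i
    ... | no _ with any? (λ v → E? u v i)
    ...   | yes (v , _) = v , suc i
    ...   | no _        = u , suc i

    move-legal : ∀ u i → (∃ λ q → (u , i) ⟶ q) → (u , i) ⟶ move (u , i)
    move-legal u i ((v , _) , _ , e) with any? (λ v → E? u v i ×-dec rounds? (_∈? target) (K ∸ suc i) (suc i) v)
    ... | yes (_ , e′ , _) = refl , e′
    ... | no _ with any? (λ v → E? u v i)
    ...   | yes (_ , e′) = refl , e′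
    ...   | no ¬e        = contradiction (v , e) ¬e

    move-wins : ∀ u i → (∃ λ v → E u v i × within (K ∸ suc i) (suc i) v) → within (K ∸ suc i) (suc i) (proj₁ (move (u , i)))
    move-wins u i w with any? (λ v → E? u v i ×-dec rounds? (_∈? target) (K ∸ suc i) (suc i) v)
    ... | yes (_ , _ , x) = x
    ... | no ¬w           = contradiction w ¬w

    σ : Strategy
    σ _ = move

    Good : History → Position → Set
    Good h (v , i) = Any InTarget h ⊎ ∃ λ k → i + k ≡ K × within k i v

    invariant : ∀ {h p} → Consistent σ (source , 0) h p → Good h p
    invariant start = inj₂ (K , refl , from-source)
    invariant (step {h} {u , i} {v , .(suc i)} c (refl , e) follows) with invariant c
    ... | inj₁ t                     = inj₁ (there t)
    ... | inj₂ (zero , _ , t)        = inj₁ (here t)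
    ... | inj₂ (suc k , i+k , hit t) = inj₁ (here t)
    ... | inj₂ (suc k , i+k , forced o f) = inj₂ (k , trans (sym (+-suc i k)) i+k , f v e)
    ... | inj₂ (suc k , i+k , choose o v′ e′ x) = inj₂ (k , i+k′ , subst (λ p → within k (suc i) (proj₁ p)) (sym (follows o))
                                                       (subst (λ m → within m (suc i) (proj₁ (move (u , i)))) K∸i (move-wins u i (v′ , e′ , subst (λ m → within m (suc i) v′) (sym K∸i) x))))
      where
      i+k′ : suc i + k ≡ K
      i+k′ = trans (sym (+-suc i k)) i+k
      K∸i : K ∸ suc i ≡ k
      K∸i = trans (cong (_∸ suc i) (sym i+k′)) (m+n∸m≡n (suc i) k)

    dead-end : ∀ h p → Consistent σ (source , 0) h p → DeadEnd p → Any InTarget (p ∷ h) ⊎ ownerOf p ≡ player₂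
    dead-end h (u , i) c dead with invariant c
    ... | inj₁ t                            = inj₁ (there t)
    ... | inj₂ (zero , _ , t)               = inj₁ (here t)
    ... | inj₂ (suc k , _ , hit t)          = inj₁ (here t)
    ... | inj₂ (suc k , _ , forced o _)     = inj₂ o
    ... | inj₂ (suc k , _ , choose _ v e _) = contradiction ((v , suc i) , refl , e) dead

    module _ (π : ℕ → Position) (consistent : ∀ n → Consistent σ (source , 0) (before π n) (π n)) where

      clocked : ∀ {h p} → Consistent σ (source , 0) h p → proj₂ p ≡ length h
      clocked start                = refl
      clocked (step c (refl , _) _) = cong suc (clocked c)

      before-length : ∀ n → length (before π n) ≡ n
      before-length zero    = refl
      before-length (suc n) = cong suc (before-length n)

      visited : ∀ n → Any InTarget (before π n) → ∃ λ m → InTarget (π m)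
      visited (suc n) (here t)  = n , t
      visited (suc n) (there t) = visited n t

      hits : ∃ λ n → InTarget (π n)
      hits with invariant (consistent K)
      ... | inj₁ t             = visited K t
      -- At time `K` no round is left, and being within 0 rounds of the targets means standing on
      -- one.
      ... | inj₂ (k , e , x)   = K , subst (λ m → within m (proj₂ (π K)) (proj₁ (π K))) k≡0 x
        where
        k≡0 : k ≡ 0
        k≡0 = +-cancelˡ-≡ K k 0 (trans (trans (cong (_+ k) (sym (trans (clocked (consistent K)) (before-length K)))) e) (sym (+-identityʳ K)))

    wins : Player₁Wins
    wins = σ , record { legal = λ { h (u , i) _ → move-legal u i } ; finite = dead-end ; infinite = hits }

  -- A trap may contain dead ends of player 1, where `keeps` is vacuous and she loses; `stays`
  -- excludes those of player 2.
  record Trap (X : ℕ → Pred V 0ℓ) : Set where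
    field
      avoids : ∀ {i v} → X i v → ¬ v ∈ target
      keeps  : ∀ {i v} → X i v → owner v ≡ player₁ → ∀ u → E v u i → X (suc i) u
      stays  : ∀ {i v} → X i v → owner v ≡ player₂ → ∃ λ u → E v u i × X (suc i) u

  -- The strategy is played against the trap. The play cannot stop, since a dead end of player 1
  -- reached without a target contradicts `finite`; so it is infinite, and its avoidance of the
  -- targets contradicts `infinite`.
  trapped : ∀ {X} → Trap X → X 0 source → ¬ Player₁Wins
  trapped {X} trap x₀ (σ , winning) = escape (infinite π consistent)
    where
    open Trap trap
    open Winning winning
    record State : Set where
      constructor state
      field
        {past}   : History
        {vertex} : V
        {now}    : ℕ
        follows  : Consistent σ (source , 0) past (vertex , now)
        held     : X now vertex
        missed   : ¬ Any InTarget past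
    open State

    missed-now : ∀ s → ¬ Any InTarget ((vertex s , now s) ∷ past s)
    missed-now s (here t)  = avoids (held s) t
    missed-now s (there t) = missed s t

    extend : ∀ s → ∃ λ v → Consistent σ (source , 0) ((vertex s , now s) ∷ past s) (v , suc (now s)) × X (suc (now s)) v
    extend s = player-cases (owner (vertex s)) by-σ by-trap
      where
      Extension : Set
      Extension = ∃ λ v → Consistent σ (source , 0) ((vertex s , now s) ∷ past s) (v , suc (now s)) × X (suc (now s)) v
      by-trap : owner (vertex s) ≡ player₂ → Extension
      by-trap o₂ with stays (held s) o₂
      ... | u , e , x = u , step (follows s) (refl , e) (λ o₁ → contradiction o₂ (player₁≢player₂ o₁)) , x
      by-σ : owner (vertex s) ≡ player₁ → Extension
      by-σ o₁ with any? (λ v → E? (vertex s) v (now s))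
      ... | no ¬e = case finite _ _ (follows s) (λ { ((v , _) , _ , e) → ¬e (v , e) }) of λ
        { (inj₁ t)  → contradiction t (missed-now s)
        ; (inj₂ o₂) → contradiction o₂ (player₁≢player₂ o₁) }
      ... | yes (v , e) with σ (past s) (vertex s , now s) in eq | legal (past s) (vertex s , now s) o₁ ((v , suc (now s)) , refl , e)
      ...   | u , .(suc (now s)) | refl , e′ = u , step (follows s) (refl , e′) (λ _ → sym eq) , keeps (held s) o₁ u e′

    play : ℕ → State
    play zero    = state start x₀ λ ()
    play (suc n) = state (proj₁ (proj₂ (extend (play n)))) (proj₂ (proj₂ (extend (play n)))) (missed-now (play n))

    π : ℕ → Position
    π n = vertex (play n) , now (play n)

    past≡before : ∀ n → past (play n) ≡ before π n
    past≡before zero    = refl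
    past≡before (suc n) = cong (π n ∷_) (past≡before n)

    consistent : ∀ n → Consistent σ (source , 0) (before π n) (π n)
    consistent n = subst (λ h → Consistent σ (source , 0) h (π n)) (past≡before n) (follows (play n))

    escape : ¬ ∃ λ n → InTarget (π n)
    escape (n , t) = avoids (held (play n)) t

  -- Outside a set closed under `Pre`, player 1 has no move into the set and player 2 always has one
  -- that stays outside.
  complement-trap : (X : ℕ → Pred V 0ℓ) → (∀ i → Decidable (X i)) → (∀ {i} → Pre (At i) (X (suc i)) ⊆ X i) → Trap (λ i v → ¬ X i v)
  complement-trap X X? closed = record
    { avoids = λ ¬x t → ¬x (closed (hit t))
    ; keeps  = λ ¬x o u e x → ¬x (closed (choose o u e x))
    ; stays  = λ {i} {v} ¬x o → stays ¬x o
    }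
    where
    stays : ∀ {i v} → ¬ X i v → owner v ≡ player₂ → ∃ λ u → E v u i × ¬ X (suc i) u
    stays {i} {v} ¬x o with ¬∀⟶∃¬ _ (λ u → E v u i → X (suc i) u) (λ u → E? v u i →-dec X? (suc i) u) (λ f → ¬x (closed (forced o f)))
    ... | u , ¬f with E? v u i
    ...   | yes e = u , e , λ x → ¬f (λ _ → x)
    ...   | no ¬e = contradiction (λ e → contradiction e ¬e) ¬f

  -- The limit graph; declining and improving games

  module Limit (Inf : V → V → Set) (Inf? : ∀ u v → Dec (Inf u v)) where

    attractor : ℕ → Pred V 0ℓ
    attractor zero    = Target
    attractor (suc k) = Pre Inf (attractor k)

    attractor? : ∀ k → Decidable (attractor k)
    attractor? zero    = _∈? target
    attractor? (suc k) = pre? Inf? (attractor? k)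

    attractor-grows : ∀ k → attractor k ⊆ attractor (suc k)
    attractor-grows zero    t = hit t
    attractor-grows (suc k)   = pre-mono (λ _ a → a) (λ _ a → a) (attractor-grows k)

    attractor-stable : ∀ {k} → size ≤ k → attractor (suc k) ⊆ attractor k
    attractor-stable {k} n≤k = stable {k} {0} n≤k
      where
      open Stability (λ k _ → attractor k) (λ k _ → attractor? k) (λ {k} → attractor-grows k) id
        (λ {k} → pre-difference (attractor? k) Inf?)

    target⊆attractor : ∀ k → Target ⊆ attractor k
    target⊆attractor zero    t = t
    target⊆attractor (suc k) t = hit t

    solution : ℕ → ℕ → ℕ → Pred V 0ℓ
    solution a b i = rounds (attractor a) b i

    module Declining-case
      (earlier₁ : ∀ {u v i} → owner u ≡ player₁ → E u v (suc i) → E u v i)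
      (later₂   : ∀ {u v i} → owner u ≡ player₂ → E u v i → E u v (suc i))
      (limit₁   : ∀ {u v i} → owner u ≡ player₁ → Inf u v → E u v i)
      (limit₂   : ∀ {u v i} → owner u ≡ player₂ → E u v i → Inf u v)
      where

      within-shrinks : ∀ k i → within k (suc i) ⊆ within k i
      within-shrinks zero    i = id
      within-shrinks (suc k) i = pre-mono earlier₁ later₂ (within-shrinks k (suc i))

      within-stable : ∀ {k i} → size ≤ k → within (suc k) i ⊆ within k i
      within-stable {k} {i} n≤k = stable {k} {i} n≤k
        where
        open Stability within (rounds? (_∈? target)) (λ {k} {i} → within-grows k i) (λ {k} {i} → within-shrinks k i)
          (λ {k} {i} → pre-difference (rounds? (_∈? target) k (suc i)) (At? i))

      -- In the limit graph player 1 has only edges that are available at every time, and player 2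
      -- has every edge that is ever available. So a win there is a win from any time.
      attractor⊆within : ∀ k i → attractor k ⊆ within k i
      attractor⊆within zero    i = id
      attractor⊆within (suc k) i = pre-mono limit₁ limit₂ (attractor⊆within k (suc i))

      solution⊆within : ∀ a b i → solution a b i ⊆ within (b + a) i
      solution⊆within a zero    i = attractor⊆within a i
      solution⊆within a (suc b) i = pre-mono (λ _ x → x) (λ _ x → x) (solution⊆within a b (suc i))

      -- By `within-stable` the sets `within b` are closed under `Pre`, so their complements form a
      -- trap; and they lie in `solution a b`, whose starting set contains the targets.
      solved : ∀ {a b} → size ≤ b → solution a b 0 source ⇔ Player₁Wins
      solved {a} {b} n≤b = mk⇔ (λ s → Win.wins {b + a} (solution⊆within a b 0 s)) (λ w → decidable-stable (rounds? (attractor? a) b 0 source)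
        (λ ¬s → trapped (complement-trap (within b) (rounds? (_∈? target) b) (λ {i} → within-stable {b} {i} n≤b))
          (λ x → ¬s (rounds-base (target⊆attractor a) b 0 x)) w))

    module Improving-case
      (later₁   : ∀ {u v i} → owner u ≡ player₁ → E u v i → E u v (suc i))
      (earlier₂ : ∀ {u v i} → owner u ≡ player₂ → E u v (suc i) → E u v i)
      (limit₁   : ∀ {u v i} → owner u ≡ player₁ → E u v i → Inf u v)
      (limit₂   : ∀ {u v i} → owner u ≡ player₂ → Inf u v → E u v i)
      (N : ℕ)
      (late     : ∀ {u v i} → N ≤ i → E u v i ⇔ Inf u v)
      {a : ℕ} (n≤a : size ≤ a)
      where

      -- In the base case the limit graph favours player 1 over the edges at time `i`, so a round at
      -- `i` gives no more than a round in the limit graph, and such a round adds nothing to the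
      -- attractor once `size ≤ a`.
      solution-shrinks : ∀ k i → solution a (suc k) i ⊆ solution a k i
      solution-shrinks zero    i x = attractor-stable n≤a (pre-mono limit₁ limit₂ id x)
      solution-shrinks (suc k) i   = pre-mono (λ _ x → x) (λ _ x → x) (solution-shrinks k (suc i))

      solution-later : ∀ k i → solution a k i ⊆ solution a k (suc i)
      solution-later zero    i = id
      solution-later (suc k) i = pre-mono later₁ earlier₂ (solution-later k (suc i))

      solution? : ∀ k i → Decidable (solution a k i)
      solution? = rounds? (attractor? a)

      -- A position outside `solution` is a bounded win of player 2, who owns the decreasing edges
      -- and aims at leaving the attractor or at a dead end of player 1 off the targets. So
      -- `Stability` applies to the complements.
      solution-stable : ∀ {k i} → size ≤ k → solution a k i ⊆ solution a (suc k) i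
      solution-stable {k} {i} n≤k {v} x = decidable-stable (solution? (suc k) i v) (λ ¬x → stable n≤k ¬x x)
        where
        descend : ∀ {k i v} → ¬ solution a (2 + k) i v → ¬ ¬ solution a (1 + k) i v →
                  ∃ λ u → ¬ solution a (1 + k) (suc i) u × ¬ ¬ solution a k (suc i) u
        descend {k} {i} {v} ¬x ¬¬y with pre-difference (solution? (suc k) (suc i)) (At? i) (decidable-stable (solution? (suc k) i v) ¬¬y) ¬x
        ... | u , y , ¬y = u , ¬y , λ ¬y′ → ¬y′ y
        open Stability (λ k i v → ¬ solution a k i v) (λ k i v → ¬? (solution? k i v))
          (λ {k} {i} ¬x x → ¬x (solution-shrinks k i x)) (λ {k} {i} ¬x x → ¬x (solution-later k i x)) (λ {k} {i} {v} → descend {k} {i} {v})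

      attractor⊆within : ∀ k i → N ≤ i → attractor k ⊆ within k i
      attractor⊆within zero    i N≤i = id
      attractor⊆within (suc k) i N≤i = pre-mono (λ _ → Equivalence.from (late N≤i)) (λ _ → Equivalence.to (late N≤i))
                                                (attractor⊆within k (suc i) (m≤n⇒m≤1+n N≤i))

      solution⊆attractor : ∀ k i → solution a k i ⊆ attractor a
      solution⊆attractor zero    i x = x
      solution⊆attractor (suc k) i x = solution⊆attractor k i (solution-shrinks k i x)

      -- By `solution-stable` a round can be played with all `b` rounds still ahead. After `d` such
      -- rounds time `N` has passed, the edges are those of the limit graph, and the attractor is
      -- won in `a` more rounds.
      solution⊆within : ∀ {b} → size ≤ b → ∀ d i → N ≤ i + d → solution a b i ⊆ within (d + a) i
      solution⊆within {b} n≤b zero i N≤i x = attractor⊆within a i (subst (N ≤_) (+-identityʳ i) N≤i) (solution⊆attractor b i x)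
      solution⊆within n≤b (suc d) i N≤i x =
        pre-mono (λ _ e → e) (λ _ e → e) (solution⊆within n≤b d (suc i) (subst (N ≤_) (+-suc i d) N≤i)) (solution-stable n≤b x)

      solved : ∀ {b} → size ≤ b → solution a b 0 source ⇔ Player₁Wins
      solved {b} n≤b = mk⇔ (λ s → Win.wins {N + a} (solution⊆within n≤b N 0 ≤-refl s)) (λ w → decidable-stable (solution? b 0 source)
        (λ ¬s → trapped (complement-trap (solution a b) (solution? b) (λ {i} → solution-shrinks b i)) ¬s w))

-- The decision procedure

pattern 𝟎 = zero
pattern 𝟏 = suc zero

isOne : Maybe Bit → Bool
isOne (just 𝟏) = true
isOne _        = false

toBit : Bool → Bit
toBit false = 𝟎
toBit true  = 𝟏

opposite : Bit → Bit
opposite 𝟎 = 𝟏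
opposite 𝟏 = 𝟎

symbol : Maybe Bit → Bit
symbol (just b) = b
symbol nothing  = 𝟎

playerBit : Player → Bit
playerBit player₁ = 𝟎
playerBit player₂ = 𝟏

-- Refines the verdict "≤ so far" of a comparison, least significant digits
-- first, by one more digit of each side; missing digits count as 0.
refine : Bool → Maybe Bit → Maybe Bit → Bool
refine r x y = if isOne x then isOne y ∧ r else isOne y ∨ r

-- k₁ and k₂ are the two leading bits of a constraint. After a numeral has been
-- read, le and ge tell whether the time is at most, respectively at least, its
-- value.
record Registers : Set where
  constructor regs
  field
    going inf k₁ k₂ le ge nonzero acc : Bool

pattern idle inf acc = regs false inf false false false false false acc

Registers-finite : Finite Registers
Registers-finite = Finite-↔
  (mk↔ₛ′ (λ (regs a b c d e f g h) → (a , b , c , d) , e , f , g , h) (λ ((a , b , c , d) , e , f , g , h) → regs a b c d e f g h)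
         (λ _ → refl) (λ _ → refl))
  (Finite-× four four)
  where
  four : Finite (Bool × Bool × Bool × Bool)
  four = Finite-× Finite-Bool (Finite-× Finite-Bool (Finite-× Finite-Bool Finite-Bool))

open Registers

open Language 8 4 Registers

-- The input, the number of vertices in unary, the owners, the targets, the
-- source in unary, the constraints, the current set of winning vertices, its
-- successor under construction, and the current time in binary.
W NU OWN TGT SRC CON SET NEW TIME : Fin 9
W    = # 0
NU   = # 1
OWN  = # 2
TGT  = # 3
SRC  = # 4
CON  = # 5
SET  = # 6
NEW  = # 7
TIME = # 8

ops : List (Fin 9 × Op) → Vec Op 9
ops []             = Vec.replicate 9 keep
ops ((j , o) ∷ os) = updateAt (ops os) j (λ _ → o)

full? : Fin 9 → Registers → Heads → Bool
full? j _ hs = is-just (lookup hs j)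

moving : ∀ {n} → (Heads → List (Fin 9 × Op)) → Prog n
moving f = basic (λ r hs → r , ops (f hs))

setting : ∀ {n} → (Registers → Heads → Registers) → List (Fin 9 × Op) → Prog n
setting f os = basic (λ r hs → f r hs , ops os)

repeat₀ : ∀ {n} → Prog 0 → Prog (suc n)
repeat₀ = loop (# 0) (s≤s z≤n)

rewind : ∀ {n} → Fin 9 → Prog (suc n)
rewind j = repeat₀ (back j)

-- A loop cannot be left early; clearing `going` at the terminator makes the remaining rounds idle.
unary-body : ∀ {n} → List (Fin 9 × Op) → Prog n
unary-body os = when (λ r _ → going r) (check (full? W) ⨾
  basic (λ r hs → if isOne (lookup hs W) then (r , ops os) else (record r { going = false } , ops ((W , advance) ∷ []))))

unary : ∀ {n} → List (Fin 9 × Op) → Prog (suc n)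
unary os = setting (λ r _ → record r { going = true }) [] ⨾ repeat₀ (unary-body os) ⨾ check (λ r _ → not (going r))

copy-body : ∀ {n} → (Bit → List (Fin 9 × Op)) → Prog n
copy-body os = when (full? NU) (check (full? W) ⨾ moving (λ hs → (W , advance) ∷ (NU , advance) ∷ os (symbol (lookup hs W))))

move-body : ∀ {n} → Fin 9 → Fin 9 → Prog n
move-body i j = when (full? i) (moving (λ hs → (i , advance) ∷ (j , write (symbol (lookup hs i))) ∷ []))

header : ∀ {n} → Prog (suc n)
header =
  unary ((W , advance) ∷ (NU , write 𝟏) ∷ []) ⨾ rewind NU ⨾
  -- The head on `NU` advances with the source, so a symbol left under it means that the source is a
  -- vertex.
  unary ((W , advance) ∷ (NU , advance) ∷ (SRC , write 𝟏) ∷ []) ⨾ check (full? NU) ⨾ rewind NU ⨾ rewind SRC ⨾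
  repeat₀ (copy-body (λ b → (OWN , write b) ∷ [])) ⨾ rewind NU ⨾ rewind OWN ⨾
  -- The targets are also the set that the first pass starts from.
  repeat₀ (copy-body (λ b → (TGT , write b) ∷ (SET , write b) ∷ [])) ⨾ rewind TGT ⨾ rewind SET ⨾
  repeat₀ (move-body W CON) ⨾ rewind CON

digit-body : ∀ {n} → Prog n
digit-body = when (λ r _ → going r) (check (full? CON) ⨾
  setting (λ r hs → record r { going = isOne (lookup hs CON) }) ((CON , advance) ∷ []) ⨾
  when (λ r _ → going r) (check (full? CON) ⨾
    setting (λ r hs → record r { le = refine (le r) (lookup hs TIME) (lookup hs CON)
                               ; ge = refine (ge r) (lookup hs CON) (lookup hs TIME)
                               ; nonzero = nonzero r ∨ isOne (lookup hs CON) })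
            ((CON , advance) ∷ (TIME , advance) ∷ [])))

-- The time may have more digits than the constant; the excess is compared with zeros.
time-body : ∀ {n} → Prog n
time-body = when (full? TIME) (setting (λ r hs → record r { le = refine (le r) (lookup hs TIME) nothing ; ge = refine (ge r) nothing (lookup hs TIME) })
                                       ((TIME , advance) ∷ []))

numeral : ∀ {n} → Prog (suc n)
numeral =
  setting (λ r _ → record r { going = true ; le = true ; ge = true ; nonzero = false }) [] ⨾
  repeat₀ digit-body ⨾ check (λ r _ → not (going r)) ⨾ repeat₀ time-body ⨾ rewind TIME

available : (inf k₁ k₂ le ge : Bool) → Bool
available inf false k₂    le ge = k₂
available inf true  false le ge = not inf ∧ le
available inf true  true  le ge = inf ∨ ge

decreasing-owner : Player → Bool → Bool
decreasing-owner player₁ owner₂ = not owner₂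
decreasing-owner player₂ owner₂ = owner₂

-- The constraint x ≥ 0 is both decreasing and increasing.
monotone : (decreasing k₁ k₂ nonzero : Bool) → Bool
monotone decreasing false k₂ nz = true
monotone true       true  k₂ nz = not (k₂ ∧ nz)
monotone false      true  k₂ nz = k₂

accumulate : (owner₂ acc available good : Bool) → Bool
accumulate false acc a s = acc ∨ (a ∧ s)
accumulate true  acc a s = acc ∧ (not a ∨ s)

constraint : ∀ {n} → Player → Prog (suc n)
constraint p =
  check (full? CON) ⨾ setting (λ r hs → record r { k₁ = isOne (lookup hs CON) }) ((CON , advance) ∷ []) ⨾
  check (full? CON) ⨾ setting (λ r hs → record r { k₂ = isOne (lookup hs CON) }) ((CON , advance) ∷ []) ⨾
  when (λ r _ → k₁ r) numeral ⨾
  check (λ r hs → monotone (decreasing-owner p (isOne (lookup hs OWN))) (k₁ r) (k₂ r) (nonzero r)) ⨾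
  setting (λ r hs → idle (inf r) (accumulate (isOne (lookup hs OWN)) (acc r) (available (inf r) (k₁ r) (k₂ r) (le r) (ge r)) (isOne (lookup hs SET))))
          ((SET , advance) ∷ [])

constraint-body : ∀ {n} → Player → Prog (suc n)
constraint-body p = when (full? SET) (constraint p)

row : ∀ {n} → Player → Prog (2 + n)
row p =
  -- The owner bit is the neutral start: false for the disjunction over the moves of player 1, true
  -- for the conjunction over those of player 2.
  setting (λ r hs → record r { acc = isOne (lookup hs OWN) }) [] ⨾
  loop (# 1) (s≤s (s≤s z≤n)) (constraint-body p) ⨾ rewind SET ⨾
  basic (λ r hs → record r { acc = false } ,
                  ops ((OWN , advance) ∷ (TGT , advance) ∷ (NEW , write (toBit (isOne (lookup hs TGT) ∨ acc r))) ∷ []))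

row-body : ∀ {n} → Player → Prog (2 + n)
row-body p = when (full? OWN) (row p)

-- All rows are judged by the old set, which is why the new one grows on a tape of its own. The
-- check after the rows rejects trailing input.
pass : ∀ {n} → Player → Prog (3 + n)
pass p =
  loop (# 2) (s≤s (s≤s (s≤s z≤n))) (row-body p) ⨾ check (λ r hs → not (full? CON r hs)) ⨾
  rewind CON ⨾ rewind OWN ⨾ rewind TGT ⨾ rewind NEW ⨾ repeat₀ (move-body NEW SET) ⨾ rewind SET ⨾ rewind NEW

hasBit : Bit → Maybe Bit → Bool
hasBit b m = isOne (Maybe.map (λ { 𝟎 → opposite b ; 𝟏 → b }) m)

-- Carry and borrow are alike: digits equal to `c` are flipped, and the first other digit, or the
-- blank after the last one, becomes `c`.
bump-body : ∀ {n} → Bit → Prog n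
bump-body c = when (λ r _ → going r) (basic (λ r hs →
  if hasBit c (lookup hs TIME) then (r , ops ((TIME , write (opposite c)) ∷ []))
                               else (record r { going = false } , ops ((TIME , write c) ∷ []))))

-- Increments the time for c = 1 and decrements it for c = 0.
bump : ∀ {n} → Bit → Prog (suc n)
bump c = setting (λ r _ → record r { going = true }) [] ⨾ repeat₀ (bump-body c) ⨾ rewind TIME

locate-body : ∀ {n} → Prog n
locate-body = when (full? SRC) (moving (λ _ → (SRC , advance) ∷ (SET , advance) ∷ []))

-- The player p owns the decreasing edges.
main : Player → Prog 4
main p =
  header ⨾ setting (λ r _ → record r { inf = true }) [] ⨾ pass p ⨾ loop (# 3) ≤-refl (pass p) ⨾
  loop (# 1) (s≤s (s≤s z≤n)) (bump 𝟏) ⨾ setting (λ r _ → record r { inf = false }) [] ⨾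
  loop (# 3) ≤-refl (bump 𝟎 ⨾ pass p) ⨾ repeat₀ locate-body ⨾ check (λ r hs → isOne (lookup hs SET))

-- Exact effects of the programs on well-formed input

record Run {n} (N : ℕ) (p : Prog n) (m m′ : Memory) : Set where
  constructor run
  field result : ⟪ p ⟫ N m ≡ m′

open Run

infixr 4 _▹_
-- Runs form a record because `⟪ p ⟫` computes: a bare equation would not let `p` be inferred when
-- steps are chained.
_▹_ : ∀ {n N} {p p′ : Prog n} {m m′ m″} → Run N p m m′ → Run N p′ m′ m″ → Run N (p ⨾ p′) m m″
_▹_ {N = N} {p′ = p′} (run e) (run e′) = run (trans (cong (⟪ p′ ⟫ N) e) e′)

when-run : ∀ {n N g} {p : Prog n} {m m′} → g (proj₂ (proj₁ m)) (Vec.map scanned (proj₂ m)) ≡ true → Run N p m m′ → Run N (when g p) m m′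
when-run {N = N} {p = p} {m} e (run r) = run (trans (cong (λ b → if b then ⟪ p ⟫ N m else m) e) r)

check-run : ∀ {n N g r zs} → g r (Vec.map scanned zs) ≡ true → Run {n} N (check g) ((true , r) , zs) ((true , r) , zs)
check-run {r = r} {zs} e = run (cong (λ b → (b , r) , zs) e)

iterate-+ : ∀ {A : Set} (f : A → A) m n x → iterate (m + n) f x ≡ iterate n f (iterate m f x)
iterate-+ f zero    n x = refl
iterate-+ f (suc m) n x = iterate-+ f m n (f x)

iterate-fixed : ∀ {A : Set} {f : A → A} {y} → f y ≡ y → ∀ n → iterate n f y ≡ y
iterate-fixed e zero    = refl
iterate-fixed {f = f} e (suc n) = trans (cong (iterate n f) e) (iterate-fixed e n)

iterate-settles : ∀ {A : Set} {f : A → A} {k N x y} → k ≤ N → iterate k f x ≡ y → f y ≡ y → iterate N f x ≡ y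
iterate-settles {f = f} {k} {N} {x} k≤N e fixed = trans (cong (λ m → iterate m f x) (sym (m+[n∸m]≡n k≤N)))
  (trans (iterate-+ f k (N ∸ k) x) (trans (cong (iterate (N ∸ k) f) e) (iterate-fixed {f = f} fixed (N ∸ k))))

-- How a loop of fixed length does a job of variable length: `k` rounds reach a memory that the body
-- leaves unchanged, and the others idle.
loop-run : ∀ {n N k c c<n p m m′} → k ≤ N → iterate k (⟪ p ⟫ N) m ≡ m′ → ⟪ p ⟫ N m′ ≡ m′ → Run {n} N (loop c c<n p) m m′
loop-run k≤N e fixed = run (iterate-settles k≤N e fixed)

iterate-retreat : ∀ l r {N} → length l ≤ N → iterate N retreat (l , r) ≡ ([] , l ʳ++ r)
iterate-retreat []      r {N} _ = iterate-fixed {f = retreat} refl N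
iterate-retreat (x ∷ l) r (s≤s l≤N) = iterate-retreat l (x ∷ r) l≤N

rewind-run : ∀ {n N} j {q zs l r v} → lookup zs j ≡ (l , r) → length l ≤ N → l ʳ++ r ≡ v →
             Run {suc n} N (rewind j) (q , zs) (q , updateAt zs j (λ _ → [] , v))
rewind-run {N = N} j {q} {zs} e l≤N refl = run (trans (steps N zs) (cong (q ,_)
    (updateAt-cong-local j zs (trans (cong (iterate N retreat) e) (iterate-retreat _ _ l≤N)))))
  where
  steps : ∀ M zs → iterate M (⟪ back {0} j ⟫ N) (q , zs) ≡ (q , updateAt zs j (iterate M retreat))
  steps zero    zs = cong (q ,_) (sym (updateAt-id-local j zs refl))
  steps (suc M) zs = trans (steps M (updateAt zs j retreat)) (cong (q ,_) (updateAt-updateAt j zs))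

variable
  w nu own tgt src con set new tm : Zipper
  g i a₁ a₂ a₃ a₄ a₅ ac : Bool

digits : (Bool → Maybe Bit → Maybe Bit → Bool) → Bool → Zipper → Expansion 2 → Bool
digits u r z []      = r
digits u r z (d ∷ b) = digits u (u r (scanned z) (just d)) (perform advance z) b

leftover : (Bool → Maybe Bit → Maybe Bit → Bool) → Bool → List Bit → Bool
leftover u r []      = r
leftover u r (e ∷ t) = leftover u (u r (just e) nothing) t

skip : ℕ → Zipper → Zipper
skip n = iterate n (perform advance)

-- compare refine compares the time on the right of the zipper with b and
-- compare refine˘ compares b with the time.
compare : (Bool → Maybe Bit → Maybe Bit → Bool) → Bool → Zipper → Expansion 2 → Bool
compare u r z b = leftover u (digits u r z b) (proj₂ (skip (length b) z))

refine˘ : Bool → Maybe Bit → Maybe Bit → Bool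
refine˘ r x y = refine r y x

hasOne : Bool → Expansion 2 → Bool
hasOne nz []      = nz
hasOne nz (d ∷ b) = hasOne (nz ∨ isOne (just d)) b

digits-run : ∀ N b l rest →
  iterate (suc (length b)) (⟪ digit-body {0} ⟫ N)
    ((true , regs true i a₁ a₂ a₃ a₄ a₅ ac) , w ∷ nu ∷ own ∷ tgt ∷ src ∷ (l , encodeNumeral b ++ rest) ∷ set ∷ new ∷ tm ∷ [])
  ≡ ((true , regs false i a₁ a₂ (digits refine a₃ tm b) (digits refine˘ a₄ tm b) (hasOne a₅ b) ac) ,
     w ∷ nu ∷ own ∷ tgt ∷ src ∷ (encodeNumeral b ʳ++ l , rest) ∷ set ∷ new ∷ skip (length b) tm ∷ [])
digits-run N []      l rest = refl
digits-run N (d ∷ b) l rest = digits-run N b (d ∷ 𝟏 ∷ l) rest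

time-run : ∀ N l r →
  iterate (length r) (⟪ time-body {0} ⟫ N)
    ((true , regs g i a₁ a₂ a₃ a₄ a₅ ac) , w ∷ nu ∷ own ∷ tgt ∷ src ∷ con ∷ set ∷ new ∷ (l , r) ∷ [])
  ≡ ((true , regs g i a₁ a₂ (leftover refine a₃ r) (leftover refine˘ a₄ r) a₅ ac) ,
     w ∷ nu ∷ own ∷ tgt ∷ src ∷ con ∷ set ∷ new ∷ (r ʳ++ l , []) ∷ [])
time-run N l []      = refl
time-run N l (x ∷ r) = time-run N (x ∷ l) r

whole : Zipper → List Bit
whole (l , r) = l ʳ++ r

whole-skip : ∀ n z → whole (skip n z) ≡ whole z
whole-skip zero    z           = refl
whole-skip (suc n) (l , [])    = whole-skip n (l , [])
whole-skip (suc n) (l , x ∷ r) = whole-skip n (x ∷ l , r)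

right≤whole : ∀ z → length (proj₂ z) ≤ length (whole z)
right≤whole (l , r) = ≤-trans (m≤n+m _ (length l)) (≤-reflexive (sym (length-ʳ++ l {r})))

left≤whole : ∀ z → length (proj₁ z) ≤ length (whole z)
left≤whole (l , r) = ≤-trans (m≤m+n (length l) _) (≤-reflexive (sym (length-ʳ++ l {r})))

unwind : ∀ (xs : List Bit) {l} → (xs ʳ++ l) ʳ++ [] ≡ l ʳ++ xs
unwind xs {l} = trans (ʳ++-ʳ++ xs) (cong (l ʳ++_) (++-identityʳ xs))

length-traversed : ∀ (xs : List Bit) → length (xs ʳ++ []) ≡ length xs
length-traversed xs = trans (length-ʳ++ xs) (+-identityʳ _)

length-numeral : ∀ b → suc (length b) ≤ length (encodeNumeral b)
length-numeral []      = ≤-refl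
length-numeral (d ∷ b) = s≤s (m≤n⇒m≤1+n (length-numeral b))

numeral-run : ∀ {n N} b l rest t → length (encodeNumeral b) ≤ N → length t ≤ N →
  Run {suc n} N numeral
    ((true , regs g i a₁ a₂ a₃ a₄ a₅ ac) , w ∷ nu ∷ own ∷ tgt ∷ src ∷ (l , encodeNumeral b ++ rest) ∷ set ∷ new ∷ ([] , t) ∷ [])
    ((true , regs false i a₁ a₂ (compare refine true ([] , t) b) (compare refine˘ true ([] , t) b) (hasOne false b) ac) ,
     w ∷ nu ∷ own ∷ tgt ∷ src ∷ (encodeNumeral b ʳ++ l , rest) ∷ set ∷ new ∷ ([] , t) ∷ [])
numeral-run {N = N} b l rest t b≤N t≤N =
  run refl ▹ loop-run (≤-trans (length-numeral b) b≤N) (digits-run N b l rest) refl ▹ run refl ▹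
  loop-run (≤-trans (right≤whole z) z≤N) (time-run N (proj₁ z) (proj₂ z)) refl ▹
  rewind-run TIME refl (≤-trans (≤-reflexive length-left) z≤N) (trans (unwind (proj₂ z)) (whole-skip (length b) ([] , t)))
  where
  z : Zipper
  z = skip (length b) ([] , t)
  z≤N : length (whole z) ≤ N
  z≤N = ≤-trans (≤-reflexive (cong length (whole-skip (length b) ([] , t)))) t≤N
  length-left : length (proj₂ z ʳ++ proj₁ z) ≡ length (whole z)
  length-left = trans (length-ʳ++ (proj₂ z)) (trans (+-comm (length (proj₂ z)) _) (sym (length-ʳ++ (proj₁ z))))

-- What a successful run reveals about the input

record Passes {n} (N : ℕ) (p : Prog n) (m : Memory) : Set where
  constructor passes
  field success : passed (⟪ p ⟫ N m) ≡ true

infixl 4 _⊳_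
-- Walks along a successful run: once the form of the next piece of input is known, its exact run is
-- replayed and cut off.
_⊳_ : ∀ {n N} {p p′ : Prog n} {m m′} → Passes N (p ⨾ p′) m → Run N p m m′ → Passes N p′ m′
_⊳_ {N = N} {p′ = p′} (passes s) (run e) = passes (trans (cong (passed ∘ ⟪ p′ ⟫ N) (sym e)) s)

true≢false : true ≢ false
true≢false ()

passed-before : ∀ {n} (p : Prog n) N m → passed (⟪ p ⟫ N m) ≡ true → passed m ≡ true
passed-before p N m s with passed m in e
... | true  = refl
... | false = contradiction (trans (sym s) (failed-stays p N m e)) true≢false

passed-before-iterate : ∀ {n} (p : Prog n) N j m → passed (iterate j (⟪ p ⟫ N) m) ≡ true → passed m ≡ true
passed-before-iterate p N j m s with passed m in e
... | true  = refl
... | false = contradiction (trans (sym s) (failed-iterate (failed-stays p N) j m e)) true≢false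

passes-when : ∀ {n N g} {p : Prog n} {m} → g (proj₂ (proj₁ m)) (Vec.map scanned (proj₂ m)) ≡ true → Passes N (when g p) m → Passes N p m
passes-when {N = N} {p = p} {m} e (passes s) = passes (trans (cong (λ b → passed (if b then ⟪ p ⟫ N m else m)) (sym e)) s)

started : ∀ {n N} {p : Prog n} {m} → Passes N p m → passed m ≡ true
started {N = N} {p} {m} (passes s) = passed-before p N m s

initially : ∀ {n N} {p p′ : Prog n} {m} → Passes N (p ⨾ p′) m → Passes N p m
initially {N = N} {p} {p′} {m} (passes s) = passes (passed-before p′ N (⟪ p ⟫ N m) s)

avail : Bool → List Bit → Constraint → Bool
avail inf t never  = false
avail inf t always = true
avail inf t (x≤ b) = not inf ∧ compare refine true ([] , t) b
avail inf t (x≥ b) = inf ∨ compare refine˘ true ([] , t) b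

proper : Bool → Constraint → Bool
proper dec never  = true
proper dec always = true
proper dec (x≤ b) = monotone dec true false (hasOne false b)
proper dec (x≥ b) = monotone dec true true (hasOne false b)

bits : ∀ {n} → Vec Bit n → List Bit
bits = Vec.toList

length-bits : ∀ {n} (xs : Vec Bit n) → length (bits xs) ≡ n
length-bits []       = refl
length-bits (x ∷ xs) = cong suc (length-bits xs)

module Correctness (p : Player) where

  dec : Bit → Bool
  dec o = decreasing-owner p (isOne (just o))

  update : Bit → Bool → List Bit → Bool → Constraint → Bit → Bool
  update o inf t acc c x = accumulate (isOne (just o)) acc (avail inf t c) (isOne (just x))

  constraint-run : ∀ {n N o lo ro x ls rs} c l rest t → length (encodeConstraint c) ≤ N → length t ≤ N → proper (dec o) c ≡ true →
    Run {suc n} N (constraint p)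
      ((true , idle i ac) , w ∷ nu ∷ (lo , o ∷ ro) ∷ tgt ∷ src ∷ (l , encodeConstraint c ++ rest) ∷ (ls , x ∷ rs) ∷ new ∷ ([] , t) ∷ [])
      ((true , idle i (update o i t ac c x)) ,
       w ∷ nu ∷ (lo , o ∷ ro) ∷ tgt ∷ src ∷ (encodeConstraint c ʳ++ l , rest) ∷ (x ∷ ls , rs) ∷ new ∷ ([] , t) ∷ [])
  constraint-run never  l rest t c≤N t≤N ok = run refl ▹ run refl ▹ run refl ▹ run refl ▹ run refl ▹ run refl ▹ run refl
  constraint-run always l rest t c≤N t≤N ok = run refl ▹ run refl ▹ run refl ▹ run refl ▹ run refl ▹ run refl ▹ run refl
  constraint-run (x≤ b) l rest t c≤N t≤N ok = run refl ▹ run refl ▹ run refl ▹ run refl ▹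
    when-run refl (numeral-run b (𝟎 ∷ 𝟏 ∷ l) rest t (≤-trans (m≤n+m _ 2) c≤N) t≤N) ▹ check-run ok ▹ run refl
  constraint-run (x≥ b) l rest t c≤N t≤N ok = run refl ▹ run refl ▹ run refl ▹ run refl ▹
    when-run refl (numeral-run b (𝟏 ∷ 𝟏 ∷ l) rest t (≤-trans (m≤n+m _ 2) c≤N) t≤N) ▹ check-run ok ▹ run refl

  -- Running out of input also clears `going`, but it fails a check. So `going` cleared with the
  -- flag intact means that a terminator was read.
  digits-sound : ∀ N j l r →
    let m = iterate j (⟪ digit-body {0} ⟫ N)
              ((true , regs true i a₁ a₂ a₃ a₄ a₅ ac) , w ∷ nu ∷ own ∷ tgt ∷ src ∷ (l , r) ∷ set ∷ new ∷ tm ∷ [])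
    in passed m ∧ not (going (proj₂ (proj₁ m))) ≡ true → ∃₂ λ b rest → r ≡ encodeNumeral b ++ rest
  digits-sound N zero    l r s = contradiction (sym s) true≢false
  digits-sound N (suc j) l [] s = contradiction s (failed-digits j _ refl)
    where
    failed-digits : ∀ j m → passed m ≡ false →
      let m′ = iterate j (⟪ digit-body {0} ⟫ N) m in passed m′ ∧ not (going (proj₂ (proj₁ m′))) ≢ true
    failed-digits j m e s = true≢false (trans (sym (∧-conicalˡ _ _ s)) (failed-iterate (failed-stays (digit-body {0}) N) j m e))
  digits-sound N (suc j) l (𝟎 ∷ r) s = [] , r , refl
  digits-sound N (suc j) l (𝟏 ∷ []) s =
    contradiction (trans (sym (∧-conicalˡ _ _ s)) (failed-iterate (failed-stays (digit-body {0}) N) j _ refl)) true≢false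
  digits-sound N (suc j) l (𝟏 ∷ d ∷ r) s with digits-sound N j (d ∷ 𝟏 ∷ l) r s
  ... | b , rest , refl = d ∷ b , rest , refl

  numeral-sound : ∀ {n} N l r →
    Passes {suc n} N numeral ((true , regs g i a₁ a₂ a₃ a₄ a₅ ac) , w ∷ nu ∷ own ∷ tgt ∷ src ∷ (l , r) ∷ set ∷ new ∷ tm ∷ []) →
    ∃₂ λ b rest → r ≡ encodeNumeral b ++ rest
  numeral-sound N l r P = digits-sound N N l r (started (P ⊳ run refl ⊳ run refl ⊳ run refl))

  constraint-sound : ∀ {n N o lo ro x ls rs} l r t → length r ≤ N → length t ≤ N →
    Passes {suc n} N (constraint p)
      ((true , idle i ac) , w ∷ nu ∷ (lo , o ∷ ro) ∷ tgt ∷ src ∷ (l , r) ∷ (ls , x ∷ rs) ∷ new ∷ ([] , t) ∷ []) →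
    ∃₂ λ c rest → r ≡ encodeConstraint c ++ rest × proper (dec o) c ≡ true
  constraint-sound l []            t r≤N t≤N P = contradiction (sym (started (P ⊳ run refl))) true≢false
  constraint-sound l (x ∷ [])      t r≤N t≤N P = contradiction (sym (started (P ⊳ run refl ⊳ run refl ⊳ run refl))) true≢false
  constraint-sound l (𝟎 ∷ 𝟎 ∷ r)   t r≤N t≤N P = never , r , refl , refl
  constraint-sound l (𝟎 ∷ 𝟏 ∷ r)   t r≤N t≤N P = always , r , refl , refl
  constraint-sound {N = N} l (𝟏 ∷ k ∷ r) t r≤N t≤N P with P ⊳ run refl ⊳ run refl ⊳ run refl ⊳ run refl
  ... | P′ with numeral-sound N (k ∷ 𝟏 ∷ l) r (passes-when refl (initially P′))
  constraint-sound {N = N} l (𝟏 ∷ k ∷ r) t r≤N t≤N P | P′ | b , rest , refl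
    -- The numeral being known, its run can be replayed up to the check of monotonicity, whose
    -- success is `ok`.
    with started (P′ ⊳ when-run refl (numeral-run b (k ∷ 𝟏 ∷ l) rest t
           (≤-trans (≤-trans (length-++-≤ˡ (encodeNumeral b)) (m≤n+m _ 2)) r≤N) t≤N) ⊳ run refl)
  constraint-sound l (𝟏 ∷ 𝟎 ∷ r) t r≤N t≤N P | P′ | b , rest , refl | ok = (x≤ b) , rest , refl , ok
  constraint-sound l (𝟏 ∷ 𝟏 ∷ r) t r≤N t≤N P | P′ | b , rest , refl | ok = (x≥ b) , rest , refl , ok

  fold-row : ∀ {n} → Bit → Bool → List Bit → Bool → Vec Constraint n → Vec Bit n → Bool
  fold-row o inf t acc []       []       = acc
  fold-row o inf t acc (c ∷ cs) (x ∷ xs) = fold-row o inf t (update o inf t acc c x) cs xs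

  Row : ℕ → Set
  Row = Vec Constraint

  encodeRow : ∀ {n} → Row n → List Bit
  encodeRow = encodeVec encodeConstraint

  Proper : ∀ {n} → Bit → Row n → Set
  Proper o cs = ∀ v → proper (dec o) (lookup cs v) ≡ true

  constraints-run : ∀ {n N i ac w nu tgt src new o lo ro} (cs : Row n) (xs : Vec Bit n) l ls rest t → length (encodeRow cs) ≤ N → length t ≤ N → Proper o cs →
    iterate n (⟪ constraint-body {0} p ⟫ N)
      ((true , idle i ac) , w ∷ nu ∷ (lo , o ∷ ro) ∷ tgt ∷ src ∷ (l , encodeRow cs ++ rest) ∷ (ls , bits xs) ∷ new ∷ ([] , t) ∷ [])
    ≡ ((true , idle i (fold-row o i t ac cs xs)) ,
       w ∷ nu ∷ (lo , o ∷ ro) ∷ tgt ∷ src ∷ (encodeRow cs ʳ++ l , rest) ∷ (bits xs ʳ++ ls , []) ∷ new ∷ ([] , t) ∷ [])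
  constraints-run []       []       l ls rest t _ _ _ = refl
  constraints-run {suc n} {N} {i} {ac} {w} {nu} {tgt} {src} {new} {o} {lo} {ro} (c ∷ cs) (x ∷ xs) l ls rest t cs≤N t≤N ok
    = trans (cong (λ v → iterate (suc n) (⟪ constraint-body {0} p ⟫ N)
              ((true , idle i ac) , w ∷ nu ∷ (lo , o ∷ ro) ∷ tgt ∷ src ∷ (l , v) ∷ (ls , bits (x ∷ xs)) ∷ new ∷ ([] , t) ∷ [])) (++-assoc (encodeConstraint c) (encodeRow cs) rest))
     (trans (cong (iterate n (⟪ constraint-body {0} p ⟫ N))
              (result (constraint-run {n = 0} c l (encodeRow cs ++ rest) t (≤-trans (length-++-≤ˡ (encodeConstraint c)) cs≤N) t≤N (ok zero))))
     (trans (constraints-run cs xs (encodeConstraint c ʳ++ l) (x ∷ ls) rest t (≤-trans (length-++-≤ʳ (encodeRow cs) {encodeConstraint c}) cs≤N) t≤N (ok ∘ suc))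
            (cong (λ v → (true , idle i (fold-row o i t ac (c ∷ cs) (x ∷ xs))) ,
              w ∷ nu ∷ (lo , o ∷ ro) ∷ tgt ∷ src ∷ (v , rest) ∷ (bits (x ∷ xs) ʳ++ ls , []) ∷ new ∷ ([] , t) ∷ [])
              (sym (++-ʳ++ (encodeConstraint c))))))

  constraints-sound : ∀ {n N o lo ro} j (xs : Vec Bit n) l r ls t → n ≤ j → length r ≤ N → length t ≤ N →
    passed (iterate j (⟪ constraint-body {0} p ⟫ N)
      ((true , idle i ac) , w ∷ nu ∷ (lo , o ∷ ro) ∷ tgt ∷ src ∷ (l , r) ∷ (ls , bits xs) ∷ new ∷ ([] , t) ∷ [])) ≡ true →
    ∃₂ λ (cs : Row n) rest → r ≡ encodeRow cs ++ rest × Proper o cs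
  constraints-sound j       []       l r ls t _ _ _ _ = [] , r , refl , λ ()
  constraints-sound {N = N} (suc j) (x ∷ xs) l r ls t (s≤s n≤j) r≤N t≤N s
    with constraint-sound {n = 0} l r t r≤N t≤N (passes (passed-before-iterate (constraint-body {0} p) N j _ s))
  ... | c , r′ , refl , ok
    with constraints-sound {N = N} j xs (encodeConstraint c ʳ++ l) r′ (x ∷ ls) t n≤j (≤-trans (length-++-≤ʳ r′ {encodeConstraint c}) r≤N) t≤N
           (trans (cong (passed ∘ iterate j (⟪ constraint-body {0} p ⟫ N)) (sym (result (constraint-run {n = 0} c l r′ t (≤-trans (length-++-≤ˡ (encodeConstraint c)) r≤N) t≤N ok)))) s)
  ... | cs , rest , refl , oks = c ∷ cs , rest , sym (++-assoc (encodeConstraint c) (encodeRow cs) rest) , λ { zero → ok ; (suc v) → oks v }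

module Passing (p : Player) where
  open Correctness p

  bit-cell : ∀ {n} → Bool → List Bit → Vec Bit n → Bit → Bit → Row n → Bit
  bit-cell inf t xs o f cs = toBit (isOne (just f) ∨ fold-row o inf t (isOne (just o)) cs xs)

  row-run : ∀ {n k N o lo ro f lf rf ln rn} (cs : Row n) (xs : Vec Bit n) l rest t →
    n ≤ N → length (encodeRow cs) ≤ N → length t ≤ N → Proper o cs →
    Run {2 + k} N (row p)
      ((true , idle i ac) , w ∷ nu ∷ (lo , o ∷ ro) ∷ (lf , f ∷ rf) ∷ src ∷ (l , encodeRow cs ++ rest) ∷ ([] , bits xs) ∷ (ln , rn) ∷ ([] , t) ∷ [])
      ((true , idle i false) ,
       w ∷ nu ∷ (o ∷ lo , ro) ∷ (f ∷ lf , rf) ∷ src ∷ (encodeRow cs ʳ++ l , rest) ∷ ([] , bits xs) ∷ (bit-cell i t xs o f cs ∷ ln , drop 1 rn) ∷ ([] , t) ∷ [])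
  row-run {N = N} cs xs l rest t n≤N cs≤N t≤N ok =
    run refl ▹ loop-run n≤N (constraints-run {N = N} cs xs l [] rest t cs≤N t≤N ok) refl ▹
    rewind-run SET refl (≤-trans (≤-reflexive (trans (length-traversed (bits xs)) (length-bits xs))) n≤N) (unwind (bits xs)) ▹ run refl

  row-sound : ∀ {n k N o lo ro ln rn} (xs : Vec Bit n) l r t → n ≤ N → length r ≤ N → length t ≤ N →
    Passes {2 + k} N (row p)
      ((true , idle i ac) , w ∷ nu ∷ (lo , o ∷ ro) ∷ tgt ∷ src ∷ (l , r) ∷ ([] , bits xs) ∷ (ln , rn) ∷ ([] , t) ∷ []) →
    ∃₂ λ (cs : Row n) rest → r ≡ encodeRow cs ++ rest × Proper o cs
  row-sound {N = N} xs l r t n≤N r≤N t≤N P =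
    constraints-sound {N = N} N xs l r [] t n≤N r≤N t≤N (Passes.success (initially (P ⊳ run refl)))

  Matrix : ℕ → ℕ → Set
  Matrix m n = Vec (Row n) m

  encodeMatrix : ∀ {m n} → Matrix m n → List Bit
  encodeMatrix = encodeVec encodeRow

  ProperMatrix : ∀ {m n} → Vec Bit m → Matrix m n → Set
  ProperMatrix os css = ∀ u → Proper (lookup os u) (lookup css u)

  update-rows : ∀ {m n} → Bool → List Bit → Vec Bit m → Vec Bit m → Matrix m n → Vec Bit n → Vec Bit m
  update-rows inf t []       []       []         xs = []
  update-rows inf t (o ∷ os) (f ∷ fs) (cs ∷ css) xs = bit-cell inf t xs o f cs ∷ update-rows inf t os fs css xs

  rows-run : ∀ {m n N i w nu src} (os fs : Vec Bit m) (css : Matrix m n) (xs : Vec Bit n) lo lf l ln rn rest t →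
    n ≤ N → length (encodeMatrix css) ≤ N → length t ≤ N → length rn ≤ m → ProperMatrix os css →
    iterate m (⟪ row-body {0} p ⟫ N)
      ((true , idle i false) , w ∷ nu ∷ (lo , bits os) ∷ (lf , bits fs) ∷ src ∷ (l , encodeMatrix css ++ rest) ∷ ([] , bits xs) ∷ (ln , rn) ∷ ([] , t) ∷ [])
    ≡ ((true , idle i false) ,
       w ∷ nu ∷ (bits os ʳ++ lo , []) ∷ (bits fs ʳ++ lf , []) ∷ src ∷ (encodeMatrix css ʳ++ l , rest) ∷ ([] , bits xs) ∷
       (bits (update-rows i t os fs css xs) ʳ++ ln , []) ∷ ([] , t) ∷ [])
  rows-run []       []       []         xs lo lf l ln [] rest t n≤N css≤N t≤N rn≤m ok = refl
  rows-run {suc m} {n} {N} {i} {w} {nu} {src} (o ∷ os) (f ∷ fs) (cs ∷ css) xs lo lf l ln rn rest t n≤N css≤N t≤N rn≤m ok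
    = trans (cong (λ v → iterate (suc m) (⟪ row-body {0} p ⟫ N)
              ((true , idle i false) , w ∷ nu ∷ (lo , bits (o ∷ os)) ∷ (lf , bits (f ∷ fs)) ∷ src ∷ (l , v) ∷ ([] , bits xs) ∷ (ln , rn) ∷ ([] , t) ∷ [])) (++-assoc (encodeRow cs) (encodeMatrix css) rest))
     (trans (cong (iterate m (⟪ row-body {0} p ⟫ N))
              (result (row-run {ac = false} {k = 0} cs xs l (encodeMatrix css ++ rest) t n≤N (≤-trans (length-++-≤ˡ (encodeRow cs)) css≤N) t≤N (ok zero))))
     (trans (rows-run os fs css xs (o ∷ lo) (f ∷ lf) (encodeRow cs ʳ++ l) (bit-cell _ t xs o f cs ∷ ln) (drop 1 rn) rest t n≤N
              (≤-trans (length-++-≤ʳ (encodeMatrix css) {encodeRow cs}) css≤N) t≤N (drop≤ rn rn≤m) (ok ∘ suc))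
            (cong (λ v → (true , idle i false) , w ∷ nu ∷ (bits (o ∷ os) ʳ++ lo , []) ∷ (bits (f ∷ fs) ʳ++ lf , []) ∷ src ∷ (v , rest) ∷ ([] , bits xs) ∷
              (bits (update-rows i t (o ∷ os) (f ∷ fs) (cs ∷ css) xs) ʳ++ ln , []) ∷ ([] , t) ∷ []) (sym (++-ʳ++ (encodeRow cs))))))
    where
    drop≤ : ∀ rn → length rn ≤ suc m → length (drop 1 rn) ≤ m
    drop≤ []       _         = z≤n
    drop≤ (_ ∷ rn) (s≤s rn≤m) = rn≤m

  rows-sound : ∀ {m n N} j (os fs : Vec Bit m) (xs : Vec Bit n) lo lf l r ln rn t → m ≤ j → n ≤ N → length r ≤ N → length t ≤ N →
    passed (iterate j (⟪ row-body {0} p ⟫ N)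
      ((true , idle i false) , w ∷ nu ∷ (lo , bits os) ∷ (lf , bits fs) ∷ src ∷ (l , r) ∷ ([] , bits xs) ∷ (ln , rn) ∷ ([] , t) ∷ [])) ≡ true →
    ∃₂ λ (css : Matrix m n) rest → r ≡ encodeMatrix css ++ rest × ProperMatrix os css
  rows-sound j [] [] xs lo lf l r ln rn t _ _ _ _ _ = [] , r , refl , λ ()
  rows-sound {N = N} (suc j) (o ∷ os) (f ∷ fs) xs lo lf l r ln rn t (s≤s m≤j) n≤N r≤N t≤N s
    with row-sound {ac = false} {k = 0} {N = N} xs l r t n≤N r≤N t≤N (passes (passed-before-iterate (row-body {0} p) N j _ s))
  ... | cs , r′ , refl , ok
    with rows-sound {N = N} j os fs xs (o ∷ lo) (f ∷ lf) (encodeRow cs ʳ++ l) r′ (bit-cell _ t xs o f cs ∷ ln) (drop 1 rn) t m≤j n≤N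
           (≤-trans (length-++-≤ʳ r′ {encodeRow cs}) r≤N) t≤N
           (trans (cong (passed ∘ iterate j (⟪ row-body {0} p ⟫ N)) (sym (result (row-run {ac = false} {k = 0} cs xs l r′ t n≤N (≤-trans (length-++-≤ˡ (encodeRow cs)) r≤N) t≤N ok)))) s)
  ... | css , rest , refl , oks = cs ∷ css , rest , sym (++-assoc (encodeRow cs) (encodeMatrix css) rest) , λ { zero → ok ; (suc u) → oks u }

  new-to-set-run : ∀ N (xs ys : List Bit) l ls → length ys ≤ length xs →
    iterate (length xs) (⟪ move-body {0} NEW SET ⟫ N)
      ((true , idle i ac) , w ∷ nu ∷ own ∷ tgt ∷ src ∷ con ∷ (ls , ys) ∷ (l , xs) ∷ tm ∷ [])
    ≡ ((true , idle i ac) , w ∷ nu ∷ own ∷ tgt ∷ src ∷ con ∷ (xs ʳ++ ls , []) ∷ (xs ʳ++ l , []) ∷ tm ∷ [])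
  new-to-set-run N []       []       l ls _ = refl
  new-to-set-run N (x ∷ xs) []       l ls _ = new-to-set-run N xs [] (x ∷ l) (x ∷ ls) z≤n
  new-to-set-run N (x ∷ xs) (y ∷ ys) l ls (s≤s ys≤xs) = new-to-set-run N xs ys (x ∷ l) (x ∷ ls) ys≤xs

  -- The constraint tape is arbitrary here, so that the memory can be named before a matrix encoded
  -- on it is known.
  module Sized {n : ℕ} (os fs : Vec Bit n) (r : List Bit) where

    at : Bool → Zipper → Zipper → Zipper → Vec Bit n → List Bit → List Bit → Memory
    at inf w nu src xs rn t =
      (true , idle inf false) , w ∷ nu ∷ ([] , bits os) ∷ ([] , bits fs) ∷ src ∷ ([] , r) ∷ ([] , bits xs) ∷ ([] , rn) ∷ ([] , t) ∷ []

  module Step {n : ℕ} (os fs : Vec Bit n) (css : Matrix n n) where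

    next-set : Bool → List Bit → Vec Bit n → Vec Bit n
    next-set inf t xs = update-rows inf t os fs css xs

  module Given {n : ℕ} (os fs : Vec Bit n) (css : Matrix n n) (ok : ProperMatrix os css) where

    r : List Bit
    r = encodeMatrix css

    open Sized os fs r public

    open Step os fs css

    rewind-bits : ∀ {k N} j {q zs} (xs : Vec Bit n) → n ≤ N → lookup zs j ≡ (bits xs ʳ++ [] , []) →
                  Run {suc k} N (rewind j) (q , zs) (q , updateAt zs j (λ _ → [] , bits xs))
    rewind-bits j xs n≤N e =
      rewind-run j e (≤-trans (≤-reflexive (trans (length-traversed (bits xs)) (length-bits xs))) n≤N) (unwind (bits xs))

    pass-run : ∀ {k N} xs rn t → n ≤ N → length r ≤ N → length t ≤ N → length rn ≤ n →
      Run {3 + k} N (pass p) (at i w nu src xs rn t) (at i w nu src (next-set i t xs) (bits (next-set i t xs)) t)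
    pass-run {N = N} xs rn t n≤N r≤N t≤N rn≤n =
      loop-run n≤N (trans (cong (λ v → iterate n (⟪ row-body {0} p ⟫ N) (_ , _ ∷ _ ∷ _ ∷ _ ∷ _ ∷ ([] , v) ∷ _ ∷ _ ∷ _ ∷ [])) (sym (++-identityʳ r)))
                     (rows-run {N = N} os fs css xs [] [] [] [] rn [] t n≤N r≤N t≤N rn≤n ok)) refl ▹
      run refl ▹
      rewind-run CON refl (≤-trans (≤-reflexive (length-traversed r)) r≤N) (unwind r) ▹
      rewind-bits OWN os n≤N refl ▹ rewind-bits TGT fs n≤N refl ▹ rewind-bits NEW ys n≤N refl ▹
      loop-run (≤-trans (≤-reflexive (length-bits ys)) n≤N) (new-to-set-run N (bits ys) (bits xs) [] []
        (≤-reflexive (trans (length-bits xs) (sym (length-bits ys))))) refl ▹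
      rewind-bits SET ys n≤N refl ▹ rewind-bits NEW ys n≤N refl
      where
      ys : Vec Bit n
      ys = next-set _ t xs

  pass-sound : ∀ {n k N} (os fs : Vec Bit n) xs rn r t → n ≤ N → length r ≤ N → length t ≤ N → length rn ≤ n →
    Passes {3 + k} N (pass p) (Sized.at os fs r i w nu src xs rn t) → ∃ λ (css : Matrix n n) → r ≡ encodeMatrix css × ProperMatrix os css
  pass-sound {N = N} os fs xs rn r t n≤N r≤N t≤N rn≤n P
    with rows-sound {N = N} N os fs xs [] [] [] r [] rn t n≤N n≤N r≤N t≤N (Passes.success (initially P))
  ... | css , [] , refl , ok = css , ++-identityʳ _ , ok
  -- A bit left after the last row would fail the check that `CON` is exhausted.
  ... | css , b ∷ rest , refl , ok = contradiction (sym (started (P ⊳ loop-run n≤N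
      (rows-run {N = N} os fs css xs [] [] [] [] rn (b ∷ rest) t n≤N (≤-trans (length-++-≤ˡ (encodeMatrix css)) r≤N) t≤N rn≤n ok) refl ⊳ run refl))) true≢false

-- Reading the header

ones : ℕ → List Bit
ones n = replicate n 1b

length-ones : ∀ n → length (ones n) ≡ n
length-ones zero    = refl
length-ones (suc n) = cong suc (length-ones n)

size-unary : List (Fin 9 × Op)
size-unary = (W , advance) ∷ (NU , write 𝟏) ∷ []

source-unary : List (Fin 9 × Op)
source-unary = (W , advance) ∷ (NU , advance) ∷ (SRC , write 𝟏) ∷ []

to-owners to-targets : Bit → List (Fin 9 × Op)
to-owners b  = (OWN , write b) ∷ []
to-targets b = (TGT , write b) ∷ (SET , write b) ∷ []

size-run : ∀ N n l ln rest →
  iterate (suc n) (⟪ unary-body {0} size-unary ⟫ N)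
    ((true , regs true i a₁ a₂ a₃ a₄ a₅ ac) , (l , encodeUnary n ++ rest) ∷ (ln , []) ∷ own ∷ tgt ∷ src ∷ con ∷ set ∷ new ∷ tm ∷ [])
  ≡ ((true , regs false i a₁ a₂ a₃ a₄ a₅ ac) , (encodeUnary n ʳ++ l , rest) ∷ (ones n ʳ++ ln , []) ∷ own ∷ tgt ∷ src ∷ con ∷ set ∷ new ∷ tm ∷ [])
size-run N zero    l ln rest = refl
size-run N (suc n) l ln rest = size-run N n (𝟏 ∷ l) (𝟏 ∷ ln) rest

source-run : ∀ N n l ls rest →
  iterate (suc n) (⟪ unary-body {0} source-unary ⟫ N)
    ((true , regs true i a₁ a₂ a₃ a₄ a₅ ac) , (l , encodeUnary n ++ rest) ∷ nu ∷ own ∷ tgt ∷ (ls , []) ∷ con ∷ set ∷ new ∷ tm ∷ [])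
  ≡ ((true , regs false i a₁ a₂ a₃ a₄ a₅ ac) , (encodeUnary n ʳ++ l , rest) ∷ skip n nu ∷ own ∷ tgt ∷ (ones n ʳ++ ls , []) ∷ con ∷ set ∷ new ∷ tm ∷ [])
source-run N zero    l ls rest = refl
source-run N (suc n) l ls rest = source-run N n (𝟏 ∷ l) (𝟏 ∷ ls) rest

finished-reading : Memory → Bool
finished-reading m = passed m ∧ not (going (proj₂ (proj₁ m)))

failed-reading : ∀ {n} (p : Prog n) N j m → passed m ≡ false → finished-reading (iterate j (⟪ p ⟫ N) m) ≢ true
failed-reading p N j m e s = true≢false (trans (sym (∧-conicalˡ _ _ s)) (failed-iterate (failed-stays p N) j m e))

size-sound : ∀ N j l r →
  finished-reading (iterate j (⟪ unary-body {0} size-unary ⟫ N)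
    ((true , regs true i a₁ a₂ a₃ a₄ a₅ ac) , (l , r) ∷ nu ∷ own ∷ tgt ∷ src ∷ con ∷ set ∷ new ∷ tm ∷ [])) ≡ true →
  ∃₂ λ n rest → r ≡ encodeUnary n ++ rest
size-sound N zero    l r s = contradiction (sym s) true≢false
size-sound N (suc j) l [] s = contradiction s (failed-reading (unary-body {0} size-unary) N j _ refl)
size-sound N (suc j) l (𝟎 ∷ r) s = 0 , r , refl
size-sound N (suc j) l (𝟏 ∷ r) s with size-sound N j (𝟏 ∷ l) r s
... | n , rest , refl = suc n , rest , refl

source-sound : ∀ N j l r →
  finished-reading (iterate j (⟪ unary-body {0} source-unary ⟫ N)
    ((true , regs true i a₁ a₂ a₃ a₄ a₅ ac) , (l , r) ∷ nu ∷ own ∷ tgt ∷ src ∷ con ∷ set ∷ new ∷ tm ∷ [])) ≡ true →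
  ∃₂ λ n rest → r ≡ encodeUnary n ++ rest
source-sound N zero    l r s = contradiction (sym s) true≢false
source-sound N (suc j) l [] s = contradiction s (failed-reading (unary-body {0} source-unary) N j _ refl)
source-sound N (suc j) l (𝟎 ∷ r) s = 0 , r , refl
source-sound N (suc j) l (𝟏 ∷ r) s with source-sound N j (𝟏 ∷ l) r s
... | n , rest , refl = suc n , rest , refl

owners-run : ∀ {n} N (xs : Vec Bit n) l ln lo rest →
  iterate n (⟪ copy-body {0} to-owners ⟫ N)
    ((true , idle i ac) , (l , bits xs ++ rest) ∷ (ln , ones n) ∷ (lo , []) ∷ tgt ∷ src ∷ con ∷ set ∷ new ∷ tm ∷ [])
  ≡ ((true , idle i ac) , (bits xs ʳ++ l , rest) ∷ (ones n ʳ++ ln , []) ∷ (bits xs ʳ++ lo , []) ∷ tgt ∷ src ∷ con ∷ set ∷ new ∷ tm ∷ [])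
owners-run N []       l ln lo rest = refl
owners-run N (x ∷ xs) l ln lo rest = owners-run N xs (x ∷ l) (𝟏 ∷ ln) (x ∷ lo) rest

targets-run : ∀ {n} N (xs : Vec Bit n) l ln lt ls rest →
  iterate n (⟪ copy-body {0} to-targets ⟫ N)
    ((true , idle i ac) , (l , bits xs ++ rest) ∷ (ln , ones n) ∷ own ∷ (lt , []) ∷ src ∷ con ∷ (ls , []) ∷ new ∷ tm ∷ [])
  ≡ ((true , idle i ac) , (bits xs ʳ++ l , rest) ∷ (ones n ʳ++ ln , []) ∷ own ∷ (bits xs ʳ++ lt , []) ∷ src ∷ con ∷ (bits xs ʳ++ ls , []) ∷ new ∷ tm ∷ [])
targets-run N []       l ln lt ls rest = refl
targets-run N (x ∷ xs) l ln lt ls rest = targets-run N xs (x ∷ l) (𝟏 ∷ ln) (x ∷ lt) (x ∷ ls) rest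

owners-sound : ∀ N j n l ln r → n ≤ j →
  passed (iterate j (⟪ copy-body {0} to-owners ⟫ N)
    ((true , idle i ac) , (l , r) ∷ (ln , ones n) ∷ own ∷ tgt ∷ src ∷ con ∷ set ∷ new ∷ tm ∷ [])) ≡ true →
  ∃₂ λ (xs : Vec Bit n) rest → r ≡ bits xs ++ rest
owners-sound N j zero l ln r _ s = [] , r , refl
owners-sound N (suc j) (suc n) l ln [] _ s =
  contradiction (trans (sym s) (failed-iterate (failed-stays (copy-body {0} to-owners) N) j _ refl)) true≢false
owners-sound N (suc j) (suc n) l ln (x ∷ r) (s≤s n≤j) s with owners-sound N j n (x ∷ l) (𝟏 ∷ ln) r n≤j s
... | xs , rest , refl = x ∷ xs , rest , refl

targets-sound : ∀ N j n l ln r → n ≤ j →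
  passed (iterate j (⟪ copy-body {0} to-targets ⟫ N)
    ((true , idle i ac) , (l , r) ∷ (ln , ones n) ∷ own ∷ tgt ∷ src ∷ con ∷ set ∷ new ∷ tm ∷ [])) ≡ true →
  ∃₂ λ (xs : Vec Bit n) rest → r ≡ bits xs ++ rest
targets-sound N j zero l ln r _ s = [] , r , refl
targets-sound N (suc j) (suc n) l ln [] _ s =
  contradiction (trans (sym s) (failed-iterate (failed-stays (copy-body {0} to-targets) N) j _ refl)) true≢false
targets-sound N (suc j) (suc n) l ln (x ∷ r) (s≤s n≤j) s with targets-sound N j n (x ∷ l) (𝟏 ∷ ln) r n≤j s
... | xs , rest , refl = x ∷ xs , rest , refl

input-to-constraints-run : ∀ N r l lc →
  iterate (length r) (⟪ move-body {0} W CON ⟫ N)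
    ((true , idle i ac) , (l , r) ∷ nu ∷ own ∷ tgt ∷ src ∷ (lc , []) ∷ set ∷ new ∷ tm ∷ [])
  ≡ ((true , idle i ac) , (r ʳ++ l , []) ∷ nu ∷ own ∷ tgt ∷ src ∷ (r ʳ++ lc , []) ∷ set ∷ new ∷ tm ∷ [])
input-to-constraints-run N []      l lc = refl
input-to-constraints-run N (x ∷ r) l lc = input-to-constraints-run N r (x ∷ l) (x ∷ lc)

full-skip : ∀ {s n} l → s < n → is-just (scanned (skip s (l , ones n))) ≡ true
full-skip {zero}  {suc n} l _         = refl
full-skip {suc s} {suc n} l (s≤s s<n) = full-skip (𝟏 ∷ l) s<n

skip-full : ∀ s n l → is-just (scanned (skip s (l , ones n))) ≡ true → s < n
skip-full zero    (suc n) l _ = s≤s z≤n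
skip-full (suc s) zero    l e = contradiction (trans (sym e) (cong (is-just ∘ scanned) (iterate-fixed {f = perform advance} refl s))) true≢false
skip-full zero    zero    l ()
skip-full (suc s) (suc n) l e = s≤s (skip-full s n (𝟏 ∷ l) e)

empty-tapes : ∀ {n} → Vec Zipper n
empty-tapes = Vec.replicate _ ([] , [])

initial-memory : List Bit → Memory
initial-memory v = (true , idle false false) , ([] , v) ∷ empty-tapes

rewind-list : ∀ {k N} j {q zs} xs → length xs ≤ N → lookup zs j ≡ (xs ʳ++ [] , []) →
              Run {suc k} N (rewind j) (q , zs) (q , updateAt zs j (λ _ → [] , xs))
rewind-list j xs xs≤N e = rewind-run j e (≤-trans (≤-reflexive (length-traversed xs)) xs≤N) (unwind xs)

ones≤ : ∀ {n N} → n ≤ N → length (ones n) ≤ N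
ones≤ {n} n≤N = ≤-trans (≤-reflexive (length-ones n)) n≤N

bits≤ : ∀ {n N} (xs : Vec Bit n) → n ≤ N → length (bits xs) ≤ N
bits≤ xs n≤N = ≤-trans (≤-reflexive (length-bits xs)) n≤N

length-unary : ∀ n → length (encodeUnary n) ≡ suc n
length-unary zero    = refl
length-unary (suc n) = cong suc (length-unary n)

module Reading (N : ℕ) where

  unary-bound : ∀ n {rest} → length (encodeUnary n ++ rest) ≤ N → n < N
  unary-bound n le = ≤-trans (≤-trans (≤-reflexive (sym (length-unary n))) (length-++-≤ˡ (encodeUnary n))) le

  rest-bound : ∀ xs {rest : List Bit} → length (xs ++ rest) ≤ N → length rest ≤ N
  rest-bound xs {rest} le = ≤-trans (length-++-≤ʳ rest {xs}) le

  read-size : ∀ {k} n rest → suc n ≤ N →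
    Run {suc k} N (unary size-unary) (initial-memory (encodeUnary n ++ rest))
      ((true , idle false false) , (encodeUnary n ʳ++ [] , rest) ∷ (ones n ʳ++ [] , []) ∷ empty-tapes)
  read-size n rest n<N = run refl ▹ loop-run n<N (size-run N n [] [] rest) refl ▹ run refl

  read-source : ∀ {k} s l nu rest → suc s ≤ N →
    Run {suc k} N (unary source-unary) ((true , idle false false) , (l , encodeUnary s ++ rest) ∷ nu ∷ empty-tapes)
      ((true , idle false false) , (encodeUnary s ʳ++ l , rest) ∷ skip s nu ∷ ([] , []) ∷ ([] , []) ∷ (ones s ʳ++ [] , []) ∷ empty-tapes)
  read-source s l nu rest s<N = run refl ▹ loop-run s<N (source-run N s l [] rest) refl ▹ run refl

  rewind-skipped : ∀ {k zs q} s n → n ≤ N → lookup zs NU ≡ skip s ([] , ones n) →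
    Run {suc k} N (rewind NU) (q , zs) (q , updateAt zs NU (λ _ → [] , ones n))
  rewind-skipped s n n≤N e = rewind-run NU e
    (≤-trans (left≤whole (skip s ([] , ones n))) (≤-trans (≤-reflexive (cong length (whole-skip s ([] , ones n)))) (ones≤ n≤N)))
    (whole-skip s ([] , ones n))

  module _ {n s : ℕ} (os fs : Vec Bit n) (r : List Bit) where

    header-input : List Bit
    header-input = encodeUnary n ++ encodeUnary s ++ bits os ++ bits fs ++ r

    after-header : Zipper → Zipper → Memory
    after-header w nu =
      (true , idle false false) , w ∷ nu ∷ ([] , bits os) ∷ ([] , bits fs) ∷ ([] , ones s) ∷ ([] , r) ∷ ([] , bits fs) ∷ ([] , []) ∷ ([] , []) ∷ []

    header-run : ∀ {k} → s < n → length header-input ≤ N → ∃₂ λ w nu → Run {suc k} N header (initial-memory header-input) (after-header w nu)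
    header-run s<n v≤N = _ , _ ,
      (read-size n _ n<N ▹ rewind-list NU (ones n) (ones≤ n≤N) refl ▹
       read-source s (encodeUnary n ʳ++ []) _ _ (≤-trans s<n n≤N) ▹ check-run (full-skip [] s<n) ▹
       rewind-skipped s n n≤N refl ▹ rewind-list SRC (ones s) (ones≤ (≤-trans (<⇒≤ s<n) n≤N)) refl ▹
       loop-run n≤N (owners-run N os _ [] [] _) refl ▹ rewind-list NU (ones n) (ones≤ n≤N) refl ▹ rewind-list OWN (bits os) (bits≤ os n≤N) refl ▹
       loop-run n≤N (targets-run N fs _ [] [] [] r) refl ▹ rewind-list TGT (bits fs) (bits≤ fs n≤N) refl ▹ rewind-list SET (bits fs) (bits≤ fs n≤N) refl ▹
       loop-run r≤N (input-to-constraints-run N r _ []) refl ▹ rewind-list CON r r≤N refl)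
      where
      n<N : n < N
      n<N = unary-bound n v≤N
      n≤N : n ≤ N
      n≤N = <⇒≤ n<N
      r≤N : length r ≤ N
      r≤N = rest-bound (bits fs) (rest-bound (bits os) (rest-bound (encodeUnary s) (rest-bound (encodeUnary n) v≤N)))

  record HeaderOf (v : List Bit) : Set where
    constructor header-of
    field
      {n s}   : ℕ
      s<n     : s < n
      os fs   : Vec Bit n
      r       : List Bit
      input≡  : v ≡ header-input {n} {s} os fs r

  header-sound : ∀ {k} v → length v ≤ N → Passes {suc k} N header (initial-memory v) → HeaderOf v
  header-sound v v≤N P with size-sound N N [] v (Passes.success (initially P ⊳ run refl ⊳ run refl))
  ... | n , v₁ , refl with unary-bound n v≤N | rest-bound (encodeUnary n) v≤N
  ... | n<N | v₁≤N with P ⊳ read-size n v₁ n<N ⊳ rewind-list NU (ones n) (ones≤ (<⇒≤ n<N)) refl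
  ... | P₁ with source-sound N N (encodeUnary n ʳ++ []) v₁ (Passes.success (initially P₁ ⊳ run refl ⊳ run refl))
  ... | s , v₂ , refl with unary-bound s v₁≤N
  ... | s<N with P₁ ⊳ read-source s (encodeUnary n ʳ++ []) _ v₂ s<N
  ... | P₂ with started (P₂ ⊳ run refl)
  ... | full with skip-full s n [] full
  ... | s<n with P₂ ⊳ check-run full ⊳
        rewind-skipped s n (<⇒≤ n<N) refl ⊳ rewind-list SRC (ones s) (ones≤ (<⇒≤ s<N)) refl
  ... | P₃ with owners-sound N N n _ [] v₂ (<⇒≤ n<N) (Passes.success (initially P₃))
  ... | os , v₃ , refl with P₃ ⊳ loop-run (<⇒≤ n<N) (owners-run N os _ [] [] v₃) refl ⊳ rewind-list NU (ones n) (ones≤ (<⇒≤ n<N)) refl ⊳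
        rewind-list OWN (bits os) (bits≤ os (<⇒≤ n<N)) refl
  ... | P₄ with targets-sound N N n _ [] v₃ (<⇒≤ n<N) (Passes.success (initially P₄))
  ... | fs , r , refl = header-of s<n os fs r refl

-- Counting the time in binary

bumped : Bit → List Bit → List Bit
bumped c []      = c ∷ []
bumped c (x ∷ t) = if hasBit c (just x) then opposite c ∷ bumped c t else c ∷ t

-- Where the head stops depends on the carry; the rewind that follows needs only the whole contents.
bump-steps : ∀ N c l t → ∃₂ λ j z → j ≤ length (bumped c t) × whole z ≡ l ʳ++ bumped c t ×
  iterate j (⟪ bump-body {0} c ⟫ N) ((true , regs true i a₁ a₂ a₃ a₄ a₅ ac) , w ∷ nu ∷ own ∷ tgt ∷ src ∷ con ∷ set ∷ new ∷ (l , t) ∷ [])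
    ≡ ((true , regs false i a₁ a₂ a₃ a₄ a₅ ac) , w ∷ nu ∷ own ∷ tgt ∷ src ∷ con ∷ set ∷ new ∷ z ∷ [])
bump-steps N 𝟎 l []      = 1 , _ , ≤-refl , refl , refl
bump-steps N 𝟏 l []      = 1 , _ , ≤-refl , refl , refl
bump-steps N 𝟎 l (𝟏 ∷ t) = 1 , _ , s≤s z≤n , refl , refl
bump-steps N 𝟏 l (𝟎 ∷ t) = 1 , _ , s≤s z≤n , refl , refl
bump-steps N 𝟎 l (𝟎 ∷ t) =
  let j , z , j≤ , z≡ , e = bump-steps N 𝟎 (𝟏 ∷ l) t in suc j , z , s≤s j≤ , z≡ , e
bump-steps N 𝟏 l (𝟏 ∷ t) =
  let j , z , j≤ , z≡ , e = bump-steps N 𝟏 (𝟎 ∷ l) t in suc j , z , s≤s j≤ , z≡ , e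

bump-run : ∀ {n} N c t → length (bumped c t) ≤ N →
  Run {suc n} N (bump c)
    ((true , idle i ac) , w ∷ nu ∷ own ∷ tgt ∷ src ∷ con ∷ set ∷ new ∷ ([] , t) ∷ [])
    ((true , idle i ac) , w ∷ nu ∷ own ∷ tgt ∷ src ∷ con ∷ set ∷ new ∷ ([] , bumped c t) ∷ [])
bump-run N c t t≤N =
  let j , z , j≤ , z≡ , e = bump-steps N c [] t
  in run refl ▹ loop-run (≤-trans j≤ t≤N) e refl ▹
     rewind-run TIME refl (≤-trans (left≤whole z) (≤-trans (≤-reflexive (cong length z≡)) t≤N)) z≡

value : List Bit → ℕ
value = fromDigits

value-increment : ∀ t → value (bumped 𝟏 t) ≡ suc (value t)
value-increment []      = refl
value-increment (𝟎 ∷ t) = refl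
value-increment (𝟏 ∷ t) = cong (_* 2) (value-increment t)

length-increment : ∀ t → length (bumped 𝟏 t) ≤ suc (length t)
length-increment []      = ≤-refl
length-increment (𝟎 ∷ t) = n≤1+n _
length-increment (𝟏 ∷ t) = s≤s (length-increment t)

-- High zeros are kept, so the time never outgrows the N cells that a rewind can cover.
value-decrement : ∀ t {v} → value t ≡ suc v → value (bumped 𝟎 t) ≡ v × length (bumped 𝟎 t) ≡ length t
value-decrement (𝟏 ∷ t) e = suc-injective e , refl
value-decrement (𝟎 ∷ t) e with value t in eq
value-decrement (𝟎 ∷ t) refl | suc u with value-decrement t eq
... | v≡ , l≡ = cong (λ u → suc (u * 2)) v≡ , cong suc l≡

clock-value : ∀ j t → value (iterate j (bumped 𝟏) t) ≡ j + value t
clock-value zero    t = refl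
clock-value (suc j) t = trans (clock-value j (bumped 𝟏 t)) (trans (cong (j +_) (value-increment t)) (+-suc j (value t)))

clock-length : ∀ j t → length (iterate j (bumped 𝟏) t) ≤ j + length t
clock-length zero    t = ≤-refl
clock-length (suc j) t = ≤-trans (clock-length j (bumped 𝟏 t)) (≤-trans (+-monoʳ-≤ j (length-increment t)) (≤-reflexive (+-suc j (length t))))

locate-steps : ∀ N s ls →
  iterate s (⟪ locate-body {0} ⟫ N) ((true , idle i ac) , w ∷ nu ∷ own ∷ tgt ∷ (ls , ones s) ∷ con ∷ set ∷ new ∷ tm ∷ [])
    ≡ ((true , idle i ac) , w ∷ nu ∷ own ∷ tgt ∷ (ones s ʳ++ ls , []) ∷ con ∷ skip s set ∷ new ∷ tm ∷ [])
locate-steps N zero    ls = refl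
locate-steps N (suc s) ls = locate-steps N s (𝟏 ∷ ls)

scanned-skip : ∀ {n} (xs : Vec Bit n) (v : Fin n) l → scanned (skip (toℕ v) (l , bits xs)) ≡ just (lookup xs v)
scanned-skip (x ∷ xs) zero    l = refl
scanned-skip (x ∷ xs) (suc v) l = scanned-skip xs v (x ∷ l)

verdict : Prog 4 → List Bit → Bool
verdict q v = passed (⟪ q ⟫ (length v) (initial-memory v))

verdict∈P : ∀ {L : Language} q → (∀ v → verdict q v ≡ true ⇔ L v) → L ∈P
verdict∈P {L} q spec = program∈P {L = L} q (idle false false) Registers-finite spec

-- The run of the whole machine

module Overall (p : Player) where
  open Correctness p
  open Passing p

  module Final {n} (os fs : Vec Bit n) (css : Matrix n n) where

    open Step os fs css public

    timed-sets : ℕ → List Bit → Vec Bit n → Vec Bit n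
    timed-sets zero    t xs = xs
    timed-sets (suc j) t xs = timed-sets j (bumped 𝟎 t) (next-set false (bumped 𝟎 t) xs)

    final-set : ℕ → Vec Bit n
    final-set N = timed-sets N (iterate N (bumped 𝟏) []) (iterate N (next-set true []) (next-set true [] fs))

  module Valid {n} (os fs : Vec Bit n) (css : Matrix n n) (ok : ProperMatrix os css) (N : ℕ) (n≤N : n ≤ N)
               (css≤N : length (encodeMatrix css) ≤ N) where
    open Given os fs css ok using (at; pass-run)
    open Final os fs css

    -- After a pass `NEW` repeats `SET`, so the memory between rounds depends on the set alone. The
    -- pass that `main` makes before the loop brings it into this shape.
    passes-run : ∀ j xs t → length t ≤ N →
      iterate j (⟪ pass {0} p ⟫ N) (at i w nu src xs (bits xs) t)
        ≡ at i w nu src (iterate j (next-set i t) xs) (bits (iterate j (next-set i t) xs)) t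
    passes-run zero    xs t t≤N = refl
    passes-run {i = i} (suc j) xs t t≤N = trans (cong (iterate j (⟪ pass {0} p ⟫ N)) (result (pass-run {k = 0} xs (bits xs) t n≤N css≤N t≤N (≤-reflexive (length-bits xs)))))
                                        (passes-run j (next-set i t xs) t t≤N)

    increments-run : ∀ j xs rn t → length t + j ≤ N →
      iterate j (⟪ bump {0} 𝟏 ⟫ N) (at i w nu src xs rn t) ≡ at i w nu src xs rn (iterate j (bumped 𝟏) t)
    increments-run zero    xs rn t _ = refl
    increments-run (suc j) xs rn t t+j≤N = trans (cong (iterate j (⟪ bump {0} 𝟏 ⟫ N)) (result (bump-run {n = 0} N 𝟏 t (≤-trans (m≤m+n _ j) bound))))
                                                 (increments-run j xs rn (bumped 𝟏 t) bound)
      where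
      bound : length (bumped 𝟏 t) + j ≤ N
      bound = ≤-trans (+-monoˡ-≤ j (length-increment t)) (≤-trans (≤-reflexive (sym (+-suc (length t) j))) t+j≤N)

    timed-run : ∀ j xs t → value t ≡ j → length t ≤ N →
      ∃ λ t′ → iterate j (⟪ bump {2} 𝟎 ⨾ pass {0} p ⟫ N) (at false w nu src xs (bits xs) t)
        ≡ at false w nu src (timed-sets j t xs) (bits (timed-sets j t xs)) t′
    timed-run zero    xs t _ _ = t , refl
    timed-run (suc j) xs t v≡ t≤N =
      let v′≡ , l≡ = value-decrement t v≡
          t′≤N     = ≤-trans (≤-reflexive l≡) t≤N
          xs′      = next-set false (bumped 𝟎 t) xs
          t″ , e   = timed-run j xs′ (bumped 𝟎 t) v′≡ t′≤N
          once     = bump-run {n = 2} N 𝟎 t t′≤N ▹ pass-run {k = 0} xs (bits xs) (bumped 𝟎 t) n≤N css≤N t′≤N (≤-reflexive (length-bits xs))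
      in t″ , trans (cong (iterate j (⟪ bump {2} 𝟎 ⨾ pass {0} p ⟫ N)) (result once)) e

    finish : ∀ {v} (s : Fin n) {w nu} → Run N (header {3}) (initial-memory v) (at false w nu ([] , ones (toℕ s)) fs [] []) →
             passed (⟪ main p ⟫ N (initial-memory v)) ≡ isOne (just (lookup (final-set N) s))
    finish {v} s h = let m , e , passed≡ = whole-run in trans (cong passed (result e)) (trans passed≡ (cong isOne (scanned-skip (final-set N) s [])))
      where
      start : Vec Bit n
      start = next-set true [] fs
      t₀ : List Bit
      t₀ = iterate N (bumped 𝟏) []
      s≤N : toℕ s ≤ N
      s≤N = ≤-trans (<⇒≤ (toℕ<n s)) n≤N
      whole-run : ∃ λ m → Run N (main p) (initial-memory v) m × passed m ≡ isOne (scanned (skip (toℕ s) ([] , bits (final-set N))))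
      whole-run =
        let t′ , timed = timed-run N (iterate N (next-set true []) start) t₀ (trans (clock-value N []) (+-identityʳ N))
                           (≤-trans (clock-length N []) (≤-reflexive (+-identityʳ N)))
        in _ , (h ▹ run refl ▹ pass-run {k = 1} fs [] [] n≤N css≤N z≤n z≤n ▹ run (passes-run N start [] z≤n) ▹
                run (increments-run N _ _ [] ≤-refl) ▹ run refl ▹ run timed ▹
                loop-run s≤N (locate-steps N (toℕ s) []) refl ▹ run refl) , refl

  encoding : ∀ {n} → Fin n → (os fs : Vec Bit n) → Matrix n n → List Bit
  encoding {n} s os fs css = encodeUnary n ++ encodeUnary (toℕ s) ++ bits os ++ bits fs ++ encodeMatrix css

  main-result : ∀ {n} (s : Fin n) (os fs : Vec Bit n) css → ProperMatrix os css → let v = encoding s os fs css in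
    verdict (main p) v ≡ isOne (just (lookup (Final.final-set os fs css (length v)) s))
  main-result {n} s os fs css ok = Valid.finish os fs css ok N (<⇒≤ (unary-bound n ≤-refl))
      (rest-bound (bits fs) (rest-bound (bits os) (rest-bound (encodeUnary (toℕ s)) (rest-bound (encodeUnary n) ≤-refl))))
      s (proj₂ (proj₂ (header-run os fs (encodeMatrix css) (toℕ<n s) ≤-refl)))
    where
    N : ℕ
    N = length (encoding s os fs css)
    open Reading N

  Encodes : List Bit → Set
  Encodes v = ∃ λ n → Σ (Fin n) λ s → ∃₂ λ (os fs : Vec Bit n) → ∃ λ css → v ≡ encoding s os fs css × ProperMatrix os css

  module _ (N : ℕ) where
    open Reading N

    -- The pass before the loop is the witness: its success already means that all constraints were
    -- read and checked and that the input ended there.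
    constraints-of : ∀ {n s} → s < n → (os fs : Vec Bit n) (r : List Bit) → length (header-input {n} {s} os fs r) ≤ N →
      Passes N (main p) (initial-memory (header-input {n} {s} os fs r)) → ∃ λ (css : Matrix n n) → r ≡ encodeMatrix css × ProperMatrix os css
    constraints-of {n} {s} s<n os fs r v≤N P =
      pass-sound {k = 1} os fs fs [] r [] (<⇒≤ (unary-bound n v≤N))
        (rest-bound (bits fs) (rest-bound (bits os) (rest-bound (encodeUnary s) (rest-bound (encodeUnary n) v≤N)))) z≤n z≤n
        (initially (P ⊳ proj₂ (proj₂ (header-run os fs r s<n v≤N)) ⊳ run refl))

    encodes : ∀ {n s} → s < n → (os fs : Vec Bit n) (r : List Bit) →
      (∃ λ (css : Matrix n n) → r ≡ encodeMatrix css × ProperMatrix os css) → Encodes (header-input {n} {s} os fs r)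
    encodes {n} s<n os fs r (css , r≡ , ok) = n , fromℕ< s<n , os , fs , css ,
      cong₂ (λ s r → encodeUnary n ++ encodeUnary s ++ bits os ++ bits fs ++ r) (sym (toℕ-fromℕ< s<n)) r≡ , ok

    header-encodes : ∀ {v} → length v ≤ N → Passes N (main p) (initial-memory v) → HeaderOf v → Encodes v
    header-encodes v≤N P (header-of s<n os fs r refl) = encodes s<n os fs r (constraints-of s<n os fs r v≤N P)

  main-sound : ∀ v → verdict (main p) v ≡ true → Encodes v
  main-sound v success = header-encodes (length v) ≤-refl P (Reading.header-sound (length v) v ≤-refl (initially P))
    where
    P : Passes (length v) (main p) (initial-memory v)
    P = passes success

-- Correctness of the decision procedure

module _ where
  open Equivalence

  -- The invariant of a comparison from the low end: if the low digits compare as at most, the high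
  -- parts must satisfy ≤; if the low digits on the left are greater, the high parts must satisfy <.
  Leq : Bool → ℕ → ℕ → Set
  Leq true  x y = x ≤ y
  Leq false x y = x < y

  even-≤ : ∀ {x y} → x ≤ y ⇔ x * 2 ≤ y * 2
  even-≤ {x} {y} = mk⇔ (*-monoˡ-≤ 2) (*-cancelʳ-≤ x y 2)

  odd-≤ : ∀ {x y} → x ≤ y ⇔ x * 2 ≤ 1 + y * 2
  odd-≤ {x} {y} = mk⇔ (λ le → m≤n⇒m≤1+n (*-monoˡ-≤ 2 le)) back-odd
    where
    back-odd : x * 2 ≤ 1 + y * 2 → x ≤ y
    back-odd le = ≮⇒≥ λ y<x → <-irrefl refl (≤-trans (*-monoˡ-≤ 2 y<x) le)

  even-< : ∀ {x y} → x < y ⇔ 1 + x * 2 ≤ y * 2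
  even-< {x} {y} = mk⇔ (λ lt → ≤-trans (n≤1+n _) (*-monoˡ-≤ 2 lt)) (λ le → ≰⇒> λ y≤x → <-irrefl refl (≤-trans le (*-monoˡ-≤ 2 y≤x)))

  s≤s-⇔ : ∀ {x y} → x ≤ y ⇔ suc x ≤ suc y
  s≤s-⇔ = mk⇔ s≤s ≤-pred

  refine-leq : ∀ r e d x y → Leq (refine r (just e) (just d)) x y ⇔ Leq r (toℕ e + x * 2) (toℕ d + y * 2)
  refine-leq true  𝟎 𝟎 x y = even-≤
  refine-leq true  𝟎 𝟏 x y = odd-≤
  refine-leq true  𝟏 𝟎 x y = even-<
  refine-leq true  𝟏 𝟏 x y = ⇔-trans even-≤ s≤s-⇔
  refine-leq false 𝟎 𝟎 x y = even-<
  refine-leq false 𝟎 𝟏 x y = ⇔-trans even-≤ s≤s-⇔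
  refine-leq false 𝟏 𝟎 x y = even-≤
  refine-leq false 𝟏 𝟏 x y = ⇔-trans even-< s≤s-⇔

  true-leq : ∀ r → r ≡ true ⇔ Leq r 0 0
  true-leq true  = mk⇔ (λ _ → z≤n) (λ _ → refl)
  true-leq false = mk⇔ (λ ()) (λ ())

  leftover-leq : ∀ r t → leftover refine r t ≡ true ⇔ Leq r (value t) 0
  leftover-leq r []      = true-leq r
  leftover-leq r (e ∷ t) = ⇔-trans (leftover-leq (refine r (just e) nothing) t) (refine-leq r e 𝟎 (value t) 0)

  leftover-geq : ∀ r t → leftover refine˘ r t ≡ true ⇔ Leq r 0 (value t)
  leftover-geq r []      = true-leq r
  leftover-geq r (e ∷ t) = ⇔-trans (leftover-geq (refine r nothing (just e)) t) (refine-leq r 𝟎 e 0 (value t))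

  compare-leq : ∀ r l t b → compare refine r (l , t) b ≡ true ⇔ Leq r (value t) (value b)
  compare-leq r l t       []      = leftover-leq r t
  compare-leq r l []      (d ∷ b) = ⇔-trans (compare-leq (refine r nothing (just d)) l [] b) (refine-leq r 𝟎 d 0 (value b))
  compare-leq r l (e ∷ t) (d ∷ b) = ⇔-trans (compare-leq (refine r (just e) (just d)) (e ∷ l) t b) (refine-leq r e d (value t) (value b))

  compare-geq : ∀ r l t b → compare refine˘ r (l , t) b ≡ true ⇔ Leq r (value b) (value t)
  compare-geq r l t       []      = leftover-geq r t
  compare-geq r l []      (d ∷ b) = ⇔-trans (compare-geq (refine r (just d) nothing) l [] b) (refine-leq r d 𝟎 (value b) 0)
  compare-geq r l (e ∷ t) (d ∷ b) = ⇔-trans (compare-geq (refine r (just d) (just e)) (e ∷ l) t b) (refine-leq r d e (value b) (value t))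

  avail-at : ∀ t c → avail false t c ≡ true ⇔ Available c (value t)
  avail-at t never  = mk⇔ (λ ()) (λ ())
  avail-at t always = mk⇔ _ (λ _ → refl)
  avail-at t (x≤ b) = compare-leq true [] t b
  avail-at t (x≥ b) = compare-geq true [] t b

  Eventually : Constraint → Set
  Eventually never  = ⊥
  Eventually always = ⊤
  Eventually (x≤ b) = ⊥
  Eventually (x≥ b) = ⊤

  avail-eventually : ∀ t c → avail true t c ≡ true ⇔ Eventually c
  avail-eventually t never  = mk⇔ (λ ()) (λ ())
  avail-eventually t always = mk⇔ _ (λ _ → refl)
  avail-eventually t (x≤ b) = mk⇔ (λ ()) (λ ())
  avail-eventually t (x≥ b) = mk⇔ _ (λ _ → refl)

  available? : ∀ c i → Dec (Available c i)
  available? never  i = no id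
  available? always i = yes tt
  available? (x≤ b) i = i ≤? value b
  available? (x≥ b) i = value b ≤? i

  eventually? : ∀ c → Dec (Eventually c)
  eventually? never  = no id
  eventually? always = yes tt
  eventually? (x≤ b) = no id
  eventually? (x≥ b) = yes tt

  threshold : Constraint → ℕ
  threshold never  = 0
  threshold always = 0
  threshold (x≤ b) = suc (value b)
  threshold (x≥ b) = value b

  late-available : ∀ c {i} → threshold c ≤ i → Available c i ⇔ Eventually c
  late-available never  le = mk⇔ id id
  late-available always le = mk⇔ id id
  late-available (x≤ b) le = mk⇔ (λ i≤b → <-irrefl refl (≤-trans le i≤b)) (λ ())
  late-available (x≥ b) le = mk⇔ _ (λ _ → le)

  decreasing-to-0 : ∀ {A} → Decreasing A → ∀ i → A i → A 0
  decreasing-to-0 d zero    a = a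
  decreasing-to-0 d (suc i) a = decreasing-to-0 d i (d i a)

  increasing-by : ∀ {A} → Increasing A → ∀ j {i} → A i → A (j + i)
  increasing-by f zero    a = a
  increasing-by f (suc j) a = f _ (increasing-by f j a)

  decreasing-eventually : ∀ c → Decreasing (Available c) → Eventually c → ∀ i → Available c i
  decreasing-eventually always d _ i = tt
  -- If this constraint is decreasing, its availability at its own constant passes down to 0, so the
  -- constant is 0.
  decreasing-eventually (x≥ b) d _ i = ≤-trans (decreasing-to-0 {Available (x≥ b)} d (value b) ≤-refl) z≤n

  increasing-eventually : ∀ c → Increasing (Available c) → ∀ {i} → Available c i → Eventually c
  increasing-eventually always f a = tt
  -- Availability would persist for `suc (value b)` more units of time, beyond the bound.
  increasing-eventually (x≤ b) f a = <-irrefl refl (≤-trans (m≤m+n _ _) (increasing-by {Available (x≤ b)} f (suc (value b)) a))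
  increasing-eventually (x≥ b) f a = tt

  hasOne-true : ∀ b → hasOne true b ≡ true
  hasOne-true []      = refl
  hasOne-true (d ∷ b) = hasOne-true b

  no-ones : ∀ b → hasOne false b ≡ false → value b ≡ 0
  no-ones []      e = refl
  no-ones (𝟎 ∷ b) e = cong (_* 2) (no-ones b e)
  no-ones (𝟏 ∷ b) e = contradiction (trans (sym (hasOne-true b)) e) true≢false

  zero-has-no-ones : ∀ b → value b ≡ 0 → hasOne false b ≡ false
  zero-has-no-ones []      e = refl
  zero-has-no-ones (𝟎 ∷ b) e = zero-has-no-ones b (*-cancelʳ-≡ (value b) 0 2 e)

  proper-decreasing : ∀ c → proper true c ≡ true ⇔ Decreasing (Available c)
  proper-decreasing never  = mk⇔ (λ _ _ ()) (λ _ → refl)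
  proper-decreasing always = mk⇔ _ (λ _ → refl)
  proper-decreasing (x≤ b) = mk⇔ (λ _ i le → ≤-trans (n≤1+n i) le) (λ _ → refl)
  proper-decreasing (x≥ b) with hasOne false b in e
  ... | true  = mk⇔ (λ ()) (λ d → contradiction (trans (sym e) (zero-has-no-ones b (n≤0⇒n≡0 (decreasing-to-0 {Available (x≥ b)} d (value b) ≤-refl)))) true≢false)
  ... | false = mk⇔ (λ _ i _ → ≤-trans (≤-reflexive (no-ones b e)) z≤n) (λ _ → refl)

  proper-increasing : ∀ c → proper false c ≡ true ⇔ Increasing (Available c)
  proper-increasing never  = mk⇔ (λ _ _ ()) (λ _ → refl)
  proper-increasing always = mk⇔ _ (λ _ → refl)
  proper-increasing (x≤ b) = mk⇔ (λ ()) (λ f → ⊥-elim (increasing-eventually (x≤ b) f {value b} ≤-refl))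
  proper-increasing (x≥ b) = mk⇔ (λ _ i le → m≤n⇒m≤1+n le) (λ _ → refl)

  upper-bound : ∀ {n} (f : Fin n → ℕ) → ∃ λ M → ∀ v → f v ≤ M
  upper-bound {zero}  f = 0 , λ ()
  upper-bound {suc n} f with upper-bound (f ∘ suc)
  ... | M , f≤M = f zero ⊔ M , λ { zero → m≤m⊔n (f zero) M ; (suc v) → ≤-trans (f≤M v) (m≤n⊔m (f zero) M) }

  toBit≡𝟏 : ∀ b → toBit b ≡ 𝟏 ⇔ b ≡ true
  toBit≡𝟏 true  = mk⇔ (λ _ → refl) (λ _ → refl)
  toBit≡𝟏 false = mk⇔ (λ ()) (λ ())

  isOne≡true : ∀ b → isOne (just b) ≡ true ⇔ b ≡ 𝟏
  isOne≡true 𝟎 = mk⇔ (λ ()) (λ ())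
  isOne≡true 𝟏 = mk⇔ (λ _ → refl) (λ _ → refl)

  ∨≡true : ∀ a {b} → a ∨ b ≡ true ⇔ (a ≡ true ⊎ b ≡ true)
  ∨≡true true  = mk⇔ (λ _ → inj₁ refl) (λ _ → refl)
  ∨≡true false = mk⇔ inj₂ λ { (inj₁ ()) ; (inj₂ e) → e }

  ∧≡true : ∀ a {b} → a ∧ b ≡ true ⇔ (a ≡ true × b ≡ true)
  ∧≡true true  = mk⇔ (refl ,_) proj₂
  ∧≡true false = mk⇔ (λ ()) proj₁

  implies≡true : ∀ a {b} → not a ∨ b ≡ true ⇔ (a ≡ true → b ≡ true)
  implies≡true true  = mk⇔ (λ e _ → e) (λ f → f refl)
  implies≡true false = mk⇔ (λ _ ()) (λ _ → refl)

-- From computed bit vectors to winning regions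

module Semantics (p : Player) where
  open Equivalence
  open Correctness p
  open Passing p
  open Overall p

  some-successor : ∀ {n} inf t acc (cs : Row n) xs →
    fold-row 𝟎 inf t acc cs xs ≡ true ⇔ (acc ≡ true ⊎ ∃ λ v → avail inf t (lookup cs v) ≡ true × lookup xs v ≡ 𝟏)
  some-successor inf t acc []       []       = mk⇔ inj₁ λ { (inj₁ e) → e ; (inj₂ (() , _)) }
  some-successor inf t acc (c ∷ cs) (x ∷ xs) = mk⇔ there-is found
    where
    IH = some-successor inf t (update 𝟎 inf t acc c x) cs xs
    there-is : fold-row 𝟎 inf t acc (c ∷ cs) (x ∷ xs) ≡ true → _
    there-is e with to IH e
    ... | inj₂ (v , a , s) = inj₂ (suc v , a , s)
    ... | inj₁ e′ with to (∨≡true acc) e′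
    ...   | inj₁ e″ = inj₁ e″
    ...   | inj₂ e″ = let a , s = to (∧≡true (avail inf t c)) e″ in inj₂ (zero , a , to (isOne≡true x) s)
    found : _ → fold-row 𝟎 inf t acc (c ∷ cs) (x ∷ xs) ≡ true
    found (inj₁ e)               = from IH (inj₁ (from (∨≡true acc) (inj₁ e)))
    found (inj₂ (zero , a , s))  = from IH (inj₁ (from (∨≡true acc) (inj₂ (from (∧≡true (avail inf t c)) (a , from (isOne≡true x) s)))))
    found (inj₂ (suc v , a , s)) = from IH (inj₂ (v , a , s))

  all-successors : ∀ {n} inf t acc (cs : Row n) xs →
    fold-row 𝟏 inf t acc cs xs ≡ true ⇔ (acc ≡ true × ∀ v → avail inf t (lookup cs v) ≡ true → lookup xs v ≡ 𝟏)
  all-successors inf t acc []       []       = mk⇔ (λ e → e , λ ()) proj₁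
  all-successors inf t acc (c ∷ cs) (x ∷ xs) = mk⇔ every gathered
    where
    IH = all-successors inf t (update 𝟏 inf t acc c x) cs xs
    every : fold-row 𝟏 inf t acc (c ∷ cs) (x ∷ xs) ≡ true → _
    every e = let e₁ , rest = to IH e ; e₂ , imp = to (∧≡true acc) e₁ in
      e₂ , λ { zero a → to (isOne≡true x) (to (implies≡true (avail inf t c)) imp a) ; (suc v) → rest v }
    gathered : _ → fold-row 𝟏 inf t acc (c ∷ cs) (x ∷ xs) ≡ true
    gathered (e , f) = from IH (from (∧≡true acc) (e , from (implies≡true (avail inf t c)) (λ a → from (isOne≡true x) (f zero a))) , λ v → f (suc v))

  lookup-update-rows : ∀ {m n} inf t (os fs : Vec Bit m) (css : Matrix m n) xs u →
    lookup (update-rows inf t os fs css xs) u ≡ bit-cell inf t xs (lookup os u) (lookup fs u) (lookup css u)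
  lookup-update-rows inf t (o ∷ os) (f ∷ fs) (cs ∷ css) xs zero    = refl
  lookup-update-rows inf t (o ∷ os) (f ∷ fs) (cs ∷ css) xs (suc u) = lookup-update-rows inf t os fs css xs u

  -- One predicate for both kinds of games: declining for player 1 as `p`, improving for player 2.
  Monotone : TemporalGame → Set
  Monotone 𝒢 = ∀ u v → (owner u ≡ p → Decreasing (E u v)) × (owner u ≢ p → Increasing (E u v))
    where open TemporalGame 𝒢

  module ForInstance (G : Instance) where
    open Instance G renaming (target to targets; size to n; source to s)
    open Solving ⟦ G ⟧ (λ u v i → available? (lookup (lookup constraints u) v) i)
    open Limit (λ u v → Eventually (lookup (lookup constraints u) v)) (λ u v → eventually? (lookup (lookup constraints u) v))
    open TemporalGame ⟦ G ⟧ using (Player₁Wins)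

    os fs : Vec Bit n
    os = Vec.map playerBit owners
    fs = Vec.map toBit targets

    open Final os fs constraints

    Represents-set : Vec Bit n → Pred (Fin n) 0ℓ → Set
    Represents-set xs X = ∀ v → lookup xs v ≡ 𝟏 ⇔ X v

    represents-target : Represents-set fs Target
    represents-target v = subst (λ b → b ≡ 𝟏 ⇔ Target v) (sym (lookup-map v toBit targets))
      (⇔-trans (toBit≡𝟏 (lookup targets v)) (mk⇔ (lookup⇒[]= v targets) []=⇒lookup))

    -- `A` stands for the limit graph in the first phase and for the edges at the current time in
    -- the second, so both phases share this lemma.
    represents-pre : ∀ {inf t A X xs} → Represents-set xs X → (∀ u v → avail inf t (lookup (lookup constraints u) v) ≡ true ⇔ A u v) →
                     Represents-set (next-set inf t xs) (Pre A X)
    represents-pre {inf} {t} {A} {X} {xs} rep av u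
      rewrite lookup-update-rows inf t os fs constraints xs u | lookup-map u playerBit owners | lookup-map u toBit targets =
      by-owner (lookup owners u) refl
      where
      cs : Row n
      cs = lookup constraints u
      on-target : isOne (just (toBit (lookup targets u))) ≡ true ⇔ Target u
      on-target = ⇔-trans (isOne≡true _) (⇔-trans (toBit≡𝟏 (lookup targets u)) (mk⇔ (lookup⇒[]= u targets) []=⇒lookup))
      by-owner : ∀ o → lookup owners u ≡ o → bit-cell inf t xs (playerBit o) (toBit (lookup targets u)) cs ≡ 𝟏 ⇔ Pre A X u
      by-owner player₁ e = ⇔-trans (toBit≡𝟏 _) (⇔-trans (∨≡true _) (mk⇔ there-is found))
        where
        there-is : _ → Pre A X u
        there-is (inj₁ h) = hit (to on-target h)
        there-is (inj₂ h) with to (some-successor inf t false cs xs) h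
        ... | inj₂ (v , a , x) = choose e v (to (av u v) a) (to (rep v) x)
        found : Pre A X u → _
        found (hit h)          = inj₁ (from on-target h)
        found (choose _ v a x) = inj₂ (from (some-successor inf t false cs xs) (inj₂ (v , from (av u v) a , from (rep v) x)))
        found (forced e′ _)    = contradiction e′ (player₁≢player₂ e)
      by-owner player₂ e = ⇔-trans (toBit≡𝟏 _) (⇔-trans (∨≡true _) (mk⇔ every gathered))
        where
        every : _ → Pre A X u
        every (inj₁ h) = hit (to on-target h)
        every (inj₂ h) = forced e λ v a → to (rep v) (proj₂ (to (all-successors inf t true cs xs) h) v (from (av u v) a))
        gathered : Pre A X u → _
        gathered (hit h)           = inj₁ (from on-target h)
        gathered (choose e′ v a x) = contradiction e (player₁≢player₂ e′)
        gathered (forced _ f)      = inj₂ (from (all-successors inf t true cs xs) (refl , λ v a → from (rep v) (f v (to (av u v) a))))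

    represents-attractor : ∀ j {k xs} → Represents-set xs (attractor k) → Represents-set (iterate j (next-set true []) xs) (attractor (j + k))
    represents-attractor zero    rep = rep
    represents-attractor (suc j) {k} {xs} rep = subst (λ m → Represents-set (iterate j (next-set true []) (next-set true [] xs)) (attractor m)) (+-suc j k)
      (represents-attractor j {suc k} {next-set true [] xs} (represents-pre {t = []} {xs = xs} rep (λ u v → avail-eventually [] (lookup (lookup constraints u) v))))

    -- The clock is decremented before each pass: starting from `j`, the passes use the edges at
    -- times j - 1 down to 0.
    represents-solution : ∀ a j {k} t xs → value t ≡ j → Represents-set xs (solution a k j) → Represents-set (timed-sets j t xs) (solution a (j + k) 0)
    represents-solution a zero    t xs _  rep = rep
    represents-solution a (suc j) {k} t xs v≡ rep = subst (λ b → Represents-set (timed-sets (suc j) t xs) (solution a b 0)) (+-suc j k)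
      (represents-solution a j {suc k} (bumped 𝟎 t) (next-set false (bumped 𝟎 t) xs) v′≡
        (represents-pre {t = bumped 𝟎 t} {xs = xs} rep (λ u v → subst (λ i → avail false (bumped 𝟎 t) (lookup (lookup constraints u) v) ≡ true ⇔ Available (lookup (lookup constraints u) v) i) v′≡
                                            (avail-at (bumped 𝟎 t) (lookup (lookup constraints u) v)))))
      where
      v′≡ : value (bumped 𝟎 t) ≡ j
      v′≡ = proj₁ (value-decrement t v≡)

    -- The attractor index is `N + 1` because the pass before the loop counts as well.
    represents-final : ∀ N → Represents-set (final-set N) (solution (N + 1) (N + 0) 0)
    represents-final N = represents-solution (N + 1) N {0} (iterate N (bumped 𝟏) []) (iterate N (next-set true []) (next-set true [] fs))
      (trans (clock-value N []) (+-identityʳ N))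
      (represents-attractor N {1} {next-set true [] fs} (represents-pre {t = []} {xs = fs} represents-target (λ u v → avail-eventually [] (lookup (lookup constraints u) v))))

    C : Fin n → Fin n → Constraint
    C u v = lookup (lookup constraints u) v

    solves : Monotone ⟦ G ⟧ → ∀ {a b} → n ≤ a → n ≤ b → solution a b 0 s ⇔ Player₁Wins
    solves mono {a} {b} n≤a n≤b = player-cases p declining improving
      where
      same : ∀ {u v} → lookup owners u ≡ p → Decreasing (Available (C u v))
      same {u} {v} = proj₁ (mono u v)
      other : ∀ {u v} → lookup owners u ≢ p → Increasing (Available (C u v))
      other {u} {v} = proj₂ (mono u v)
      declining : p ≡ player₁ → solution a b 0 s ⇔ Player₁Wins
      declining p≡₁ = Declining-case.solved
        (λ {u} {v} {i} o → dec₁ {u} {v} o i) (λ {u} {v} {i} o → inc₂ {u} {v} o i)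
        (λ {u} {v} {i} o e → decreasing-eventually (C u v) (dec₁ {u} {v} o) e i) (λ {u} {v} o → increasing-eventually (C u v) (inc₂ {u} {v} o)) {a} n≤b
        where
        dec₁ : ∀ {u v} → lookup owners u ≡ player₁ → Decreasing (Available (C u v))
        dec₁ {u} {v} o = same {u} {v} (trans o (sym p≡₁))
        inc₂ : ∀ {u v} → lookup owners u ≡ player₂ → Increasing (Available (C u v))
        inc₂ {u} {v} o = other {u} {v} (λ e → player₁≢player₂ (trans e p≡₁) o)
      improving : p ≡ player₂ → solution a b 0 s ⇔ Player₁Wins
      improving p≡₂ = Improving-case.solved
        (λ {u} {v} {i} o → inc₁ {u} {v} o i) (λ {u} {v} {i} o → dec₂ {u} {v} o i)
        (λ {u} {v} o → increasing-eventually (C u v) (inc₁ {u} {v} o)) (λ {u} {v} {i} o e → decreasing-eventually (C u v) (dec₂ {u} {v} o) e i)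
        (proj₁ horizon) (λ {u} {v} le → late-available (C u v) (≤-trans (proj₂ horizon u v) le)) n≤a n≤b
        where
        inc₁ : ∀ {u v} → lookup owners u ≡ player₁ → Increasing (Available (C u v))
        inc₁ {u} {v} o = other {u} {v} (λ e → player₁≢player₂ o (trans e p≡₂))
        dec₂ : ∀ {u v} → lookup owners u ≡ player₂ → Decreasing (Available (C u v))
        dec₂ {u} {v} o = same {u} {v} (trans o (sym p≡₂))
        row-bound : ∀ u → ∃ λ M → ∀ v → threshold (C u v) ≤ M
        row-bound u = upper-bound (λ v → threshold (C u v))
        horizon : ∃ λ M → ∀ u v → threshold (C u v) ≤ M
        horizon = let M , bound = upper-bound (λ u → proj₁ (row-bound u)) in M , λ u v → ≤-trans (proj₂ (row-bound u) v) (bound u)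

    dec-owner : ∀ o → decreasing-owner p (isOne (just (playerBit o))) ≡ true ⇔ o ≡ p
    dec-owner o = by-players p o
      where
      by-players : ∀ q o → decreasing-owner q (isOne (just (playerBit o))) ≡ true ⇔ o ≡ q
      by-players player₁ player₁ = mk⇔ (λ _ → refl) (λ _ → refl)
      by-players player₁ player₂ = mk⇔ (λ ()) (λ ())
      by-players player₂ player₁ = mk⇔ (λ ()) (λ ())
      by-players player₂ player₂ = mk⇔ (λ _ → refl) (λ _ → refl)

    dec-at : ∀ u → dec (lookup os u) ≡ true ⇔ lookup owners u ≡ p
    dec-at u rewrite lookup-map u playerBit owners = dec-owner (lookup owners u)

    proper⇔monotone : ProperMatrix os constraints ⇔ Monotone ⟦ G ⟧
    proper⇔monotone = mk⇔ to-monotone from-monotone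
      where
      to-monotone : ProperMatrix os constraints → Monotone ⟦ G ⟧
      to-monotone ok u v =
        (λ o → to (proper-decreasing (C u v)) (subst (λ b → proper b (C u v) ≡ true) (from (dec-at u) o) (ok u v))) ,
        (λ o → to (proper-increasing (C u v)) (subst (λ b → proper b (C u v) ≡ true) (¬-not (λ e → o (to (dec-at u) e))) (ok u v)))
      from-monotone : Monotone ⟦ G ⟧ → ProperMatrix os constraints
      from-monotone mono u v with dec (lookup os u) in e
      ... | true  = from (proper-decreasing (C u v)) (proj₁ (mono u v) (to (dec-at u) e))
      ... | false = from (proper-increasing (C u v)) (proj₂ (mono u v) (λ o → true≢false (trans (sym (from (dec-at u) o)) e)))

    encode-players : ∀ {m} (qs : Vec Player m) → encodeVec encodePlayer qs ≡ bits (Vec.map playerBit qs)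
    encode-players []             = refl
    encode-players (player₁ ∷ qs) = cong (𝟎 ∷_) (encode-players qs)
    encode-players (player₂ ∷ qs) = cong (𝟏 ∷_) (encode-players qs)

    encode-sides : ∀ {m} (xs : Vec Side m) → encodeVec encodeSide xs ≡ bits (Vec.map toBit xs)
    encode-sides []             = refl
    encode-sides (outside ∷ xs) = cong (𝟎 ∷_) (encode-sides xs)
    encode-sides (inside ∷ xs)  = cong (𝟏 ∷_) (encode-sides xs)

    encode≡encoding : encode G ≡ encoding s os fs constraints
    encode≡encoding = cong₂ (λ x y → encodeUnary n ++ encodeUnary (toℕ s) ++ x ++ y ++ encodeMatrix constraints)
                            (encode-players owners) (encode-sides targets)

    accepts : Monotone ⟦ G ⟧ → verdict (main p) (encode G) ≡ true ⇔ Player₁Wins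
    accepts mono = subst (λ v → verdict (main p) v ≡ true ⇔ Player₁Wins) (sym encode≡encoding)
      (subst (λ b → b ≡ true ⇔ Player₁Wins) (sym (main-result s os fs constraints (from proper⇔monotone mono)))
        (⇔-trans (isOne≡true _) (⇔-trans (represents-final N s) (solves mono (≤-trans n≤N (m≤m+n N 1)) (≤-trans n≤N (m≤m+n N 0))))))
      where
      N : ℕ
      N = length (encoding s os fs constraints)
      n≤N : n ≤ N
      n≤N = <⇒≤ (Reading.unary-bound N n ≤-refl)

  MonotoneReachability : Language
  MonotoneReachability v = ∃ λ G → encode G ≡ v × Monotone ⟦ G ⟧ × TemporalGame.Player₁Wins ⟦ G ⟧

  bitPlayer : Bit → Player
  bitPlayer 𝟎 = player₁
  bitPlayer 𝟏 = player₂

  playerBit-bitPlayer : ∀ {m} (xs : Vec Bit m) → Vec.map playerBit (Vec.map bitPlayer xs) ≡ xs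
  playerBit-bitPlayer []       = refl
  playerBit-bitPlayer (𝟎 ∷ xs) = cong (𝟎 ∷_) (playerBit-bitPlayer xs)
  playerBit-bitPlayer (𝟏 ∷ xs) = cong (𝟏 ∷_) (playerBit-bitPlayer xs)

  toBit-isOne : ∀ {m} (xs : Vec Bit m) → Vec.map toBit (Vec.map (isOne ∘ just) xs) ≡ xs
  toBit-isOne []       = refl
  toBit-isOne (𝟎 ∷ xs) = cong (𝟎 ∷_) (toBit-isOne xs)
  toBit-isOne (𝟏 ∷ xs) = cong (𝟏 ∷_) (toBit-isOne xs)

  decode : ∀ {v} → Encodes v → ∃ λ G → encode G ≡ v × Monotone ⟦ G ⟧
  decode (n , s , os , fs , css , v≡ , ok) = G ,
    trans (ForInstance.encode≡encoding G) (trans (cong₂ (λ os fs → encoding s os fs css) (playerBit-bitPlayer os) (toBit-isOne fs)) (sym v≡)) ,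
    to (ForInstance.proper⇔monotone G) (subst (λ os → ProperMatrix os css) (sym (playerBit-bitPlayer os)) ok)
    where
    G : Instance
    G = record { size = n ; constraints = css ; owners = Vec.map bitPlayer os ; target = Vec.map (isOne ∘ just) fs ; source = s }

  -- `decode` supplies some monotone instance with code `v`, and `accepts` ties the verdict to the
  -- winner of any such instance.
  accepted⇔ : ∀ v → verdict (main p) v ≡ true ⇔ MonotoneReachability v
  accepted⇔ v = mk⇔ (λ e → sound e (decode (main-sound v e))) complete
    where
    sound : verdict (main p) v ≡ true → (∃ λ G → encode G ≡ v × Monotone ⟦ G ⟧) → MonotoneReachability v
    sound e (G , refl , mono) = G , refl , mono , to (ForInstance.accepts G mono) e
    complete : MonotoneReachability v → verdict (main p) v ≡ true
    complete (G , refl , mono , wins) = from (ForInstance.accepts G mono) wins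

∈P-resp : ∀ {L L′ : Language} → (∀ v → L v ⇔ L′ v) → L ∈P → L′ ∈P
∈P-resp eq (M , c , d , decides) = M , c , d , λ v →
  let b , runs , spec = decides v in b , runs , ⇔-trans spec (eq v)

monotone∈P : ∀ p → Semantics.MonotoneReachability p ∈P
monotone∈P p = verdict∈P {L = Semantics.MonotoneReachability p} (main p) (Semantics.accepted⇔ p)

theorem5 : (DecliningReachability ∈P) × (ImprovingReachability ∈P)
theorem5 = ∈P-resp declining (monotone∈P player₁) , ∈P-resp improving (monotone∈P player₂)
  where
  ≢₁ : ∀ {o} → o ≢ player₁ → o ≡ player₂
  ≢₁ {player₁} ne = contradiction refl ne
  ≢₁ {player₂} ne = refl
  ≢₂ : ∀ {o} → o ≢ player₂ → o ≡ player₁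
  ≢₂ {player₁} ne = refl
  ≢₂ {player₂} ne = contradiction refl ne
  declining : ∀ v → Semantics.MonotoneReachability player₁ v ⇔ DecliningReachability v
  declining v = mk⇔
    (λ (G , e , mono , wins) → G , e , (λ u v → proj₁ (mono u v) , λ o → proj₂ (mono u v) (λ o′ → case trans (sym o) o′ of λ ())) , wins)
    (λ (G , e , decl , wins) → G , e , (λ u v → proj₁ (decl u v) , λ o → proj₂ (decl u v) (≢₁ o)) , wins)
  improving : ∀ v → Semantics.MonotoneReachability player₂ v ⇔ ImprovingReachability v
  improving v = mk⇔
    (λ (G , e , mono , wins) → G , e , (λ u v → (λ o → proj₂ (mono u v) (λ o′ → case trans (sym o) o′ of λ ())) , proj₁ (mono u v)) , wins)
    (λ (G , e , impr , wins) → G , e , (λ u v → proj₂ (impr u v) , λ o → proj₁ (impr u v) (≢₂ o)) , wins)
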